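{- We have $$\frac{(1-t)\exp_{q}(x)}{1-t\,\mathrm{Exp}_{q}(yx)\exp_{q}(x)}=\sum_{n=0}^{\infty}\left(\frac{1+yt}{1-t}\right)^{n}P_{n}^{(\mathrm{inv},\mathrm{lpk},\mathrm{des})}\left(q,\frac{(1+y)^{2}t}{(y+t)(1+yt)},\frac{y+t}{1+yt}\right)\frac{x^{n}}{[n]_{q}!}.$$ Equivalently, $$\sum_{n=0}^{\infty}P_{n}^{(\mathrm{inv},\mathrm{lpk},\mathrm{des})}(q,y,t)\frac{x^{n}}{[n]_{q}!}=\frac{(1-v)\exp_{q}\left(\frac{1-v}{1+uv}x\right)}{1-v\,\mathrm{Exp}_{q}\left(\frac{u(1-v)}{1+uv}x\right)\exp_{q}\left(\frac{1-v}{1+uv}x\right)},$$ where $$u=\frac{1+t^{2}-2yt-(1-t)\sqrt{(1+t)^{2}-4yt}}{2(1-y)t},\qquad v=\frac{(1+t)^{2}-2yt-(1+t)\sqrt{(1+t)^{2}-4yt}}{2yt}.$$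
   Context: $\mathfrak{S}_n$ is the set of permutations $\pi=\pi_1\cdots\pi_n$ of $[n]=\{1,\dots,n\}$. For $\pi\in\mathfrak{S}_n$: $\mathrm{des}(\pi)$ is the number of $i\in[n-1]$ with $\pi_i>\pi_{i+1}$; $\mathrm{lpk}(\pi)$ is the number of left peaks, where $i\in[n-1]$ is a left peak if either $2\le i\le n-1$ and $\pi_{i-1}<\pi_i>\pi_{i+1}$, or $i=1$ and $\pi_1>\pi_2$; $\mathrm{inv}(\pi)$ is the number of pairs $(i,j)$ with $1\le i<j\le n$ and $\pi_i>\pi_j$. For $n\ge1$, $P_n^{(\mathrm{inv},\mathrm{lpk},\mathrm{des})}(q,y,t)=\sum_{\pi\in\mathfrak{S}_n}q^{\mathrm{inv}(\pi)}y^{\mathrm{lpk}(\pi)}t^{\mathrm{des}(\pi)}$, and the $0$th polynomial is $1$. Also $[n]_q!=(1+q)(1+q+q^2)\cdots(1+q+\cdots+q^{n-1})$ (with $[0]_q!=[1]_q!=1$), $\exp_q(x)=\sum_{n\ge0}\frac{x^n}{[n]_q!}$ and $\mathrm{Exp}_q(x)=\sum_{n\ge0}q^{\binom n2}\frac{x^n}{[n]_q!}$. Here $q,y,t,x$ are indeterminates and the identities are identities of formal power series in $x$: in the first, coefficients are rational functions of $q,y,t$; in the second, coefficients are formal power series in $t$ over $\mathbb{Q}(q)[y]$, where $\sqrt{(1+t)^2-4yt}$ is the power series in $t$ over $\mathbb{Q}[y]$ with constant term $1$, so that $u,v$ are formal power series in $t$ over $\mathbb{Q}[y]$. -}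

module Defs where

open import Algebra.Bundles using (RawRing; Semiring; CommutativeRing)
import Algebra.Construct.Pointwise as Pointwise
import Algebra.Definitions.RawSemiring as RawSemiringDefinitions
import Algebra.Morphism.Construct.Composition as Composition
import Algebra.Morphism.RingMonomorphism as RingMonomorphism
open import Algebra.Morphism.Structures using (IsRingHomomorphism; IsRingMonomorphism)
import Algebra.Properties.Group as GroupProperties
import Algebra.Properties.Ring as RingProperties
import Algebra.Solver.Ring.NaturalCoefficients.Default as SemiringSolver
open import Data.Bool.Base using (if_then_else_)
open import Data.Empty using (⊥-elim)
open import Data.Fin.Base using (Fin; zero; suc; toℕ)
import Data.Fin.Properties as Fin
open import Data.List.Base as List using (List; []; _∷_)
open import Data.Nat.Base as ℕ using (ℕ; zero; suc; z≤n; s≤s; _∸_; _⊔_)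
open import Data.Nat.Combinatorics using (_C_)
import Data.Nat.Properties as ℕ
open import Data.Product.Base using (_×_; _,_; ∃-syntax)
open import Data.Rational.Base as ℚ using (ℚ; 0ℚ; 1ℚ)
import Data.Rational.Properties as ℚ
open import Data.Sum.Base using (_⊎_; inj₁; inj₂)
open import Data.Vec.Base as Vec using (Vec; []; _∷_)
open import Data.Vec.Functional as Vector using (Vector)
open import Data.Vec.Relation.Unary.AllPairs using (allPairs?)
open import Function.Base using (_∘_; id)
open import Level using (0ℓ)
import Relation.Binary.PropositionalEquality as ≡
open ≡ using (_≡_)
import Relation.Binary.Reasoning.Setoid as SetoidReasoning
open import Relation.Nullary using (¬_; Dec; yes; no; does; ¬?; contradiction)

------------------------------------------------------------------------
-- Coefficient rings

-- An integral domain in which being zero is decidable.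
record Domain : Set₁ where
  field
    commutativeRing : CommutativeRing 0ℓ 0ℓ
  open CommutativeRing commutativeRing public hiding (zero)
  field
    _≈0?           : ∀ x → Dec (x ≈ 0#)
    1≉0            : ¬ (1# ≈ 0#)
    noZeroDivisors : ∀ {x y} → x * y ≈ 0# → x ≈ 0# ⊎ y ≈ 0#

-- A commutative ring with a total operation giving the inverse of every
-- unit; its value at a non-unit is irrelevant.
record RingWithInverse : Set₁ where
  field
    commutativeRing : CommutativeRing 0ℓ 0ℓ
  open CommutativeRing commutativeRing public hiding (zero)
  infix 9 _⁻¹
  field
    _⁻¹      : Carrier → Carrier
    inverseʳ : ∀ {x y} → x * y ≈ 1# → x * x ⁻¹ ≈ 1#

  open RawSemiringDefinitions (Semiring.rawSemiring semiring) public using (_^_)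

  infixl 7 _/_
  _/_ : Carrier → Carrier → Carrier
  x / y = x * y ⁻¹

record Field : Set₁ where
  field
    domain : Domain
  open Domain domain public
  infix 9 _⁻¹
  field
    _⁻¹      : Carrier → Carrier
    inverseʳ : ∀ {x} → ¬ (x ≈ 0#) → x * x ⁻¹ ≈ 1#

  ringWithInverse : RingWithInverse
  ringWithInverse = record
    { commutativeRing = commutativeRing
    ; _⁻¹             = _⁻¹
    ; inverseʳ        = λ {x} {y} xy≈1 → inverseʳ λ x≈0 →
        1≉0 (trans (sym xy≈1) (trans (*-congʳ x≈0) (zeroˡ y)))
    }

------------------------------------------------------------------------
-- Formal power series R[[X]], given by their coefficient sequences

module PowerSeries (R : CommutativeRing 0ℓ 0ℓ) where

  open CommutativeRing R hiding (zero)
  open RawSemiringDefinitions (Semiring.rawSemiring semiring) using (sum)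
  open SetoidReasoning setoid
  private module + = Pointwise ℕ

  Series : Set
  Series = ℕ → Carrier

  infix 4 _≋_
  _≋_ : Series → Series → Set
  f ≋ g = ∀ n → f n ≈ g n

  constant : Carrier → Series
  constant c zero    = c
  constant c (suc _) = 0#

  X : Series
  X 1 = 1#
  X _ = 0#

  infixl 6 _⊞_
  _⊞_ : Series → Series → Series
  (f ⊞ g) n = f n + g n

  ⊟_ : Series → Series
  (⊟ f) n = - f n

  infixl 7 _⊠_
  _⊠_ : Series → Series → Series
  (f ⊠ g) n = sum {suc n} λ i → f (toℕ i) * g (n ∸ toℕ i)

  -- The substitution X ↦ c X.
  scale : Carrier → Series → Series
  scale c f n = c ^ n * f n
    where open RawSemiringDefinitions (Semiring.rawSemiring semiring) using (_^_)

  private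
    tail : Series → Series
    tail f = f ∘ suc

    0ˢ : Series
    0ˢ _ = 0#

    sum-cong : ∀ {n} {f g : Vector Carrier n} → (∀ i → f i ≈ g i) → sum f ≈ sum g
    sum-cong {zero}  _   = refl
    sum-cong {suc _} f≈g = +-cong (f≈g zero) (sum-cong (f≈g ∘ suc))

    interchange : ∀ a b c d → (a + b) + (c + d) ≈ (a + c) + (b + d)
    interchange = solve 4 (λ a b c d → (a :+ b) :+ (c :+ d) := (a :+ c) :+ (b :+ d)) refl
      where open SemiringSolver commutativeSemiring

  ⊠-cong : ∀ {f g h k} → f ≋ g → h ≋ k → f ⊠ h ≋ g ⊠ k
  ⊠-cong f≋g h≋k n = sum-cong {suc n} λ i → *-cong (f≋g (toℕ i)) (h≋k (n ∸ toℕ i))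

  ⊠-zeroˡ : ∀ {f} g → f ≋ 0ˢ → f ⊠ g ≋ 0ˢ
  ⊠-zeroˡ g f≋0 zero    = trans (+-identityʳ _) (trans (*-congʳ (f≋0 0)) (zeroˡ _))
  ⊠-zeroˡ g f≋0 (suc n) = trans
    (+-cong (trans (*-congʳ (f≋0 0)) (zeroˡ _)) (⊠-zeroˡ g (f≋0 ∘ suc) n))
    (+-identityˡ _)

  ⊠-tailʳ : ∀ f g n → (f ⊠ g) (suc n) ≈ (f ⊠ tail g) n + f (suc n) * g 0
  ⊠-tailʳ f g zero    = +-cong (sym (+-identityʳ _)) (+-identityʳ _)
  ⊠-tailʳ f g (suc n) = trans (+-congˡ (⊠-tailʳ (tail f) g n)) (sym (+-assoc _ _ _))

  ⊠-comm : ∀ f g → f ⊠ g ≋ g ⊠ f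
  ⊠-comm f g zero    = +-congʳ (*-comm _ _)
  ⊠-comm f g (suc n) = begin
    f 0 * g (suc n) + (tail f ⊠ g) n  ≈⟨ +-cong (*-comm _ _) (⊠-comm (tail f) g n) ⟩
    g (suc n) * f 0 + (g ⊠ tail f) n  ≈⟨ +-comm _ _ ⟩
    (g ⊠ tail f) n + g (suc n) * f 0  ≈⟨ ⊠-tailʳ g f n ⟨
    (g ⊠ f) (suc n)                   ∎

  ⊠-distribʳ : ∀ h f g → (f ⊞ g) ⊠ h ≋ (f ⊠ h) ⊞ (g ⊠ h)
  ⊠-distribʳ h f g zero = begin
    (f 0 + g 0) * h 0 + 0#                 ≈⟨ +-cong (distribʳ _ _ _) (sym (+-identityʳ _)) ⟩
    (f 0 * h 0 + g 0 * h 0) + (0# + 0#)    ≈⟨ interchange _ _ _ _ ⟩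
    (f 0 * h 0 + 0#) + (g 0 * h 0 + 0#)    ∎
  ⊠-distribʳ h f g (suc n) =
    trans (+-cong (distribʳ _ _ _) (⊠-distribʳ h (tail f) (tail g) n)) (interchange _ _ _ _)

  scalarˡ : ∀ c f g n → ((λ k → c * f k) ⊠ g) n ≈ c * (f ⊠ g) n
  scalarˡ c f g zero    = begin
    (c * f 0) * g 0 + 0#  ≈⟨ +-identityʳ _ ⟩
    (c * f 0) * g 0       ≈⟨ *-assoc _ _ _ ⟩
    c * (f 0 * g 0)       ≈⟨ *-congˡ (+-identityʳ _) ⟨
    c * (f 0 * g 0 + 0#)  ∎
  scalarˡ c f g (suc n) =
    trans (+-cong (*-assoc _ _ _) (scalarˡ c (tail f) g n)) (sym (distribˡ _ _ _))

  ⊠-assoc : ∀ f g h → (f ⊠ g) ⊠ h ≋ f ⊠ (g ⊠ h)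
  ⊠-assoc f g h zero    = begin
    (f 0 * g 0 + 0#) * h 0 + 0#  ≈⟨ +-congʳ (*-congʳ (+-identityʳ _)) ⟩
    (f 0 * g 0) * h 0 + 0#       ≈⟨ +-congʳ (*-assoc _ _ _) ⟩
    f 0 * (g 0 * h 0) + 0#       ≈⟨ +-congʳ (*-congˡ (+-identityʳ _)) ⟨
    f 0 * (g 0 * h 0 + 0#) + 0#  ∎
  ⊠-assoc f g h (suc n) = begin
    (f 0 * g 0 + 0#) * h (suc n) + (((λ k → f 0 * tail g k) ⊞ (tail f ⊠ g)) ⊠ h) n
      ≈⟨ +-cong (trans (*-congʳ (+-identityʳ _)) (*-assoc _ _ _))
                (⊠-distribʳ h (λ k → f 0 * tail g k) (tail f ⊠ g) n) ⟩
    f 0 * (g 0 * h (suc n)) + (((λ k → f 0 * tail g k) ⊠ h) n + ((tail f ⊠ g) ⊠ h) n)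
      ≈⟨ +-congˡ (+-cong (scalarˡ (f 0) (tail g) h n) (⊠-assoc (tail f) g h n)) ⟩
    f 0 * (g 0 * h (suc n)) + (f 0 * (tail g ⊠ h) n + (tail f ⊠ (g ⊠ h)) n)
      ≈⟨ +-assoc _ _ _ ⟨
    (f 0 * (g 0 * h (suc n)) + f 0 * (tail g ⊠ h) n) + (tail f ⊠ (g ⊠ h)) n
      ≈⟨ +-congʳ (distribˡ _ _ _) ⟨
    f 0 * (g 0 * h (suc n) + (tail g ⊠ h) n) + (tail f ⊠ (g ⊠ h)) n
      ∎

  ⊠-constantˡ : ∀ c f n → (constant c ⊠ f) n ≈ c * f n
  ⊠-constantˡ c f zero    = +-identityʳ _
  ⊠-constantˡ c f (suc n) = trans (+-congˡ (⊠-zeroˡ f (λ _ → refl) n)) (+-identityʳ _)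

  ⊠-identityˡ : ∀ f → constant 1# ⊠ f ≋ f
  ⊠-identityˡ f n = trans (⊠-constantˡ 1# f n) (*-identityˡ _)

  private
    constant-0 : constant 0# ≋ 0ˢ
    constant-0 zero    = refl
    constant-0 (suc _) = refl

  seriesRing : CommutativeRing 0ℓ 0ℓ
  seriesRing = record
    { Carrier = Series ; _≈_ = _≋_ ; _+_ = _⊞_ ; _*_ = _⊠_ ; -_ = ⊟_
    ; 0# = 0ˢ ; 1# = constant 1#
    ; isCommutativeRing = record
      { isRing = record
        { +-isAbelianGroup = +.isAbelianGroup +-isAbelianGroup
        ; *-cong           = ⊠-cong
        ; *-assoc          = ⊠-assoc
        ; *-identity       = ⊠-identityˡ , λ f n → trans (⊠-comm f (constant 1#) n) (⊠-identityˡ f n)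
        ; distrib          = (λ f g h n → trans (⊠-comm f (g ⊞ h) n) (trans (⊠-distribʳ f g h n)
                                (+-cong (⊠-comm g f n) (⊠-comm h f n))))
                           , ⊠-distribʳ
        }
      ; *-comm = ⊠-comm
      }
    }

-- A power series is a unit exactly when its constant term is.
module PowerSeriesInverse (R : RingWithInverse) where

  open RingWithInverse R
  open RawSemiringDefinitions (Semiring.rawSemiring semiring) using (sum)
  open PowerSeries commutativeRing public

  private
    -- The coefficients n, n − 1, …, 0 of 1/f.
    inverseCoefficients : Series → ∀ n → Vector Carrier (suc n)
    inverseCoefficients f zero    = f 0 ⁻¹ Vector.∷ Vector.[]
    inverseCoefficients f (suc n) =
      (- (f 0 ⁻¹ * sum λ i → f (suc (toℕ i)) * inverseCoefficients f n i))
        Vector.∷ inverseCoefficients f n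

  inverse : Series → Series
  inverse f n = inverseCoefficients f n zero

  private
    coefficient : ∀ f n i → inverseCoefficients f n i ≡ inverse f (n ∸ toℕ i)
    coefficient f n       zero    = ≡.refl
    coefficient f (suc n) (suc i) = coefficient f n i

    sum-cong-≡ : ∀ {n} {f g : Vector Carrier n} → (∀ i → f i ≡ g i) → sum f ≡ sum g
    sum-cong-≡ {zero}  _   = ≡.refl
    sum-cong-≡ {suc _} f≡g = ≡.cong₂ _+_ (f≡g zero) (sum-cong-≡ (f≡g ∘ suc))

  ⊠-inverseʳ : ∀ f → f 0 * f 0 ⁻¹ ≈ 1# → f ⊠ inverse f ≋ constant 1#
  ⊠-inverseʳ f unit zero    = trans (+-identityʳ _) unit
  ⊠-inverseʳ f unit (suc n) = begin
    f 0 * (- (f 0 ⁻¹ * s)) + (f ∘ suc ⊠ inverse f) n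
      ≡⟨ ≡.cong (f 0 * (- (f 0 ⁻¹ * s)) +_)
           (sum-cong-≡ {suc n} λ i → ≡.cong (f (suc (toℕ i)) *_) (coefficient f n i)) ⟨
    f 0 * (- (f 0 ⁻¹ * s)) + s      ≈⟨ +-congʳ (-‿distribʳ-* _ _) ⟨
    - (f 0 * (f 0 ⁻¹ * s)) + s      ≈⟨ +-congʳ (-‿cong (*-assoc _ _ _)) ⟨
    - (f 0 * f 0 ⁻¹ * s) + s        ≈⟨ +-congʳ (-‿cong (trans (*-congʳ unit) (*-identityˡ _))) ⟩
    - s + s                         ≈⟨ -‿inverseˡ s ⟩
    0#                              ∎
    where
    open SetoidReasoning setoid
    open RingProperties ring using (-‿distribʳ-*)
    s : Carrier
    s = sum {suc n} λ i → f (suc (toℕ i)) * inverseCoefficients f n i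

  seriesRingWithInverse : RingWithInverse
  seriesRingWithInverse = record
    { commutativeRing = seriesRing
    ; _⁻¹             = inverse
    ; inverseʳ        = λ {f} fg≋1 →
        ⊠-inverseʳ f (inverseʳ (trans (sym (+-identityʳ _)) (fg≋1 0)))
    }

------------------------------------------------------------------------
-- Polynomials R[X], as the power series with finitely many non-zero
-- coefficients; `bound` is not part of the identity of a polynomial.

module Polynomials (R : CommutativeRing 0ℓ 0ℓ) where

  open CommutativeRing R hiding (zero)
  open PowerSeries R
  private
    module S = CommutativeRing seriesRing

    Bounded : ℕ → Series → Set
    Bounded N f = ∀ {n} → N ℕ.≤ n → f n ≈ 0#

    ⊠-bounded : ∀ M {N f g} → Bounded M f → Bounded N g → Bounded (M ℕ.+ N) (f ⊠ g)
    ⊠-bounded zero    {g = g} f≈0 g≈0 {n} _ = ⊠-zeroˡ g (λ k → f≈0 {k} z≤n) n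
    ⊠-bounded (suc M) {N} f≈0 g≈0 {suc n} (s≤s M+N≤n) = trans
      (+-cong (trans (*-congˡ (g≈0 (ℕ.m≤n⇒m≤1+n (ℕ.≤-trans (ℕ.m≤n+m N M) M+N≤n)))) (zeroʳ _))
              (⊠-bounded M (λ {k} M≤k → f≈0 {suc k} (s≤s M≤k)) g≈0 M+N≤n))
      (+-identityˡ _)

  record Polynomial : Set where
    constructor polynomial
    field
      coeff    : Series
      bound    : ℕ
      vanishes : ∀ {n} → bound ℕ.≤ n → coeff n ≈ 0#
  open Polynomial public

  constantᴾ : Carrier → Polynomial
  constantᴾ c = polynomial (constant c) 1 λ { (s≤s _) → refl }

  Xᴾ : Polynomial
  Xᴾ = polynomial X 2 λ { (s≤s (s≤s _)) → refl }

  private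
    polynomialRawRing : RawRing 0ℓ 0ℓ
    polynomialRawRing = record
      { Carrier = Polynomial
      ; _≈_ = λ p r → coeff p ≋ coeff r
      ; _+_ = λ p r → polynomial (coeff p ⊞ coeff r) (bound p ⊔ bound r) λ b≤n → trans
          (+-cong (vanishes p (ℕ.m⊔n≤o⇒m≤o (bound p) (bound r) b≤n))
                  (vanishes r (ℕ.m⊔n≤o⇒n≤o (bound p) (bound r) b≤n)))
          (+-identityˡ _)
      ; _*_ = λ p r → polynomial (coeff p ⊠ coeff r) (bound p ℕ.+ bound r)
          (⊠-bounded (bound p) (vanishes p) (vanishes r))
      ; -_  = λ p → polynomial (⊟ coeff p) (bound p) λ b≤n →
          trans (-‿cong (vanishes p b≤n)) (RingProperties.-0#≈0# ring)
      ; 0#  = polynomial (λ _ → 0#) 0 λ _ → refl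
      ; 1#  = constantᴾ 1#
      }

    coeff-mono : IsRingMonomorphism polynomialRawRing S.rawRing coeff
    coeff-mono = record
      { isRingHomomorphism = record
        { isSemiringHomomorphism = record
          { isNearSemiringHomomorphism = record
            { +-isMonoidHomomorphism = record
              { isMagmaHomomorphism = record
                { isRelHomomorphism = record { cong = id }
                ; homo = λ _ _ → S.refl }
              ; ε-homo = S.refl }
            ; *-homo = λ _ _ → S.refl }
          ; 1#-homo = S.refl }
        ; -‿homo = λ _ → S.refl }
      ; injective = id
      }

  polynomialRing : CommutativeRing 0ℓ 0ℓ
  polynomialRing = record
    { isCommutativeRing = RingMonomorphism.isCommutativeRing coeff-mono S.isCommutativeRing }

  constantᴾ-isRingHomomorphism :
    IsRingHomomorphism (CommutativeRing.rawRing R) polynomialRawRing constantᴾ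
  constantᴾ-isRingHomomorphism = record
    { isSemiringHomomorphism = record
      { isNearSemiringHomomorphism = record
        { +-isMonoidHomomorphism = record
          { isMagmaHomomorphism = record
            { isRelHomomorphism = record
              { cong = λ x≈y → λ { zero → x≈y ; (suc _) → refl } }
            ; homo = λ _ _ → λ { zero → refl ; (suc _) → sym (+-identityˡ _) } }
          ; ε-homo = λ { zero → refl ; (suc _) → refl } }
        ; *-homo = λ x y → λ
          { zero    → sym (+-identityʳ _)
          ; (suc n) → sym (trans (⊠-constantˡ x (constant y) (suc n)) (zeroʳ _)) } }
      ; 1#-homo = λ _ → refl }
    ; -‿homo = λ _ → λ { zero → refl ; (suc _) → sym (RingProperties.-0#≈0# ring) } }

-- The map R[X] → S[X] applying a ring homomorphism to the coefficients.
mapPolynomial : ∀ {R S : CommutativeRing 0ℓ 0ℓ}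
  {h : CommutativeRing.Carrier R → CommutativeRing.Carrier S} →
  IsRingHomomorphism (CommutativeRing.rawRing R) (CommutativeRing.rawRing S) h →
  Polynomials.Polynomial R → Polynomials.Polynomial S
mapPolynomial {R} {S} {h} isHom (Polynomials.polynomial f N vanishes) =
  Polynomials.polynomial (h ∘ f) N λ N≤n →
    CommutativeRing.trans S (⟦⟧-cong (vanishes N≤n)) 0#-homo
  where open IsRingHomomorphism isHom

module PolynomialDomain (D : Domain) where

  open Domain D
  open PowerSeries commutativeRing
  open Polynomials commutativeRing public

  private
    module P = CommutativeRing polynomialRing

    Leading : Series → ℕ → Set
    Leading f d = ¬ (f d ≈ 0#) × (∀ {n} → d ℕ.< n → f n ≈ 0#)

    leading : ∀ N f → (∀ {n} → N ℕ.≤ n → f n ≈ 0#) → (∀ n → f n ≈ 0#) ⊎ ∃[ d ] Leading f d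
    leading zero    f f≈0 = inj₁ λ _ → f≈0 z≤n
    leading (suc N) f f≈0 with f N ≈0?
    ... | no  fN≉0 = inj₂ (N , fN≉0 , f≈0)
    ... | yes fN≈0 = leading N f λ N≤n → case-≤ N≤n
      where
      case-≤ : ∀ {n} → N ℕ.≤ n → f n ≈ 0#
      case-≤ N≤n with ℕ.m≤n⇒m<n∨m≡n N≤n
      ... | inj₁ N<n    = f≈0 N<n
      ... | inj₂ ≡.refl = fN≈0

    ⊠-leading : ∀ d e {f g} →
      (∀ {n} → d ℕ.< n → f n ≈ 0#) → (∀ {n} → e ℕ.< n → g n ≈ 0#) →
      (f ⊠ g) (d ℕ.+ e) ≈ f d * g e
    ⊠-leading zero zero _ _ = +-identityʳ _
    ⊠-leading zero (suc e) {f} {g} f≈0 _ =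
      trans (+-congˡ (⊠-zeroˡ {f ∘ suc} g (λ _ → f≈0 (s≤s z≤n)) e)) (+-identityʳ _)
    ⊠-leading (suc d) e f≈0 g≈0 = trans
      (+-cong (trans (*-congˡ (g≈0 (s≤s (ℕ.m≤n+m e d)))) (zeroʳ _))
              (⊠-leading d e (f≈0 ∘ s≤s) g≈0))
      (+-identityˡ _)

    ≈0?ᴾ : ∀ p → Dec (p P.≈ P.0#)
    ≈0?ᴾ p with leading (bound p) (coeff p) (vanishes p)
    ... | inj₁ p≈0            = yes p≈0
    ... | inj₂ (d , pd≉0 , _) = no λ p≈0 → pd≉0 (p≈0 d)

    noZeroDivisorsᴾ : ∀ {p r} → p P.* r P.≈ P.0# → p P.≈ P.0# ⊎ r P.≈ P.0#
    noZeroDivisorsᴾ {p} {r} pr≈0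
      with leading (bound p) (coeff p) (vanishes p) | leading (bound r) (coeff r) (vanishes r)
    ... | inj₁ p≈0 | _        = inj₁ p≈0
    ... | inj₂ _   | inj₁ r≈0 = inj₂ r≈0
    ... | inj₂ (d , pd≉0 , p≈0) | inj₂ (e , re≉0 , r≈0)
      with noZeroDivisors (trans (sym (⊠-leading d e p≈0 r≈0)) (pr≈0 (d ℕ.+ e)))
    ... | inj₁ pd≈0 = contradiction pd≈0 pd≉0
    ... | inj₂ re≈0 = contradiction re≈0 re≉0

  polynomialDomain : Domain
  polynomialDomain = record
    { commutativeRing = polynomialRing
    ; _≈0?            = ≈0?ᴾ
    ; 1≉0             = λ 1≈0 → 1≉0 (1≈0 0)
    ; noZeroDivisors  = λ {p} {r} → noZeroDivisorsᴾ {p} {r}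
    }

  unit⇒constant : ∀ p r → p P.* r P.≈ P.1# → ∀ n → coeff p (suc n) ≈ 0#
  unit⇒constant p r pr≈1 with leading (bound p) (coeff p) (vanishes p)
                            | leading (bound r) (coeff r) (vanishes r)
  ... | inj₁ p≈0                  | _        = λ n → p≈0 (suc n)
  ... | inj₂ _                    | inj₁ r≈0 = ⊥-elim (1≉0 (trans (sym (pr≈1 0))
                                      (trans (⊠-comm (coeff p) (coeff r) 0) (⊠-zeroˡ (coeff p) r≈0 0))))
  ... | inj₂ (zero  , _    , p≈0) | inj₂ _   = λ _ → p≈0 (s≤s z≤n)
  ... | inj₂ (suc d , pd≉0 , p≈0) | inj₂ (e , re≉0 , r≈0)
    with noZeroDivisors (trans (sym (⊠-leading (suc d) e p≈0 r≈0)) (pr≈1 (suc d ℕ.+ e)))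
  ... | inj₁ pd≈0 = contradiction pd≈0 pd≉0
  ... | inj₂ re≈0 = contradiction re≈0 re≉0

-- The units of K[X] are the non-zero constants.
module PolynomialInverse (K : Field) where

  open Field K
  open PowerSeries commutativeRing
  open PolynomialDomain domain public

  private
    module P = CommutativeRing polynomialRing

    inverseʳᴾ : ∀ {p r} → p P.* r P.≈ P.1# → p P.* constantᴾ (coeff p 0 ⁻¹) P.≈ P.1#
    inverseʳᴾ {p} {r} pr≈1 n =
      trans (⊠-comm (coeff p) (constant p₀⁻¹) n) (trans (⊠-constantˡ p₀⁻¹ (coeff p) n) (at n))
      where
      p₀⁻¹ : Carrier
      p₀⁻¹ = coeff p 0 ⁻¹
      p₀≉0 : ¬ (coeff p 0 ≈ 0#)
      p₀≉0 p₀≈0 = 1≉0 (trans (sym (pr≈1 0))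
        (trans (+-identityʳ _) (trans (*-congʳ p₀≈0) (zeroˡ _))))
      at : ∀ n → p₀⁻¹ * coeff p n ≈ constant 1# n
      at zero    = trans (*-comm _ _) (inverseʳ p₀≉0)
      at (suc n) = trans (*-congˡ (unit⇒constant p r pr≈1 n)) (zeroʳ _)

  polynomialRingWithInverse : RingWithInverse
  polynomialRingWithInverse = record
    { commutativeRing = polynomialRing
    ; _⁻¹             = λ p → constantᴾ (coeff p 0 ⁻¹)
    ; inverseʳ        = λ {p} {r} → inverseʳᴾ {p} {r}
    }

------------------------------------------------------------------------
-- The field of fractions of a domain

module Fractions (D : Domain) where

  open Domain D
  open SetoidReasoning setoid
  open RingProperties ring using (-‿distribˡ-*)
  open SemiringSolver commutativeSemiring

  record Fraction : Set where
    constructor fraction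
    field
      num   : Carrier
      den   : Carrier
      den≉0 : ¬ (den ≈ 0#)
  open Fraction public

  embed : Carrier → Fraction
  embed x = fraction x 1# 1≉0

  private
    *-≉0 : ∀ {x y} → ¬ (x ≈ 0#) → ¬ (y ≈ 0#) → ¬ (x * y ≈ 0#)
    *-≉0 x≉0 y≉0 xy≈0 with noZeroDivisors xy≈0
    ... | inj₁ x≈0 = x≉0 x≈0
    ... | inj₂ y≈0 = y≉0 y≈0

    cancelʳ : ∀ {x y z} → ¬ (z ≈ 0#) → x * z ≈ y * z → x ≈ y
    cancelʳ {x} {y} {z} z≉0 xz≈yz with noZeroDivisors {x - y} {z} (begin
      (x - y) * z        ≈⟨ distribʳ _ _ _ ⟩
      x * z + - y * z    ≈⟨ +-cong xz≈yz (sym (-‿distribˡ-* _ _)) ⟩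
      y * z - y * z      ≈⟨ -‿inverseʳ _ ⟩
      0#                 ∎)
    ... | inj₁ x-y≈0 = GroupProperties.x∙y⁻¹≈ε⇒x≈y +-group _ _ x-y≈0
    ... | inj₂ z≈0   = contradiction z≈0 z≉0

  infix 4 _≃_
  _≃_ : Fraction → Fraction → Set
  a ≃ b = num a * den b ≈ num b * den a

  infixl 6 _⊞_
  _⊞_ : Fraction → Fraction → Fraction
  a ⊞ b = fraction (num a * den b + num b * den a) (den a * den b) (*-≉0 (den≉0 a) (den≉0 b))

  infixl 7 _⊠_
  _⊠_ : Fraction → Fraction → Fraction
  a ⊠ b = fraction (num a * num b) (den a * den b) (*-≉0 (den≉0 a) (den≉0 b))

  ⊟_ : Fraction → Fraction
  ⊟ a = fraction (- num a) (den a) (den≉0 a)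

  inverse : Fraction → Fraction
  inverse a with num a ≈0?
  ... | yes _     = embed 0#
  ... | no num≉0  = fraction (den a) (num a) num≉0

  private
    ≃-trans : ∀ {a b c} → a ≃ b → b ≃ c → a ≃ c
    ≃-trans {a} {b} {c} a≃b b≃c = cancelʳ (den≉0 b) (begin
      num a * den c * den b   ≈⟨ swap _ _ _ ⟩
      num a * den b * den c   ≈⟨ *-congʳ a≃b ⟩
      num b * den a * den c   ≈⟨ swap _ _ _ ⟩
      num b * den c * den a   ≈⟨ *-congʳ b≃c ⟩
      num c * den b * den a   ≈⟨ swap _ _ _ ⟩
      num c * den a * den b   ∎)
      where
      swap : ∀ x y z → x * y * z ≈ x * z * y
      swap = solve 3 (λ x y z → x :* y :* z := x :* z :* y) refl

    ⊞-cong : ∀ {a b c d} → a ≃ b → c ≃ d → a ⊞ c ≃ b ⊞ d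
    ⊞-cong {a} {b} {c} {d} a≃b c≃d = begin
      (num a * den c + num c * den a) * (den b * den d)
        ≈⟨ solve 6 (λ na da nc dc db dd → (na :* dc :+ nc :* da) :* (db :* dd)
             := (na :* db) :* (dc :* dd) :+ (nc :* dd) :* (da :* db)) refl
             (num a) (den a) (num c) (den c) (den b) (den d) ⟩
      (num a * den b) * (den c * den d) + (num c * den d) * (den a * den b)
        ≈⟨ +-cong (*-congʳ a≃b) (*-congʳ c≃d) ⟩
      (num b * den a) * (den c * den d) + (num d * den c) * (den a * den b)
        ≈⟨ solve 6 (λ nb da nd dc db dd → (nb :* da) :* (dc :* dd) :+ (nd :* dc) :* (da :* db)
             := (nb :* dd :+ nd :* db) :* (da :* dc)) refl
             (num b) (den a) (num d) (den c) (den b) (den d) ⟩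
      (num b * den d + num d * den b) * (den a * den c)
        ∎

    ⊠-cong : ∀ {a b c d} → a ≃ b → c ≃ d → a ⊠ c ≃ b ⊠ d
    ⊠-cong {a} {b} {c} {d} a≃b c≃d = begin
      (num a * num c) * (den b * den d)  ≈⟨ mid4 _ _ _ _ ⟩
      (num a * den b) * (num c * den d)  ≈⟨ *-cong a≃b c≃d ⟩
      (num b * den a) * (num d * den c)  ≈⟨ mid4 _ _ _ _ ⟩
      (num b * num d) * (den a * den c)  ∎
      where
      mid4 : ∀ w x y z → (w * x) * (y * z) ≈ (w * y) * (x * z)
      mid4 = solve 4 (λ w x y z → (w :* x) :* (y :* z) := (w :* y) :* (x :* z)) refl

    ⊟-cong : ∀ {a b} → a ≃ b → ⊟ a ≃ ⊟ b
    ⊟-cong a≃b = trans (sym (-‿distribˡ-* _ _)) (trans (-‿cong a≃b) (-‿distribˡ-* _ _))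

    ⊟-inverseˡ : ∀ a → ⊟ a ⊞ a ≃ embed 0#
    ⊟-inverseˡ a = begin
      (- num a * den a + num a * den a) * 1#  ≈⟨ *-identityʳ _ ⟩
      - num a * den a + num a * den a         ≈⟨ +-congʳ (-‿distribˡ-* _ _) ⟨
      - (num a * den a) + num a * den a       ≈⟨ -‿inverseˡ _ ⟩
      0#                                      ≈⟨ zeroˡ _ ⟨
      0# * (den a * den a)                    ∎

    ⊞-comm : ∀ a b → a ⊞ b ≃ b ⊞ a
    ⊞-comm a b = solve 4 (λ na da nb db →
      (na :* db :+ nb :* da) :* (db :* da) := (nb :* da :+ na :* db) :* (da :* db)) refl
      (num a) (den a) (num b) (den b)

    ⊞-assoc : ∀ a b c → (a ⊞ b) ⊞ c ≃ a ⊞ (b ⊞ c)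
    ⊞-assoc a b c = solve 6 (λ na da nb db nc dc →
      ((na :* db :+ nb :* da) :* dc :+ nc :* (da :* db)) :* (da :* (db :* dc))
      := (na :* (db :* dc) :+ (nb :* dc :+ nc :* db) :* da) :* ((da :* db) :* dc)) refl
      (num a) (den a) (num b) (den b) (num c) (den c)

    ⊞-identityˡ : ∀ a → embed 0# ⊞ a ≃ a
    ⊞-identityˡ a = begin
      (0# * den a + num a * 1#) * den a  ≈⟨ *-congʳ (+-cong (zeroˡ _) (*-identityʳ _)) ⟩
      (0# + num a) * den a               ≈⟨ *-congʳ (+-identityˡ _) ⟩
      num a * den a                      ≈⟨ *-congˡ (*-identityˡ _) ⟨
      num a * (1# * den a)               ∎

    ⊠-comm : ∀ a b → a ⊠ b ≃ b ⊠ a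
    ⊠-comm a b = *-cong (*-comm _ _) (*-comm _ _)

    ⊠-assoc : ∀ a b c → (a ⊠ b) ⊠ c ≃ a ⊠ (b ⊠ c)
    ⊠-assoc a b c = *-cong (*-assoc _ _ _) (sym (*-assoc _ _ _))

    ⊠-identityˡ : ∀ a → embed 1# ⊠ a ≃ a
    ⊠-identityˡ a = *-cong (*-identityˡ _) (sym (*-identityˡ _))

    ⊠-distribʳ : ∀ c a b → (a ⊞ b) ⊠ c ≃ (a ⊠ c) ⊞ (b ⊠ c)
    ⊠-distribʳ c a b = solve 6 (λ na da nb db nc dc →
      ((na :* db :+ nb :* da) :* nc) :* ((da :* dc) :* (db :* dc))
      := ((na :* nc) :* (db :* dc) :+ (nb :* nc) :* (da :* dc)) :* ((da :* db) :* dc)) refl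
      (num a) (den a) (num b) (den b) (num c) (den c)

  fractionRing : CommutativeRing 0ℓ 0ℓ
  fractionRing = record
    { Carrier = Fraction ; _≈_ = _≃_ ; _+_ = _⊞_ ; _*_ = _⊠_ ; -_ = ⊟_
    ; 0# = embed 0# ; 1# = embed 1#
    ; isCommutativeRing = record
      { isRing = record
        { +-isAbelianGroup = record
          { isGroup = record
            { isMonoid = record
              { isSemigroup = record
                { isMagma = record
                  { isEquivalence = record
                    { refl  = refl
                    ; sym   = sym
                    ; trans = λ {a} {b} {c} → ≃-trans {a} {b} {c}
                    }
                  ; ∙-cong = λ {a} {b} {c} {d} → ⊞-cong {a} {b} {c} {d}
                  }
                ; assoc = ⊞-assoc
                }
              ; identity = ⊞-identityˡ , λ a →
                  ≃-trans {a ⊞ embed 0#} {embed 0# ⊞ a} {a} (⊞-comm a (embed 0#)) (⊞-identityˡ a)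
              }
            ; inverse = ⊟-inverseˡ , λ a →
                ≃-trans {a ⊞ (⊟ a)} {(⊟ a) ⊞ a} {embed 0#} (⊞-comm a (⊟ a)) (⊟-inverseˡ a)
            ; ⁻¹-cong = λ {a} {b} → ⊟-cong {a} {b}
            }
          ; comm = ⊞-comm
          }
        ; *-cong     = λ {a} {b} {c} {d} → ⊠-cong {a} {b} {c} {d}
        ; *-assoc    = ⊠-assoc
        ; *-identity = ⊠-identityˡ , λ a →
            ≃-trans {a ⊠ embed 1#} {embed 1# ⊠ a} {a} (⊠-comm a (embed 1#)) (⊠-identityˡ a)
        ; distrib    = (λ c a b → ≃-trans {c ⊠ (a ⊞ b)} {(a ⊞ b) ⊠ c} {(c ⊠ a) ⊞ (c ⊠ b)}
                           (⊠-comm c (a ⊞ b))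
                           (≃-trans {(a ⊞ b) ⊠ c} {(a ⊠ c) ⊞ (b ⊠ c)} {(c ⊠ a) ⊞ (c ⊠ b)}
                             (⊠-distribʳ c a b)
                             (⊞-cong {a ⊠ c} {c ⊠ a} {b ⊠ c} {c ⊠ b} (⊠-comm a c) (⊠-comm b c))))
                     , ⊠-distribʳ
        }
      ; *-comm = ⊠-comm
      }
    }

  embed-isRingHomomorphism :
    IsRingHomomorphism rawRing (CommutativeRing.rawRing fractionRing) embed
  embed-isRingHomomorphism = record
    { isSemiringHomomorphism = record
      { isNearSemiringHomomorphism = record
        { +-isMonoidHomomorphism = record
          { isMagmaHomomorphism = record
            { isRelHomomorphism = record { cong = *-congʳ }
            ; homo = λ _ _ → *-cong (sym (+-cong (*-identityʳ _) (*-identityʳ _))) (*-identityʳ _) }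
          ; ε-homo = refl }
        ; *-homo = λ _ _ → *-congˡ (*-identityʳ _) }
      ; 1#-homo = refl }
    ; -‿homo = λ _ → refl }

  private
    ≃0⇒num≈0 : ∀ {a} → a ≃ embed 0# → num a ≈ 0#
    ≃0⇒num≈0 a≃0 = trans (sym (*-identityʳ _)) (trans a≃0 (zeroˡ _))

    num≈0⇒≃0 : ∀ {a} → num a ≈ 0# → a ≃ embed 0#
    num≈0⇒≃0 num≈0 = trans (*-identityʳ _) (trans num≈0 (sym (zeroˡ _)))

    _≃0? : ∀ a → Dec (a ≃ embed 0#)
    a ≃0? with num a ≈0?
    ... | yes num≈0 = yes (num≈0⇒≃0 {a} num≈0)
    ... | no  num≉0 = no (num≉0 ∘ ≃0⇒num≈0 {a})

    ⊠-noZeroDivisors : ∀ {a b} → a ⊠ b ≃ embed 0# → a ≃ embed 0# ⊎ b ≃ embed 0#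
    ⊠-noZeroDivisors {a} {b} ab≃0 with noZeroDivisors (≃0⇒num≈0 {a ⊠ b} ab≃0)
    ... | inj₁ na≈0 = inj₁ (num≈0⇒≃0 {a} na≈0)
    ... | inj₂ nb≈0 = inj₂ (num≈0⇒≃0 {b} nb≈0)

    ⊠-inverseʳ : ∀ {a} → ¬ (a ≃ embed 0#) → a ⊠ inverse a ≃ embed 1#
    ⊠-inverseʳ {a} a≄0 with num a ≈0?
    ... | yes num≈0 = contradiction (num≈0⇒≃0 {a} num≈0) a≄0
    ... | no _      = trans (*-identityʳ _) (trans (*-comm _ _) (sym (*-identityˡ _)))

  fractionField : Field
  fractionField = record
    { domain = record
      { commutativeRing = fractionRing
      ; _≈0?            = _≃0?
      ; 1≉0             = 1≉0 ∘ ≃0⇒num≈0 {embed 1#}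
      ; noZeroDivisors  = λ {a} {b} → ⊠-noZeroDivisors {a} {b}
      }
    ; _⁻¹      = inverse
    ; inverseʳ = λ {a} → ⊠-inverseʳ {a}
    }

------------------------------------------------------------------------
-- Permutations and their statistics

words : ∀ m k → List (Vec (Fin m) k)
words m zero    = [] ∷ []
words m (suc k) = List.concatMap (λ a → List.map (a ∷_) (words m k)) (List.allFin m)

-- The permutations of an n-element chain in one-line notation: the words
-- of length n with distinct letters, each listed once.  The letters are
-- 0, …, n − 1 instead of 1, …, n, which affects none of the statistics.
𝔖 : ∀ n → List (Vec (Fin n) n)
𝔖 n = List.filter (allPairs? λ a b → ¬? (a Fin.≟ b)) (words n n)

module _ {m : ℕ} where

  infix 4 _≺_
  _≺_ : Fin m → Fin m → ℕ
  a ≺ b = if does (a Fin.<? b) then 1 else 0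

  interiorPeaks : ∀ {k} → Vec (Fin m) k → ℕ
  interiorPeaks (a ∷ b ∷ c ∷ w) = (a ≺ b) ℕ.* (c ≺ b) ℕ.+ interiorPeaks (b ∷ c ∷ w)
  interiorPeaks _               = 0

  inv : ∀ {k} → Vec (Fin m) k → ℕ
  inv []      = 0
  inv (a ∷ w) = Vec.sum (Vec.map (_≺ a) w) ℕ.+ inv w

  des : ∀ {k} → Vec (Fin m) k → ℕ
  des (a ∷ b ∷ w) = (b ≺ a) ℕ.+ des (b ∷ w)
  des _           = 0

  lpk : ∀ {k} → Vec (Fin m) k → ℕ
  lpk (a ∷ b ∷ w) = (b ≺ a) ℕ.+ interiorPeaks (a ∷ b ∷ w)
  lpk _           = 0

------------------------------------------------------------------------
-- q-exponentials, and the polynomials Pₙ evaluated in a ring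

module QSeries (R : RingWithInverse) (q : RingWithInverse.Carrier R) where

  open RingWithInverse R
  open RawSemiringDefinitions (Semiring.rawSemiring semiring) using (sum)
  open PowerSeriesInverse R using (Series)

  [_]q : ℕ → Carrier
  [ n ]q = sum {n} λ i → q ^ toℕ i

  [_]q! : ℕ → Carrier
  [ zero ]q!  = 1#
  [ suc n ]q! = [ n ]q! * [ suc n ]q

  exp : Series
  exp n = 1# / [ n ]q!

  Exp : Series
  Exp n = q ^ (n C 2) / [ n ]q!

  P : ℕ → Carrier → Carrier → Carrier
  P n y t = List.foldr _+_ 0# (List.map (λ π → q ^ inv π * y ^ lpk π * t ^ des π) (𝔖 n))

------------------------------------------------------------------------
-- The coefficient rings

ℚ-domain : Domain
ℚ-domain = record
  { commutativeRing = ℚ.+-*-commutativeRing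
  ; _≈0?            = ℚ._≟ 0ℚ
  ; 1≉0             = λ ()
  ; noZeroDivisors  = λ {p} {r} → noZeroDivisors p r
  }
  where
  noZeroDivisors : ∀ p r → p ℚ.* r ≡ 0ℚ → p ≡ 0ℚ ⊎ r ≡ 0ℚ
  noZeroDivisors p r pr≡0 with p ℚ.≟ 0ℚ
  ... | yes p≡0 = inj₁ p≡0
  ... | no  p≢0 = inj₂ (begin
    r                      ≡⟨ ℚ.*-identityˡ r ⟨
    1ℚ ℚ.* r               ≡⟨ ≡.cong (ℚ._* r) (ℚ.*-inverseˡ p) ⟨
    (ℚ.1/ p) ℚ.* p ℚ.* r   ≡⟨ ℚ.*-assoc (ℚ.1/ p) p r ⟩
    (ℚ.1/ p) ℚ.* (p ℚ.* r) ≡⟨ ≡.cong ((ℚ.1/ p) ℚ.*_) pr≡0 ⟩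
    (ℚ.1/ p) ℚ.* 0ℚ        ≡⟨ ℚ.*-zeroʳ (ℚ.1/ p) ⟩
    0ℚ                     ∎)
    where
    open ≡.≡-Reasoning
    instance
      _ : ℚ.NonZero p
      _ = ℚ.≢-nonZero p≢0

module ℚ[q]        = PolynomialDomain ℚ-domain
module ℚ[q,y]      = PolynomialDomain ℚ[q].polynomialDomain
module ℚ[q,y,t]    = PolynomialDomain ℚ[q,y].polynomialDomain
module Frac[q]     = Fractions ℚ[q].polynomialDomain
module Frac[q,y,t] = Fractions ℚ[q,y,t].polynomialDomain

-- The rings of coefficients of the series in x below, and their
-- indeterminates, are opaque only because unfolding these towers of
-- polynomial, fraction and series rings makes conversion checking slow.

-- ℚ(q,y,t), and power series in x over it (the operations of module x).
module RationalFunctions where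

  opaque
    coefficients : RingWithInverse
    coefficients = Field.ringWithInverse Frac[q,y,t].fractionField

  open RingWithInverse coefficients public

  opaque
    unfolding coefficients

    q y t : Carrier
    q = Frac[q,y,t].embed (ℚ[q,y,t].constantᴾ (ℚ[q,y].constantᴾ ℚ[q].Xᴾ))
    y = Frac[q,y,t].embed (ℚ[q,y,t].constantᴾ ℚ[q,y].Xᴾ)
    t = Frac[q,y,t].embed ℚ[q,y,t].Xᴾ

  open PowerSeriesInverse coefficients public using (Series; constant; scale; seriesRingWithInverse)
  module x = RingWithInverse seriesRingWithInverse
  open QSeries coefficients q public

-- ℚ[y][[t]].
module ℚ[y]⟦t⟧ where

  module ℚ[y]  = Polynomials ℚ.+-*-commutativeRing
  module t[[]] = PowerSeries ℚ[y].polynomialRing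

  open CommutativeRing t[[]].seriesRing public
  open RawSemiringDefinitions (Semiring.rawSemiring semiring) public using (_^_)

  y t 2# 4# : Carrier
  y  = t[[]].constant ℚ[y].Xᴾ
  t  = t[[]].X
  2# = 1# + 1#
  4# = 2# + 2#

  -- s = √((1 + t)² − 4yt), normalised by s(0) = 1.
  IsRoot : Carrier → Set
  IsRoot s = s ^ 2 ≈ (1# + t) ^ 2 - 4# * y * t
           × CommutativeRing._≈_ ℚ[y].polynomialRing (s 0) (CommutativeRing.1# ℚ[y].polynomialRing)

  -- ℚ[y][[t]] is a domain, so the quotient a/b with b ≠ 0 is the unique
  -- c, if there is one, such that b c = a.
  infix 4 _≈_÷_
  _≈_÷_ : Carrier → Carrier → Carrier → Set
  c ≈ a ÷ b = b * c ≈ a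

  -- The defining formulas of u and v, where s = √((1 + t)² − 4yt).
  IsU IsV : Carrier → Carrier → Set
  IsU s u = u ≈ 1# + t ^ 2 - 2# * y * t - (1# - t) * s ÷ 2# * (1# - y) * t
  IsV s v = v ≈ (1# + t) ^ 2 - 2# * y * t - (1# + t) * s ÷ 2# * y * t

-- ℚ(q)[y][[t]], and power series in x over it (the operations of module x).
module ℚ⟨q⟩[y]⟦t⟧ where

  module ℚ⟨q⟩[y] = PolynomialInverse Frac[q].fractionField
  module t[[]]   = PowerSeriesInverse ℚ⟨q⟩[y].polynomialRingWithInverse

  opaque
    coefficients : RingWithInverse
    coefficients = t[[]].seriesRingWithInverse

  open RingWithInverse coefficients public

  opaque
    unfolding coefficients

    q y t : Carrier
    q = t[[]].constant (ℚ⟨q⟩[y].constantᴾ (Frac[q].embed ℚ[q].Xᴾ))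
    y = t[[]].constant ℚ⟨q⟩[y].Xᴾ
    t = t[[]].X

  open PowerSeriesInverse coefficients public using (Series; constant; scale; seriesRingWithInverse)
  module x = RingWithInverse seriesRingWithInverse
  open QSeries coefficients q public

  ℚ→ℚ⟨q⟩ : IsRingHomomorphism
    (CommutativeRing.rawRing ℚ.+-*-commutativeRing)
    (CommutativeRing.rawRing Frac[q].fractionRing)
    (Frac[q].embed ∘ ℚ[q].constantᴾ)
  ℚ→ℚ⟨q⟩ = Composition.isRingHomomorphism
    (λ {a} {b} {c} → CommutativeRing.trans Frac[q].fractionRing {a} {b} {c})
    ℚ[q].constantᴾ-isRingHomomorphism Frac[q].embed-isRingHomomorphism

  opaque
    unfolding coefficients

    -- The inclusion of ℚ[y][[t]].
    include : ℚ[y]⟦t⟧.Carrier → Carrier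
    include f n = mapPolynomial ℚ→ℚ⟨q⟩ (f n)

-- Cut a permutation of length n into an increasing block followed by k pairs of
-- a decreasing and an increasing block, all possibly empty, with weight T for
-- each pair and Y for each letter in a decreasing block.  Multiplication by
-- exp_q (by Exp_q) adds an increasing (a decreasing) block, so the sum of all
-- these weights times q^inv is [n]_q! times the coefficient of x^n in
-- exp_q(x) / (1 − T Exp_q(Yx) exp_q(x)).  For a fixed permutation, the choice of
-- the block of the next letter is a transfer matrix of rank one, whence the sum
-- over its decompositions is a product: a left peak and its valley contribute
-- (1 + Y)² T, a double descent Y + T, a double ascent 1 + YT, and the
-- denominator is (1 − T)^(n+1).  In Lehmer codes, where inversions add up, this
-- becomes a recursion on the first letter that telescopes.
--
-- For the second identity put Y = u and T = v: v is the solution of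
-- v = t (y (1 + v)² − (2 + t) v) in ℚ[y][[t]] and u = (t − v) / (1 − tv), which
-- gives t (1 + uv) = u + v and yt (1 + uv)² = (1 + u)² v.
module Submission where

open import Defs
open import Algebra.Bundles using (CommutativeRing; Semiring)
import Algebra.Definitions.RawSemiring as RawSemiringDefinitions
import Algebra.Morphism.Construct.Composition as Composition
open import Algebra.Morphism.Structures using (IsRingHomomorphism)
import Algebra.Properties.CommutativeSemigroup as CommutativeSemigroupProperties
import Algebra.Properties.CommutativeSemiring.Exp as CommutativeExpProperties
import Algebra.Properties.Group as GroupProperties
import Algebra.Properties.Ring as RingProperties
import Algebra.Properties.Semiring.Exp as ExpProperties
import Algebra.Properties.Semiring.Mult.TCOptimised as Mult
import Algebra.Properties.Semiring.Sum as SumProperties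
import Algebra.Solver.Ring as RingSolver
open import Algebra.Solver.Ring.AlmostCommutativeRing
  using (fromCommutativeRing; _-Raw-AlmostCommutative⟶_)
open import Data.Bool.Base using (Bool; true; false; if_then_else_; _∧_; not)
import Data.Bool.Properties as Bool
open import Data.Fin.Base using (Fin; zero; suc; toℕ)
import Data.Fin.Properties as Fin
open import Data.Integer.Base as ℤ using (ℤ; +_; -[1+_]; _⊖_)
import Data.Integer.Properties as ℤ
open import Data.List.Base as List using (List; []; _∷_)
open import Data.Maybe.Base using (Maybe; just; nothing)
open import Data.Nat.Base as ℕ using (ℕ; zero; suc; z≤n; s≤s; _∸_)
open import Data.Nat.Combinatorics using (_C_; nC1≡n; nCk+nC[k+1]≡[n+1]C[k+1])
import Data.Nat.Properties as ℕ
open import Data.Product using (_×_; _,_; proj₁; proj₂; ∃-syntax; ∃!)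
import Data.Rational.Properties as ℚ
open import Data.Sum.Base using (_⊎_; inj₁; inj₂)
open import Data.Vec.Base as Vec using (Vec; []; _∷_)
open import Data.Vec.Relation.Unary.All using (all?)
open import Data.Vec.Relation.Unary.AllPairs using (allPairs?)
open import Function.Base using (_∘_)
open import Level using (0ℓ)
open import Relation.Binary.Definitions using (Tri; tri<; tri≈; tri>)
import Relation.Binary.PropositionalEquality as ≡
open ≡ using (_≡_)
import Relation.Binary.Reasoning.Setoid as SetoidReasoning
open import Relation.Nullary using (¬_; ¬?; yes; no; does; contradiction)
open import Relation.Nullary.Decidable using (dec-true; dec-false)
open import Relation.Unary using (Pred; Decidable)

-- The coefficients of S = (1 - T) exp_q(x) / (1 - T Exp_q(Yx) exp_q(x)) alone do not satisfy a
-- recursion on the first letter, because the next step also depends on the rank j of the letter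
-- just read. The refined counts are nevertheless determined by S. Since Exp_q(-x) exp_q(x) = 1, the
-- equation of S becomes Exp_q(-x) S = (1 - T) + T Exp_q(Yx) S, and `mix` interpolates between the
-- coefficients of S (at j = 0) and those of the two products (at m = 0). The recurrence of `mix` in
-- j is what makes the sum over the next letter telescope; the equation of S enters only through the
-- constant term and the boundary term at the largest rank. The second identity is not obtained by
-- inserting u and v into the first: the two live in different rings. Both are instances of one
-- computation over any ring in which the q-numbers are units and `Substitution` holds.

-- The library's commutative ring solvers take coefficients in the ring
-- itself, where cancellation cannot be decided, or in ℕ; here they are integers.
module IntegerSolver (R : CommutativeRing 0ℓ 0ℓ) where

  open CommutativeRing R
  open RingProperties ring using (-‿distribˡ-*; -‿distribʳ-*; -0#≈0#; -‿involutive; -‿+-comm)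
  open Mult semiring using (1+×; ×-homo-+; ×1-homo-*) renaming (_×_ to infixl 8 _·_)
  open CommutativeSemigroupProperties (CommutativeRing.+-commutativeSemigroup R) using (x∙yz≈y∙xz)
  open SetoidReasoning setoid

  private
    ⟦_⟧ : ℤ → Carrier
    ⟦ + n ⟧      = n · 1#
    ⟦ -[1+ n ] ⟧ = - (suc n · 1#)

    neg-homo : ∀ i → ⟦ ℤ.- i ⟧ ≈ - ⟦ i ⟧
    neg-homo (+ zero)    = sym -0#≈0#
    neg-homo (+ (suc n)) = refl
    neg-homo -[1+ n ]    = sym (-‿involutive _)

    ⊖-homo : ∀ m n → ⟦ m ⊖ n ⟧ ≈ m · 1# - n · 1#
    ⊖-homo zero    zero    = sym (-‿inverseʳ _)
    ⊖-homo zero    (suc n) = sym (+-identityˡ _)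
    ⊖-homo (suc m) zero    = sym (trans (+-congˡ -0#≈0#) (+-identityʳ _))
    ⊖-homo (suc m) (suc n) = begin
      ⟦ suc m ⊖ suc n ⟧                       ≡⟨ ≡.cong ⟦_⟧ (ℤ.[1+m]⊖[1+n]≡m⊖n m n) ⟩
      ⟦ m ⊖ n ⟧                               ≈⟨ ⊖-homo m n ⟩
      m · 1# - n · 1#                         ≈⟨ +-identityˡ _ ⟨
      0# + (m · 1# - n · 1#)                  ≈⟨ +-congʳ (-‿inverseʳ 1#) ⟨
      (1# - 1#) + (m · 1# - n · 1#)           ≈⟨ +-assoc _ _ _ ⟩
      1# + (- 1# + (m · 1# - n · 1#))         ≈⟨ +-congˡ (x∙yz≈y∙xz (- 1#) (m · 1#) _) ⟩
      1# + (m · 1# + (- 1# - n · 1#))         ≈⟨ +-assoc _ _ _ ⟨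
      (1# + m · 1#) + (- 1# - n · 1#)         ≈⟨ +-congˡ (-‿+-comm 1# (n · 1#)) ⟩
      (1# + m · 1#) - (1# + n · 1#)           ≈⟨ +-cong (1+× m 1#) (-‿cong (1+× n 1#)) ⟨
      suc m · 1# - suc n · 1#                 ∎

    +-homo : ∀ i j → ⟦ i ℤ.+ j ⟧ ≈ ⟦ i ⟧ + ⟦ j ⟧
    +-homo (+ m)    (+ n)    = ×-homo-+ 1# m n
    +-homo (+ m)    -[1+ n ] = ⊖-homo m (suc n)
    +-homo -[1+ m ] (+ n)    = trans (⊖-homo n (suc m)) (+-comm _ _)
    +-homo -[1+ m ] -[1+ n ] = begin
      - (suc (suc (m ℕ.+ n)) · 1#)
        ≈⟨ -‿cong (reflexive (≡.cong (_· 1#) (≡.cong suc (≡.sym (ℕ.+-suc m n))))) ⟩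
      - ((suc m ℕ.+ suc n) · 1#)         ≈⟨ -‿cong (×-homo-+ 1# (suc m) (suc n)) ⟩
      - (suc m · 1# + suc n · 1#)        ≈⟨ -‿+-comm _ _ ⟨
      - (suc m · 1#) - suc n · 1#        ∎

    +*+-homo : ∀ m n → ⟦ + m ℤ.* + n ⟧ ≈ ⟦ + m ⟧ * ⟦ + n ⟧
    +*+-homo m n = trans (reflexive (≡.cong ⟦_⟧ (≡.sym (ℤ.pos-* m n)))) (×1-homo-* m n)

    +*-homo : ∀ m j → ⟦ + m ℤ.* j ⟧ ≈ ⟦ + m ⟧ * ⟦ j ⟧
    +*-homo m (+ n)    = +*+-homo m n
    +*-homo m -[1+ n ] = begin
      ⟦ + m ℤ.* -[1+ n ] ⟧        ≡⟨ ≡.cong ⟦_⟧ (≡.sym (ℤ.neg-distribʳ-* (+ m) (+ suc n))) ⟩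
      ⟦ ℤ.- (+ m ℤ.* + suc n) ⟧   ≈⟨ neg-homo (+ m ℤ.* + suc n) ⟩
      - ⟦ + m ℤ.* + suc n ⟧       ≈⟨ -‿cong (+*+-homo m (suc n)) ⟩
      - (m · 1# * suc n · 1#)     ≈⟨ -‿distribʳ-* _ _ ⟩
      m · 1# * - (suc n · 1#)     ∎

    *-homo : ∀ i j → ⟦ i ℤ.* j ⟧ ≈ ⟦ i ⟧ * ⟦ j ⟧
    *-homo (+ m)    j = +*-homo m j
    *-homo -[1+ m ] j = begin
      ⟦ -[1+ m ] ℤ.* j ⟧          ≡⟨ ≡.cong ⟦_⟧ (≡.sym (ℤ.neg-distribˡ-* (+ suc m) j)) ⟩
      ⟦ ℤ.- (+ suc m ℤ.* j) ⟧     ≈⟨ neg-homo (+ suc m ℤ.* j) ⟩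
      - ⟦ + suc m ℤ.* j ⟧         ≈⟨ -‿cong (+*-homo (suc m) j) ⟩
      - (suc m · 1# * ⟦ j ⟧)      ≈⟨ -‿distribˡ-* _ _ ⟩
      - (suc m · 1#) * ⟦ j ⟧      ∎

    homomorphism : CommutativeRing.rawRing ℤ.+-*-commutativeRing
                   -Raw-AlmostCommutative⟶ fromCommutativeRing R
    homomorphism = record
      { ⟦_⟧    = ⟦_⟧
      ; +-homo = +-homo
      ; *-homo = *-homo
      ; -‿homo = neg-homo
      ; 0-homo = refl
      ; 1-homo = refl
      }

    _≟_ : ∀ i j → Maybe (⟦ i ⟧ ≈ ⟦ j ⟧)
    i ≟ j with i ℤ.≟ j
    ... | yes i≡j = just (reflexive (≡.cong ⟦_⟧ i≡j))
    ... | no  _   = nothing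

  open RingSolver (CommutativeRing.rawRing ℤ.+-*-commutativeRing) (fromCommutativeRing R) homomorphism _≟_ public

-- Polynomial consequences of equations

module Cancellation (A : CommutativeRing 0ℓ 0ℓ) where

  open CommutativeRing A
  open SetoidReasoning setoid

  -- Makes hypotheses available to the ring solver: a goal is first written as its target plus
  -- multiples of differences of the two sides of hypotheses, a certificate of ideal membership, and
  -- each use of this lemma erases one multiple.
  +-multiple : ∀ {a b} x c → a ≈ b → x + c * (a - b) ≈ x
  +-multiple {a} {b} x c a≈b = begin
    x + c * (a - b)  ≈⟨ +-congˡ (*-congˡ (trans (+-congʳ a≈b) (-‿inverseʳ b))) ⟩
    x + c * 0#       ≈⟨ trans (+-congˡ (zeroʳ c)) (+-identityʳ x) ⟩
    x                ∎

  unit-cancelˡ : ∀ {c c⁻¹ a b} → c * c⁻¹ ≈ 1# → c * a ≈ c * b → a ≈ b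
  unit-cancelˡ {c} {c⁻¹} {a} {b} cc⁻¹≈1 ca≈cb = begin
    a              ≈⟨ expand a ⟩
    c⁻¹ * (c * a)  ≈⟨ *-congˡ ca≈cb ⟩
    c⁻¹ * (c * b)  ≈⟨ expand b ⟨
    b              ∎
    where
    expand : ∀ x → x ≈ c⁻¹ * (c * x)
    expand x = begin
      x              ≈⟨ *-identityˡ x ⟨
      1# * x         ≈⟨ *-congʳ (trans (sym cc⁻¹≈1) (*-comm c c⁻¹)) ⟩
      c⁻¹ * c * x    ≈⟨ *-assoc c⁻¹ c x ⟩
      c⁻¹ * (c * x)  ∎

  unit-* : ∀ {a b a′ b′} → a * a′ ≈ 1# → b * b′ ≈ 1# → (a * b) * (a′ * b′) ≈ 1#
  unit-* {a} {b} {a′} {b′} aa′≈1 bb′≈1 = begin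
    (a * b) * (a′ * b′)
      ≈⟨ solve 4 (λ a b c d → (a :* b) :* (c :* d) := (a :* c) :* (b :* d)) refl a b a′ b′ ⟩
    (a * a′) * (b * b′)  ≈⟨ trans (*-cong aa′≈1 bb′≈1) (*-identityˡ 1#) ⟩
    1#                   ∎
    where open IntegerSolver A

module QuadraticIdentities (A : CommutativeRing 0ℓ 0ℓ) where

  open CommutativeRing A
  open RawSemiringDefinitions (Semiring.rawSemiring semiring) using (_^_)
  open IntegerSolver A
  open Cancellation A
  open SetoidReasoning setoid

  -- Eliminating the square root from the formula for v leaves (1 + t)² v = yt (1 + v)². `v-eq` is
  -- this equation, solved for the term v that carries no factor t.
  module FixedPoint {y t v : Carrier} (v-eq : v ≈ t * (y * (1# + v) ^ 2 - (1# + 1# + t) * v)) where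

    private
      one two : ∀ {n} → Polynomial n
      one = con (+ 1)
      two = one :+ one

      Q : ∀ {n} (y t v : Polynomial n) → Polynomial n
      Q y t v = t :* (y :* (one :+ v) :^ 2 :- (two :+ t) :* v)

    -- The squares of the two sides of the formula for (1 + t) s differ from the claim by 4yt (yt (1
    -- + v)² - (1 + t)² v), which vanishes by `v-eq`.
    root-square : ∀ {s w} → (1# + t) * w ≈ 1# →
      (1# + t) * s ≈ (1# + t) ^ 2 - (1# + 1#) * y * t - (1# + 1#) * y * t * v →
      s ^ 2 ≈ (1# + t) ^ 2 - ((1# + 1#) + (1# + 1#)) * y * t
    root-square {s} {w} unit s-eq = unit-cancelˡ (unit-* unit unit) (begin
      (1# + t) * (1# + t) * s ^ 2
        ≈⟨ solve 2 (λ t s → (one :+ t) :* (one :+ t) :* s :^ 2 := ((one :+ t) :* s) :^ 2) refl t s ⟩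
      ((1# + t) * s) ^ 2
        ≈⟨ *-cong s-eq (*-congʳ s-eq) ⟩
      ((1# + t) ^ 2 - (1# + 1#) * y * t - (1# + 1#) * y * t * v) ^ 2
        ≈⟨ solve 3 (λ y t v → ((one :+ t) :^ 2 :- two :* y :* t :- two :* y :* t :* v) :^ 2
             := (one :+ t) :* (one :+ t) :* ((one :+ t) :^ 2 :- (two :+ two) :* y :* t)
                :+ (:- ((two :+ two) :* y :* t)) :* (v :- Q y t v)) refl y t v ⟩
      _ ≈⟨ +-multiple _ _ v-eq ⟩
      (1# + t) * (1# + t) * ((1# + t) ^ 2 - ((1# + 1#) + (1# + 1#)) * y * t) ∎)

    v-formula : ∀ {s} →
      (1# + t) * s ≈ (1# + t) ^ 2 - (1# + 1#) * y * t - (1# + 1#) * y * t * v →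
      (1# + 1#) * y * t * v ≈ (1# + t) ^ 2 - (1# + 1#) * y * t - (1# + t) * s
    v-formula {s} s-eq = begin
      (1# + 1#) * y * t * v
        ≈⟨ solve 4 (λ y t v s → two :* y :* t :* v
             := ((one :+ t) :^ 2 :- two :* y :* t :- (one :+ t) :* s)
                :+ one :* ((one :+ t) :* s :- ((one :+ t) :^ 2 :- two :* y :* t :- two :* y :* t :* v))) refl y t v s ⟩
      _ ≈⟨ +-multiple _ _ s-eq ⟩
      (1# + t) ^ 2 - (1# + 1#) * y * t - (1# + t) * s ∎

    -- The equations of s and u have leading coefficients 1 + t and 1 - tv. After multiplication by
    -- both, s and u can be eliminated, and a multiple of `v-eq` remains.
    u-formula : ∀ {s u w z} → (1# + t) * w ≈ 1# → (1# - t * v) * z ≈ 1# →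
      (1# + t) * s ≈ (1# + t) ^ 2 - (1# + 1#) * y * t - (1# + 1#) * y * t * v →
      (1# - t * v) * u ≈ t - v →
      (1# + 1#) * (1# - y) * t * u ≈ 1# + t ^ 2 - (1# + 1#) * y * t - (1# - t) * s
    u-formula {s} {u} unit₁ unit₂ s-eq u-eq = unit-cancelˡ (unit-* unit₁ unit₂) (begin
      (1# + t) * (1# - t * v) * ((1# + 1#) * (1# - y) * t * u)
        ≈⟨ solve 5 (λ y t v s u →
             (one :+ t) :* (one :- t :* v) :* (two :* (one :- y) :* t :* u)
             := (one :+ t) :* (one :- t :* v) :* (one :+ t :^ 2 :- two :* y :* t :- (one :- t) :* s)
                :+ (:- (two :* t :* (one :- t))) :* (v :- Q y t v)
                :+ ((one :- t :* v) :* (one :- t)) :*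
                   ((one :+ t) :* s :- ((one :+ t) :^ 2 :- two :* y :* t :- two :* y :* t :* v))
                :+ ((one :+ t) :* two :* (one :- y) :* t) :* ((one :- t :* v) :* u :- (t :- v)))
             refl y t v s u ⟩
      _ ≈⟨ +-multiple _ _ u-eq ⟩
      _ ≈⟨ +-multiple _ _ s-eq ⟩
      _ ≈⟨ +-multiple _ _ v-eq ⟩
      (1# + t) * (1# - t * v) * (1# + t ^ 2 - (1# + 1#) * y * t - (1# - t) * s) ∎)

    t-equation : ∀ {u} → (1# - t * v) * u ≈ t - v → t * (1# + u * v) ≈ u + v
    t-equation {u} u-eq = begin
      t * (1# + u * v)
        ≈⟨ solve 3 (λ t v u → t :* (one :+ u :* v)
             := (u :+ v) :+ (:- one) :* ((one :- t :* v) :* u :- (t :- v))) refl t v u ⟩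
      _ ≈⟨ +-multiple _ _ u-eq ⟩
      u + v ∎

    -- For u = (t - v) / (1 - tv), the factor 1 - tv turns 1 + uv into 1 - v² and 1 + u into (1 + t)
    -- (1 - v). The claim is then (1 - v)² times the equation yt (1 + v)² = (1 + t)² v.
    yt-equation : ∀ {u z} → (1# - t * v) * z ≈ 1# → (1# - t * v) * u ≈ t - v →
      y * t * (1# + u * v) ^ 2 ≈ (1# + u) ^ 2 * v
    yt-equation {u} unit u-eq = unit-cancelˡ (unit-* unit unit) (begin
      (1# - t * v) * (1# - t * v) * (y * t * (1# + u * v) ^ 2)
        ≈⟨ solve 4 (λ y t v u → (one :- t :* v) :* (one :- t :* v) :* (y :* t :* (one :+ u :* v) :^ 2)
             := y :* t :* ((one :- t :* v) :+ (one :- t :* v) :* u :* v) :^ 2) refl y t v u ⟩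
      y * t * ((1# - t * v) + (1# - t * v) * u * v) ^ 2
        ≈⟨ *-congˡ (^2-cong (+-congˡ (*-congʳ u-eq))) ⟩
      y * t * ((1# - t * v) + (t - v) * v) ^ 2
        ≈⟨ solve 3 (λ y t v → y :* t :* ((one :- t :* v) :+ (t :- v) :* v) :^ 2
             := ((one :- t :* v) :+ (t :- v)) :^ 2 :* v
                :+ (:- (one :- v) :^ 2) :* (v :- Q y t v)) refl y t v ⟩
      _ ≈⟨ +-multiple _ _ v-eq ⟩
      ((1# - t * v) + (t - v)) ^ 2 * v
        ≈⟨ *-congʳ (^2-cong (+-congˡ u-eq)) ⟨
      ((1# - t * v) + (1# - t * v) * u) ^ 2 * v
        ≈⟨ solve 3 (λ t v u → ((one :- t :* v) :+ (one :- t :* v) :* u) :^ 2 :* v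
             := (one :- t :* v) :* (one :- t :* v) :* ((one :+ u) :^ 2 :* v)) refl t v u ⟩
      (1# - t * v) * (1# - t * v) * ((1# + u) ^ 2 * v) ∎)
      where
      ^2-cong : ∀ {a b} → a ≈ b → a ^ 2 ≈ b ^ 2
      ^2-cong a≈b = *-cong a≈b (*-congʳ a≈b)

-- q-exponentials

InvertibleQNumbers : (R : RingWithInverse) → RingWithInverse.Carrier R → Set
InvertibleQNumbers R q = ∀ n → [ suc n ]q * [ suc n ]q ⁻¹ ≈ 1#
  where
  open RingWithInverse R
  open QSeries R q

module QExponentials (R : RingWithInverse) (q : RingWithInverse.Carrier R)
  ([1+_]q-unit : InvertibleQNumbers R q) where

  open RingWithInverse R
  open QSeries R q
  open PowerSeriesInverse R
  open SumProperties semiring using (sum; *-distribˡ-sum; ∑-distrib-+; sum-cong-≋)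
  open ExpProperties semiring using (^-homo-*; ^-congʳ)
  open Cancellation commutativeRing
  open IntegerSolver commutativeRing
  open SetoidReasoning setoid

  !-unit : ∀ n → [ n ]q! * [ n ]q! ⁻¹ ≈ 1#
  !-unit zero    = inverseʳ (*-identityˡ 1#)
  !-unit (suc n) = inverseʳ (unit-* (!-unit n) ([1+ n ]q-unit))

  1⁻¹≈1 : 1# ⁻¹ ≈ 1#
  1⁻¹≈1 = trans (sym (*-identityˡ _)) (!-unit 0)

  exp₀≈1 : exp 0 ≈ 1#
  exp₀≈1 = !-unit 0

  Exp₀≈1 : Exp 0 ≈ 1#
  Exp₀≈1 = !-unit 0

  exp-recurrence : ∀ n → [ suc n ]q * exp (suc n) ≈ exp n
  exp-recurrence n = begin
    [ suc n ]q * (1# * [ suc n ]q! ⁻¹)              ≈⟨ *-identityˡ _ ⟨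
    1# * ([ suc n ]q * (1# * [ suc n ]q! ⁻¹))       ≈⟨ *-congʳ (!-unit n) ⟨
    [ n ]q! * [ n ]q! ⁻¹ * ([ suc n ]q * (1# * [ suc n ]q! ⁻¹))
      ≈⟨ solve 4 (λ a b c d →
           a :* b :* (c :* (con (+ 1) :* d)) := b :* (a :* c :* d))
           refl _ _ _ _ ⟩
    [ n ]q! ⁻¹ * ([ suc n ]q! * [ suc n ]q! ⁻¹)     ≈⟨ *-congˡ (!-unit (suc n)) ⟩
    [ n ]q! ⁻¹ * 1#                                 ≈⟨ *-comm _ _ ⟩
    1# * [ n ]q! ⁻¹                                 ∎

  /!-recurrence : ∀ a n → [ suc n ]q * (a / [ suc n ]q!) ≈ a / [ n ]q!
  /!-recurrence a n = begin
    [ suc n ]q * (a * [ suc n ]q! ⁻¹)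
      ≈⟨ solve 3 (λ a b c →
           b :* (a :* c) := a :* (b :* (con (+ 1) :* c)))
           refl a [ suc n ]q ([ suc n ]q! ⁻¹) ⟩
    a * ([ suc n ]q * exp (suc n))   ≈⟨ *-congˡ (exp-recurrence n) ⟩
    a * (1# * [ n ]q! ⁻¹)            ≈⟨ *-congˡ (*-identityˡ _) ⟩
    a * [ n ]q! ⁻¹                   ∎

  -- For the q-derivative this says that the derivative of Exp_q(x) is Exp_q(qx).
  Exp-recurrence : ∀ n → [ suc n ]q * Exp (suc n) ≈ q ^ n * Exp n
  Exp-recurrence n = begin
    [ suc n ]q * (q ^ (suc n C 2) / [ suc n ]q!)  ≈⟨ /!-recurrence _ n ⟩
    q ^ (suc n C 2) / [ n ]q!                     ≈⟨ *-congʳ (^-congʳ q binomial) ⟩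
    q ^ (n ℕ.+ n C 2) / [ n ]q!                   ≈⟨ *-congʳ (^-homo-* q n (n C 2)) ⟩
    q ^ n * q ^ (n C 2) / [ n ]q!                 ≈⟨ *-assoc _ _ _ ⟩
    q ^ n * Exp n                                 ∎
    where
    binomial : suc n C 2 ≡ n ℕ.+ n C 2
    binomial = ≡.trans (≡.sym (nCk+nC[k+1]≡[n+1]C[k+1] n 1)) (≡.cong (ℕ._+ n C 2) (nC1≡n n))

  [+]q : ∀ m n → [ m ℕ.+ n ]q ≈ [ m ]q + q ^ m * [ n ]q
  [+]q zero    n = sym (trans (+-identityˡ _) (*-identityˡ _))
  [+]q (suc m) n = begin
    1# + sum (λ i → q * q ^ toℕ {m ℕ.+ n} i)      ≈⟨ +-congˡ (*-distribˡ-sum {m ℕ.+ n} q _) ⟨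
    1# + q * [ m ℕ.+ n ]q                         ≈⟨ +-congˡ (*-congˡ ([+]q m n)) ⟩
    1# + q * ([ m ]q + q ^ m * [ n ]q)
      ≈⟨ solve 4 (λ q a b c →
           con (+ 1) :+ q :* (a :+ b :* c) := (con (+ 1) :+ q :* a) :+ q :* b :* c)
           refl _ _ _ _ ⟩
    1# + q * [ m ]q + q * q ^ m * [ n ]q          ≈⟨ +-congʳ (+-congˡ (*-distribˡ-sum {m} q _)) ⟩
    [ suc m ]q + q ^ suc m * [ n ]q               ∎

  -- The q-analogue of the Euler operator x d/dx.
  ϑ : Series → Series
  ϑ f n = [ n ]q * f n

  -- The q-Leibniz rule: in [m + k]_q = [m]_q + q^m [k]_q the power q^m falls on the factor of
  -- degree m, which is thereby scaled.
  ϑ-⊠ : ∀ f g → ϑ (f ⊠ g) ≋ (f ⊠ ϑ g) ⊞ (ϑ f ⊠ scale q g)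
  ϑ-⊠ f g n = begin
    [ n ]q * (f ⊠ g) n
      ≈⟨ *-distribˡ-sum {suc n} [ n ]q (λ i → f (toℕ i) * g (n ∸ toℕ i)) ⟩
    sum {suc n} (λ i → [ n ]q * (f (toℕ i) * g (n ∸ toℕ i)))
      ≈⟨ sum-cong-≋ {suc n} term ⟩
    sum {suc n} (λ i → f (toℕ i) * ϑ g (n ∸ toℕ i) + ϑ f (toℕ i) * scale q g (n ∸ toℕ i))
      ≈⟨ ∑-distrib-+ {suc n} (λ i → f (toℕ i) * ϑ g (n ∸ toℕ i))
                               (λ i → ϑ f (toℕ i) * scale q g (n ∸ toℕ i)) ⟩
    (f ⊠ ϑ g) n + (ϑ f ⊠ scale q g) n ∎
    where
    term : ∀ i → [ n ]q * (f (toℕ i) * g (n ∸ toℕ i))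
               ≈ f (toℕ {suc n} i) * ϑ g (n ∸ toℕ i) + ϑ f (toℕ i) * scale q g (n ∸ toℕ i)
    term i = begin
      [ n ]q * (f k * g m)
        ≈⟨ *-congʳ (reflexive (≡.cong [_]q (ℕ.m∸n+n≡m (Fin.toℕ≤pred[n] i)))) ⟨
      [ m ℕ.+ k ]q * (f k * g m)
        ≈⟨ *-congʳ ([+]q m k) ⟩
      ([ m ]q + q ^ m * [ k ]q) * (f k * g m)
        ≈⟨ solve 5 (λ a b c d e →
             (a :+ b :* c) :* (d :* e) := d :* (a :* e) :+ (c :* d) :* (b :* e))
             refl _ _ _ _ _ ⟩
      f k * ϑ g m + ϑ f k * scale q g m ∎
      where
      k = toℕ i
      m = n ∸ k

  ⊠-headless : ∀ f g n → f 0 ≈ 0# → (f ⊠ g) (suc n) ≈ (f ∘ suc ⊠ g) n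
  ⊠-headless f g n f₀≈0 = trans (+-congʳ (trans (*-congʳ f₀≈0) (zeroˡ _))) (+-identityˡ _)

  scale-⊠ : ∀ c f g → scale c (f ⊠ g) ≋ scale c f ⊠ scale c g
  scale-⊠ c f g n = begin
    c ^ n * (f ⊠ g) n
      ≈⟨ *-distribˡ-sum {suc n} (c ^ n) (λ i → f (toℕ i) * g (n ∸ toℕ i)) ⟩
    sum {suc n} (λ i → c ^ n * (f (toℕ i) * g (n ∸ toℕ i)))      ≈⟨ sum-cong-≋ {suc n} term ⟩
    (scale c f ⊠ scale c g) n                                    ∎
    where
    term : ∀ i → c ^ n * (f (toℕ i) * g (n ∸ toℕ i)) ≈ scale c f (toℕ {suc n} i) * scale c g (n ∸ toℕ i)
    term i = begin
      c ^ n * (f k * g m)              ≈⟨ *-congʳ (^-congʳ c (ℕ.m∸n+n≡m (Fin.toℕ≤pred[n] i))) ⟨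
      c ^ (m ℕ.+ k) * (f k * g m)      ≈⟨ *-congʳ (^-homo-* c m k) ⟩
      c ^ m * c ^ k * (f k * g m)
        ≈⟨ solve 4 (λ a b c d → a :* b :* (c :* d) := (b :* c) :* (a :* d)) refl _ _ _ _ ⟩
      scale c f k * scale c g m        ∎
      where
      k = toℕ i
      m = n ∸ k

  -- The q-derivative of Exp_q(cx) is c Exp_q(cqx), so in the second Leibniz term both factors are
  -- scaled by q. That term is therefore a multiple of a coefficient of the original product, which
  -- closes the recurrence.
  Exp-⊠-recurrence : ∀ c g n → let f = scale c Exp in
    [ suc n ]q * (f ⊠ g) (suc n) ≈ (f ⊠ ϑ g ∘ suc) n + c * q ^ n * (f ⊠ g) n
  Exp-⊠-recurrence c g n = begin
    ϑ (f ⊠ g) (suc n)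
      ≈⟨ ϑ-⊠ f g (suc n) ⟩
    (f ⊠ ϑ g) (suc n) + (ϑ f ⊠ scale q g) (suc n)
      ≈⟨ +-cong (⊠-comm f (ϑ g) (suc n)) (⊠-headless (ϑ f) (scale q g) n (zeroˡ _)) ⟩
    (ϑ g ⊠ f) (suc n) + (ϑ f ∘ suc ⊠ scale q g) n
      ≈⟨ +-cong (⊠-headless (ϑ g) f n (zeroˡ _)) (⊠-cong {h = scale q g} derivative (λ _ → refl) n) ⟩
    (ϑ g ∘ suc ⊠ f) n + ((λ k → c * scale q f k) ⊠ scale q g) n
      ≈⟨ +-cong (⊠-comm (ϑ g ∘ suc) f n) (scalarˡ c (scale q f) (scale q g) n) ⟩
    (f ⊠ ϑ g ∘ suc) n + c * (scale q f ⊠ scale q g) n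
      ≈⟨ +-congˡ (*-congˡ (scale-⊠ q f g n)) ⟨
    (f ⊠ ϑ g ∘ suc) n + c * (q ^ n * (f ⊠ g) n)
      ≈⟨ +-congˡ (*-assoc _ _ _) ⟨
    (f ⊠ ϑ g ∘ suc) n + c * q ^ n * (f ⊠ g) n ∎
    where
    f = scale c Exp
    derivative : ∀ k → ϑ f (suc k) ≈ c * scale q f k
    derivative k = begin
      [ suc k ]q * (c * c ^ k * Exp (suc k))
        ≈⟨ solve 4 (λ a b c d → a :* (b :* c :* d) := b :* c :* (a :* d)) refl _ _ _ _ ⟩
      c * c ^ k * ([ suc k ]q * Exp (suc k))
        ≈⟨ *-congˡ (Exp-recurrence k) ⟩
      c * c ^ k * (q ^ k * Exp k)
        ≈⟨ solve 4 (λ a b c d → a :* b :* (c :* d) := a :* (c :* (b :* d))) refl _ _ _ _ ⟩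
      c * (q ^ k * (c ^ k * Exp k)) ∎

  -- If g r counts certain Lehmer codes of length r, then mix c g m j counts the
  -- codes of length m + j consisting of a strictly decreasing block of entries
  -- smaller than j, each of weight c, and a code counted by g.  If c = −1
  -- and the codes counted by g start with a weakly increasing block, it counts
  -- those of length m + j in which this block has no entry smaller than j.
  mix : Carrier → (ℕ → Carrier) → ℕ → ℕ → Carrier
  mix c g m zero    = g m
  mix c g m (suc j) = mix c g (suc m) j + c * q ^ j * mix c g m j

  -- Induction on j for all m at once: `ϑ` of the series `a m` is a shift of `a (suc m)`, so
  -- `Exp-⊠-recurrence` becomes the recursion of `mix` once the factor [j]_q! is taken out.
  mix≈⊠ : ∀ c g m j → mix c g m j ≈ [ j ]q! * (scale c Exp ⊠ λ r → g (m ℕ.+ r) / [ r ]q!) j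
  mix≈⊠ c g m zero    = sym (begin
    1# * (1# * Exp 0 * (g (m ℕ.+ 0) * 1# ⁻¹) + 0#)
      ≈⟨ solve 3 (λ a b c →
           con (+ 1) :* (con (+ 1) :* a :* (b :* c) :+ con (+ 0)) := a :* (b :* c))
           refl _ _ _ ⟩
    Exp 0 * (g (m ℕ.+ 0) * 1# ⁻¹)
      ≈⟨ *-cong Exp₀≈1 (*-cong (reflexive (≡.cong g (ℕ.+-identityʳ m))) 1⁻¹≈1) ⟩
    1# * (g m * 1#)
      ≈⟨ trans (*-identityˡ _) (*-identityʳ _) ⟩
    g m ∎)
  mix≈⊠ c g m (suc j) = begin
    mix c g (suc m) j + c * q ^ j * mix c g m j
      ≈⟨ +-cong (mix≈⊠ c g (suc m) j) (*-congˡ (mix≈⊠ c g m j)) ⟩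
    [ j ]q! * (f ⊠ a (suc m)) j + c * q ^ j * ([ j ]q! * (f ⊠ a m) j)
      ≈⟨ solve 4 (λ b x d y → b :* x :+ d :* (b :* y) := b :* (x :+ d :* y)) refl _ _ _ _ ⟩
    [ j ]q! * ((f ⊠ a (suc m)) j + c * q ^ j * (f ⊠ a m) j)
      ≈⟨ *-congˡ (+-congʳ (⊠-cong {f} {f} (λ _ → refl) step j)) ⟨
    [ j ]q! * ((f ⊠ ϑ (a m) ∘ suc) j + c * q ^ j * (f ⊠ a m) j)
      ≈⟨ *-congˡ (Exp-⊠-recurrence c (a m) j) ⟨
    [ j ]q! * ([ suc j ]q * (f ⊠ a m) (suc j))
      ≈⟨ *-assoc _ _ _ ⟨
    [ suc j ]q! * (f ⊠ a m) (suc j) ∎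
    where
    f = scale c Exp
    a : ℕ → Series
    a m r = g (m ℕ.+ r) / [ r ]q!
    step : ϑ (a m) ∘ suc ≋ a (suc m)
    step r = trans (/!-recurrence _ r) (*-congʳ (reflexive (≡.cong g (ℕ.+-suc m r))))

  -- exp_q belongs to the counts that are constantly 1. The first step of `mix` gives 1 - 1 = 0, and
  -- all further steps combine zeros.
  Exp-exp-inverse : scale (- 1#) Exp ⊠ exp ≋ constant 1#
  Exp-exp-inverse zero    = begin
    1# * Exp 0 * exp 0 + 0#  ≈⟨ +-congʳ (*-cong (*-congˡ Exp₀≈1) exp₀≈1) ⟩
    1# * 1# * 1# + 0#
      ≈⟨ solve 0 (con (+ 1) :* con (+ 1) :* con (+ 1) :+ con (+ 0) := con (+ 1)) refl ⟩
    1#                       ∎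
  Exp-exp-inverse (suc n) = unit-cancelˡ (!-unit (suc n)) (begin
    [ suc n ]q! * (scale (- 1#) Exp ⊠ exp) (suc n)  ≈⟨ mix≈⊠ (- 1#) (λ _ → 1#) 0 (suc n) ⟨
    mix (- 1#) (λ _ → 1#) 0 (suc n)                 ≈⟨ vanishes 0 n ⟩
    0#                                              ≈⟨ zeroʳ _ ⟨
    [ suc n ]q! * 0#                                ∎)
    where
    vanishes : ∀ m j → mix (- 1#) (λ _ → 1#) m (suc j) ≈ 0#
    vanishes m zero    = solve 0 (con (+ 1) :+ :- con (+ 1) :* con (+ 1) :* con (+ 1) := con (+ 0)) refl
    vanishes m (suc j) = begin
      mix (- 1#) (λ _ → 1#) (suc m) (suc j) + - 1# * q ^ suc j * mix (- 1#) (λ _ → 1#) m (suc j)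
        ≈⟨ +-cong (vanishes (suc m) j) (*-congˡ (vanishes m j)) ⟩
      0# + - 1# * q ^ suc j * 0#
        ≈⟨ trans (+-identityˡ _) (zeroʳ _) ⟩
      0# ∎

-- Lehmer codes

module LehmerCodes (R : CommutativeRing 0ℓ 0ℓ) (q : CommutativeRing.Carrier R) where

  open CommutativeRing R hiding (zero)
  open SumProperties semiring using (sum)
  open RawSemiringDefinitions (Semiring.rawSemiring semiring) using (_^_)
  open IntegerSolver R
  open SetoidReasoning setoid

  -- The weight of the codes c₁ … cₖ (0 ≤ cᵢ ≤ k − i) that follow the entry j,
  -- which is the top of an ascent if `up` holds and the bottom of a descent
  -- otherwise.  In the Lehmer code of a permutation the inversions add up and
  -- the descents stay in place.
  codes : (y t : Carrier) (k j : ℕ) (up : Bool) → Carrier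
  codes y t zero    j up = 1#
  codes y t (suc k) j up = sum {suc k} λ i → q ^ toℕ i *
    (if toℕ i ℕ.<ᵇ j then (if up then y * t else t) * codes y t k (toℕ i) false
                     else codes y t k (toℕ i) true)

  -- Two telescoping sums that meet at j, the place where the next entry of a code changes from a
  -- descent to an ascent; each side has its own potential.
  sum-telescope : ∀ n j → j ℕ.≤ n → (f h u w : ℕ → Carrier) →
    (∀ i → i ℕ.< j → f i ≈ u (suc i) - u i) →
    (∀ i → i ℕ.< n → h i ≈ w (suc i) - w i) →
    sum {n} (λ i → if toℕ i ℕ.<ᵇ j then f (toℕ i) else h (toℕ i)) ≈ (u j - u 0) + (w n - w j)
  sum-telescope zero zero _ f h u w _ _ =
    solve 2 (λ a b → con (+ 0) := (a :- a) :+ (b :- b)) refl (u 0) (w 0)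
  sum-telescope (suc n) zero _ f h u w f≈ h≈ = begin
    h 0 + sum {n} (λ i → if toℕ i ℕ.<ᵇ 0 then f (suc (toℕ i)) else h (suc (toℕ i)))
      ≈⟨ +-cong (h≈ 0 (s≤s z≤n)) (sum-telescope n 0 z≤n (f ∘ suc) (h ∘ suc) u (w ∘ suc)
           (λ _ ()) (λ i i<n → h≈ (suc i) (s≤s i<n))) ⟩
    (w 1 - w 0) + ((u 0 - u 0) + (w (suc n) - w 1))
      ≈⟨ solve 4 (λ a b c d →
           (a :- b) :+ ((c :- c) :+ (d :- a)) := (c :- c) :+ (d :- b))
           refl (w 1) (w 0) (u 0) (w (suc n)) ⟩
    (u 0 - u 0) + (w (suc n) - w 0) ∎
  sum-telescope (suc n) (suc j) (s≤s j≤n) f h u w f≈ h≈ = begin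
    f 0 + sum {n} (λ i → if toℕ i ℕ.<ᵇ j then f (suc (toℕ i)) else h (suc (toℕ i)))
      ≈⟨ +-cong (f≈ 0 (s≤s z≤n)) (sum-telescope n j j≤n (f ∘ suc) (h ∘ suc) (u ∘ suc) (w ∘ suc)
           (λ i i<j → f≈ (suc i) (s≤s i<j)) (λ i i<n → h≈ (suc i) (s≤s i<n))) ⟩
    (u 1 - u 0) + ((u (suc j) - u 1) + (w (suc n) - w (suc j)))
      ≈⟨ solve 4 (λ a b c d →
           (a :- b) :+ ((c :- a) :+ d) := (c :- b) :+ d)
           refl (u 1) (u 0) (u (suc j)) _ ⟩
    (u (suc j) - u 0) + (w (suc n) - w (suc j)) ∎

-- The generating function of Lehmer codes

-- With e₋ = 1/e this frees the right side of the equation of s from e, leaving a linear relation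
-- between the two products whose coefficients `mix` computes.
divide-out : (A : CommutativeRing 0ℓ 0ℓ) → let open CommutativeRing A in ∀ {e₋ e e₊ s m t} →
  e₋ * e ≈ 1# → s * (1# - t * e₊ * e) ≈ m * e → e₋ * s ≈ m + t * (e₊ * s)
divide-out A {e₋} {e} {e₊} {s} {m} {t} e₋e≈1 s-eq = begin
  e₋ * s
    ≈⟨ solve 6 (λ e₋ e e₊ s m t → e₋ :* s :=
         ((m :+ t :* (e₊ :* s)) :+ e₋ :* (s :* (con (+ 1) :- t :* e₊ :* e) :- m :* e))
         :+ (m :+ t :* (e₊ :* s)) :* (e₋ :* e :- con (+ 1))) refl e₋ e e₊ s m t ⟩
  _ ≈⟨ +-multiple _ _ e₋e≈1 ⟩
  _ ≈⟨ +-multiple _ _ s-eq ⟩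
  m + t * (e₊ * s) ∎
  where
  open CommutativeRing A
  open Cancellation A
  open IntegerSolver A
  open SetoidReasoning setoid

-- t = (Y + T) / (1 + YT) and y = (1 + Y)² T / ((Y + T) (1 + YT)), in a form
-- that does not require Y + T to be invertible.
record Substitution (R : RingWithInverse) : Set where
  open RingWithInverse R
  field
    {Y T y t} : Carrier
    t-eq      : t * (1# + Y * T) ≈ Y + T
    yt-eq     : y * t * (1# + Y * T) ^ 2 ≈ (1# + Y) ^ 2 * T
    1-T-unit  : (1# - T) * (1# - T) ⁻¹ ≈ 1#
    1+YT-unit : (1# + Y * T) * (1# + Y * T) ⁻¹ ≈ 1#

module CodeGeneratingFunction (R : RingWithInverse) (q : RingWithInverse.Carrier R)
  ([1+_]q-unit : InvertibleQNumbers R q) (σ : Substitution R) where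

  open RingWithInverse R
  open QSeries R q
  open Substitution σ
  open PowerSeriesInverse R
  open SumProperties semiring using (sum; *-distribˡ-sum; sum-cong-≋)
  open Cancellation commutativeRing
  open QExponentials R q [1+_]q-unit
  open LehmerCodes commutativeRing q
  open IntegerSolver commutativeRing
  open SetoidReasoning setoid

  private
    module x = RingWithInverse seriesRingWithInverse

    M N : Carrier
    M = 1# - T
    N = 1# + Y * T

  module Solution (S : Series)
    (S-eq : S x.* (x.1# x.- constant T x.* scale Y Exp x.* exp) x.≈ constant M x.* exp) where

    private
      E₋ E₊ : Series
      E₋ = scale (- 1#) Exp
      E₊ = scale Y Exp

      E₋⊠S : E₋ ⊠ S ≋ constant M ⊞ constant T ⊠ (E₊ ⊠ S)
      E₋⊠S = divide-out seriesRing {E₋} {exp} {E₊} {S} {constant M} {constant T} Exp-exp-inverse S-eq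

      g : ℕ → Carrier
      g n = [ n ]q! * S n

      g/! : ∀ n → g n / [ n ]q! ≈ S n
      g/! n = begin
        [ n ]q! * S n * [ n ]q! ⁻¹    ≈⟨ solve 3 (λ a b c → a :* b :* c := (a :* c) :* b) refl _ _ _ ⟩
        [ n ]q! * [ n ]q! ⁻¹ * S n    ≈⟨ trans (*-congʳ (!-unit n)) (*-identityˡ _) ⟩
        S n                           ∎

      I D : ℕ → ℕ → Carrier
      I = mix (- 1#) g
      D = mix Y g

      mix-total : ∀ c n → mix c g 0 n ≈ [ n ]q! * (scale c Exp ⊠ S) n
      mix-total c n = trans (mix≈⊠ c g 0 n) (*-congˡ (⊠-cong {scale c Exp} (λ _ → refl) g/! n))

      -- All entries of a code of length n are smaller than n, so `I 0 n` counts those with an empty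
      -- first increasing block. For n > 0 a pair of blocks must follow, with weight T, and it
      -- starts with a decreasing block. Algebraically, 1 - T contributes to the constant term only.
      I≈TD : ∀ n → I 0 (suc n) ≈ T * D 0 (suc n)
      I≈TD n = begin
        I 0 (suc n)
          ≈⟨ mix-total (- 1#) (suc n) ⟩
        [ suc n ]q! * (E₋ ⊠ S) (suc n)
          ≈⟨ *-congˡ (E₋⊠S (suc n)) ⟩
        [ suc n ]q! * (0# + (constant T ⊠ (E₊ ⊠ S)) (suc n))
          ≈⟨ *-congˡ (trans (+-identityˡ _) (⊠-constantˡ T (E₊ ⊠ S) (suc n))) ⟩
        [ suc n ]q! * (T * (E₊ ⊠ S) (suc n))
          ≈⟨ solve 3 (λ a b c → a :* (b :* c) := b :* (a :* c)) refl _ _ _ ⟩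
        T * ([ suc n ]q! * (E₊ ⊠ S) (suc n))
          ≈⟨ *-congˡ (mix-total Y (suc n)) ⟨
        T * D 0 (suc n) ∎

      g₀≈1 : g 0 ≈ 1#
      g₀≈1 = trans (*-identityˡ _) (unit-cancelˡ 1-T-unit (begin
        M * S 0
          ≈⟨ solve 2 (λ t s → (con (+ 1) :- t) :* s :=
               (con (+ 1) :* con (+ 1) :* s :+ con (+ 0))
               :- t :* (con (+ 1) :* con (+ 1) :* s :+ con (+ 0))) refl T (S 0) ⟩
        (1# * 1# * S 0 + 0#) - T * (1# * 1# * S 0 + 0#)
          ≈⟨ +-cong (+-congʳ (*-congʳ (*-congˡ Exp₀≈1))) (-‿cong (*-congˡ (+-congʳ (*-congʳ (*-congˡ Exp₀≈1))))) ⟨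
        (E₋ ⊠ S) 0 - T * (E₊ ⊠ S) 0
          ≈⟨ +-congʳ (E₋⊠S 0) ⟩
        (M + (constant T ⊠ (E₊ ⊠ S)) 0) - T * (E₊ ⊠ S) 0
          ≈⟨ +-congʳ (+-congˡ (⊠-constantˡ T (E₊ ⊠ S) 0)) ⟩
        (M + T * (E₊ ⊠ S) 0) - T * (E₊ ⊠ S) 0
          ≈⟨ solve 2 (λ m z → (m :+ z) :- z := m :* con (+ 1)) refl M _ ⟩
        M * 1# ∎))

      -- I and D count the continuations after a letter in an increasing, resp.
      -- decreasing block.  A letter at the top of an ascent lies in a decreasing
      -- block with relative weight YT, one at the bottom of a descent with Y.
      ascended descended : ℕ → ℕ → Carrier
      ascended  k j = M ^ k * (I (k ∸ j) j + Y * T * D (k ∸ j) j)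
      descended k j = M ^ k * (I (k ∸ j) j + Y * D (k ∸ j) j)

      -- Keeps the total length at `suc k`: for i ≤ k the first index `suc (k ∸ i)` in the recursion
      -- of `mix` is `suc k ∸ i`.
      mix-suc : ∀ c k i → i ℕ.≤ k →
        mix c g (suc k ∸ suc i) (suc i) ≈ mix c g (suc k ∸ i) i + c * q ^ i * mix c g (k ∸ i) i
      mix-suc c k i i≤k = +-congʳ (reflexive (≡.cong (λ m → mix c g m i) (≡.sym (ℕ.+-∸-assoc 1 i≤k))))

      -- Let A and B be the counts `I` and `D` at total length `suc k`. By `mix-suc`, the step from
      -- i to i + 1 adds -q^i I to A and Y q^i D to B. Hence q^i times `descended` is the increment
      -- of B - A, and q^i times `ascended` that of TB - A, up to `M ^ k`.
      sum-states : ∀ a b k j → j ℕ.≤ suc k →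
        sum {suc k} (λ i → if toℕ i ℕ.<ᵇ j then a * (q ^ toℕ i * descended k (toℕ i))
                                            else b * (q ^ toℕ i * ascended k (toℕ i)))
        ≈ M ^ k * (a * (D (suc k ∸ j) j - I (suc k ∸ j) j) + b * (I (suc k ∸ j) j - T * D (suc k ∸ j) j))
      sum-states a b k j j≤1+k = begin
        sum {suc k} (λ i → if toℕ i ℕ.<ᵇ j then f (toℕ i) else h (toℕ i))
          ≈⟨ sum-telescope (suc k) j j≤1+k f h u w
               (λ i i<j → descent i (ℕ.≤-pred (ℕ.≤-trans i<j j≤1+k))) (λ i i<1+k → ascent i (ℕ.≤-pred i<1+k)) ⟩
        (u j - u 0) + (w (suc k) - w j)
          -- Both outer boundary terms vanish: at 0 the two counts are `g (suc k)`, and at `suc k`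
          -- the equation of S gives A = TB.
          ≈⟨ +-congˡ (+-congʳ (*-congˡ (*-congˡ (+-congˡ (-‿cong final))))) ⟩
        (u j - u 0) + (M ^ k * (b * (T * B (suc k) - T * B (suc k))) - w j)
          ≈⟨ solve 8 (λ m a b b₀ bₙ i d t →
               (m :* (a :* (d :- i)) :- m :* (a :* (b₀ :- b₀)))
               :+ (m :* (b :* (t :* bₙ :- t :* bₙ)) :- m :* (b :* (t :* d :- i)))
               := m :* (a :* (d :- i) :+ b :* (i :- t :* d))) refl (M ^ k) a b (B 0) (B (suc k)) (A j) (B j) T ⟩
        M ^ k * (a * (B j - A j) + b * (A j - T * B j)) ∎
        where
        A B f h u w : ℕ → Carrier
        A i = I (suc k ∸ i) i
        B i = D (suc k ∸ i) i
        f i = a * (q ^ i * descended k i)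
        h i = b * (q ^ i * ascended k i)
        u i = M ^ k * (a * (B i - A i))
        w i = M ^ k * (b * (T * B i - A i))
        final : A (suc k) ≈ T * B (suc k)
        final = ≡.subst (λ m → I m (suc k) ≈ T * D m (suc k)) (≡.sym (ℕ.n∸n≡0 k)) (I≈TD k)
        descent : ∀ i → i ℕ.≤ k → f i ≈ u (suc i) - u i
        descent i i≤k = begin
          a * (q ^ i * (M ^ k * (I (k ∸ i) i + Y * D (k ∸ i) i)))
            ≈⟨ solve 8 (λ a r m c y d α β → a :* (r :* (m :* (c :+ y :* d))) :=
                 m :* (a :* ((β :+ y :* r :* d) :- (α :+ (:- con (+ 1)) :* r :* c))) :- m :* (a :* (β :- α)))
                 refl a (q ^ i) (M ^ k) (I (k ∸ i) i) Y (D (k ∸ i) i) (A i) (B i) ⟩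
          M ^ k * (a * ((B i + Y * q ^ i * D (k ∸ i) i) - (A i + - 1# * q ^ i * I (k ∸ i) i))) - u i
            ≈⟨ +-congʳ (*-congˡ (*-congˡ (+-cong (mix-suc Y k i i≤k) (-‿cong (mix-suc (- 1#) k i i≤k))))) ⟨
          u (suc i) - u i ∎
        ascent : ∀ i → i ℕ.≤ k → h i ≈ w (suc i) - w i
        ascent i i≤k = begin
          b * (q ^ i * (M ^ k * (I (k ∸ i) i + Y * T * D (k ∸ i) i)))
            ≈⟨ solve 9 (λ b r m c y t d α β → b :* (r :* (m :* (c :+ y :* t :* d))) :=
                 m :* (b :* (t :* (β :+ y :* r :* d) :- (α :+ (:- con (+ 1)) :* r :* c))) :- m :* (b :* (t :* β :- α)))
                 refl b (q ^ i) (M ^ k) (I (k ∸ i) i) Y T (D (k ∸ i) i) (A i) (B i) ⟩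
          M ^ k * (b * (T * (B i + Y * q ^ i * D (k ∸ i) i) - (A i + - 1# * q ^ i * I (k ∸ i) i))) - w i
            ≈⟨ +-congʳ (*-congˡ (*-congˡ (+-cong (*-congˡ (mix-suc Y k i i≤k)) (-‿cong (mix-suc (- 1#) k i i≤k))))) ⟨
          w (suc i) - w i ∎

      -- One step for both states: c normalises the current state, and a and b are the weights of
      -- passing to the normalised states after a descent and after an ascent.
      codes-step : ∀ up c a b k j → j ℕ.≤ suc k →
        (∀ i → i ℕ.≤ k → c * ((if up then y * t else t) * codes y t k i false) ≈ a * descended k i) →
        (∀ i → i ℕ.≤ k → c * codes y t k i true ≈ b * ascended k i) →
        c * codes y t (suc k) j up
        ≈ M ^ k * (a * (D (suc k ∸ j) j - I (suc k ∸ j) j) + b * (I (suc k ∸ j) j - T * D (suc k ∸ j) j))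
      codes-step up c a b k j j≤1+k descend ascend = begin
        c * codes y t (suc k) j up
          ≈⟨ *-distribˡ-sum {suc k} c (λ i → q ^ toℕ i * entry i) ⟩
        sum {suc k} (λ i → c * (q ^ toℕ i * entry i))
          ≈⟨ sum-cong-≋ {suc k} (λ i → term (toℕ i) (Fin.toℕ≤pred[n] i) (toℕ i ℕ.<ᵇ j)) ⟩
        sum {suc k} (λ i → if toℕ i ℕ.<ᵇ j then a * (q ^ toℕ i * descended k (toℕ i))
                                          else b * (q ^ toℕ i * ascended k (toℕ i)))
          ≈⟨ sum-states a b k j j≤1+k ⟩
        _ ∎
        where
        entry : Fin (suc k) → Carrier
        entry i = if toℕ i ℕ.<ᵇ j then (if up then y * t else t) * codes y t k (toℕ i) false
                                  else codes y t k (toℕ i) true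
        swap : ∀ {c x r a z} → c * x ≈ a * z → c * (r * x) ≈ a * (r * z)
        swap {c} {x} {r} {a} {z} cx≈az = begin
          c * (r * x)  ≈⟨ solve 3 (λ c r x → c :* (r :* x) := r :* (c :* x)) refl c r x ⟩
          r * (c * x)  ≈⟨ *-congˡ cx≈az ⟩
          r * (a * z)  ≈⟨ solve 3 (λ r a z → r :* (a :* z) := a :* (r :* z)) refl r a z ⟩
          a * (r * z)  ∎
        term : ∀ i → i ℕ.≤ k → ∀ below →
          c * (q ^ i * (if below then (if up then y * t else t) * codes y t k i false else codes y t k i true))
          ≈ (if below then a * (q ^ i * descended k i) else b * (q ^ i * ascended k i))
        term i i≤k true  = swap (descend i i≤k)
        term i i≤k false = swap (ascend i i≤k)

      -- The weight (1 + Y)² T of a peak with its valley is split: (1 + Y) T is paid when the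
      -- descent begins, and the other 1 + Y is kept in the normalisation of the descending state
      -- until an ascent or the end. No division by 1 + Y takes place, as `Substitution` does not
      -- make it a unit.
      codes-ascended  : ∀ k j → j ℕ.≤ k → N ^ suc k * codes y t k j true ≈ ascended k j
      codes-descended : ∀ k j → j ℕ.≤ k → N ^ k * (1# + Y) * codes y t k j false ≈ descended k j
      codes-ascended zero zero _ = begin
        N * 1# * 1#                  ≈⟨ solve 2 (λ y t → (con (+ 1) :+ y :* t) :* con (+ 1) :* con (+ 1)
                                          := con (+ 1) :* (con (+ 1) :+ y :* t :* con (+ 1))) refl Y T ⟩
        1# * (1# + Y * T * 1#)       ≈⟨ *-congˡ (+-cong g₀≈1 (*-congˡ g₀≈1)) ⟨
        1# * (g 0 + Y * T * g 0)     ∎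
      codes-ascended (suc k) j j≤1+k = begin
        N ^ suc (suc k) * codes y t (suc k) j true
          ≈⟨ codes-step true (N ^ suc (suc k)) ((1# + Y) * T) N k j j≤1+k descend
               (λ i i≤k → trans (*-assoc _ _ _) (*-congˡ (codes-ascended k i i≤k))) ⟩
        M ^ k * ((1# + Y) * T * (D (suc k ∸ j) j - I (suc k ∸ j) j) + N * (I (suc k ∸ j) j - T * D (suc k ∸ j) j))
          -- The factor that raises `M ^ k` to `M ^ suc k` appears here: the coefficient of I is 1 -
          -- T, and that of D is (1 + Y) T - (1 + YT) T = YT (1 - T).
          ≈⟨ solve 5 (λ m y t d i →
               m :* ((con (+ 1) :+ y) :* t :* (d :- i) :+ (con (+ 1) :+ y :* t) :* (i :- t :* d))
               := (con (+ 1) :- t) :* m :* (i :+ y :* t :* d)) refl (M ^ k) Y T (D (suc k ∸ j) j) (I (suc k ∸ j) j) ⟩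
        ascended (suc k) j ∎
        where
        descend : ∀ i → i ℕ.≤ k →
          N ^ suc (suc k) * (y * t * codes y t k i false) ≈ (1# + Y) * T * descended k i
        descend i i≤k = begin
          N ^ suc (suc k) * (y * t * codes y t k i false)
            ≈⟨ solve 4 (λ n nk z p →
                 n :* (n :* nk) :* (z :* p) := (z :* n :^ 2) :* (nk :* p))
                 refl N (N ^ k) (y * t) _ ⟩
          y * t * N ^ 2 * (N ^ k * codes y t k i false)
            ≈⟨ *-congʳ yt-eq ⟩
          (1# + Y) ^ 2 * T * (N ^ k * codes y t k i false)
            ≈⟨ solve 4 (λ y t nk p → (con (+ 1) :+ y) :^ 2 :* t :* (nk :* p)
                 := (con (+ 1) :+ y) :* t :* (nk :* (con (+ 1) :+ y) :* p)) refl Y T (N ^ k) _ ⟩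
          (1# + Y) * T * (N ^ k * (1# + Y) * codes y t k i false)
            ≈⟨ *-congˡ (codes-descended k i i≤k) ⟩
          (1# + Y) * T * descended k i ∎
      codes-descended zero zero _ = begin
        1# * (1# + Y) * 1#           ≈⟨ solve 1 (λ y → con (+ 1) :* (con (+ 1) :+ y) :* con (+ 1)
                                          := con (+ 1) :* (con (+ 1) :+ y :* con (+ 1))) refl Y ⟩
        1# * (1# + Y * 1#)           ≈⟨ *-congˡ (+-cong g₀≈1 (*-congˡ g₀≈1)) ⟨
        1# * (g 0 + Y * g 0)         ∎
      codes-descended (suc k) j j≤1+k = begin
        N ^ suc k * (1# + Y) * codes y t (suc k) j false
          ≈⟨ codes-step false (N ^ suc k * (1# + Y)) (Y + T) (1# + Y) k j j≤1+k descend ascend ⟩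
        M ^ k * ((Y + T) * (D (suc k ∸ j) j - I (suc k ∸ j) j) + (1# + Y) * (I (suc k ∸ j) j - T * D (suc k ∸ j) j))
          ≈⟨ solve 5 (λ m y t d i →
               m :* ((y :+ t) :* (d :- i) :+ (con (+ 1) :+ y) :* (i :- t :* d))
               := (con (+ 1) :- t) :* m :* (i :+ y :* d)) refl (M ^ k) Y T (D (suc k ∸ j) j) (I (suc k ∸ j) j) ⟩
        descended (suc k) j ∎
        where
        descend : ∀ i → i ℕ.≤ k →
          N ^ suc k * (1# + Y) * (t * codes y t k i false) ≈ (Y + T) * descended k i
        descend i i≤k = begin
          N ^ suc k * (1# + Y) * (t * codes y t k i false)
            ≈⟨ solve 5 (λ n nk y t p → n :* nk :* (con (+ 1) :+ y) :* (t :* p)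
                 := t :* n :* (nk :* (con (+ 1) :+ y) :* p)) refl N (N ^ k) Y t _ ⟩
          t * N * (N ^ k * (1# + Y) * codes y t k i false)
            ≈⟨ *-cong t-eq (codes-descended k i i≤k) ⟩
          (Y + T) * descended k i ∎
        ascend : ∀ i → i ℕ.≤ k → N ^ suc k * (1# + Y) * codes y t k i true ≈ (1# + Y) * ascended k i
        ascend i i≤k = begin
          N ^ suc k * (1# + Y) * codes y t k i true
            ≈⟨ solve 3 (λ n y p → n :* y :* p := y :* (n :* p)) refl (N ^ suc k) (1# + Y) _ ⟩
          (1# + Y) * (N ^ suc k * codes y t k i true)
            ≈⟨ *-congˡ (codes-ascended k i i≤k) ⟩
          (1# + Y) * ascended k i ∎

    -- At j = 0 both counts are `g n`, so `ascended n 0` contains a factor 1 + YT, which cancels the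
    -- surplus one in `codes-ascended`. No entry lies below 0, so the first entry of the code counts
    -- as an ascent.
    series-counts-codes : ∀ n → M ^ n * ([ n ]q! * S n) ≈ N ^ n * codes y t n 0 true
    series-counts-codes n = unit-cancelˡ 1+YT-unit (begin
      N * (M ^ n * g n)
        ≈⟨ solve 4 (λ y t m g →
             (con (+ 1) :+ y :* t) :* (m :* g) := m :* (g :+ y :* t :* g))
             refl Y T (M ^ n) (g n) ⟩
      ascended n 0
        ≈⟨ codes-ascended n 0 z≤n ⟨
      N ^ suc n * codes y t n 0 true
        ≈⟨ *-assoc _ _ _ ⟩
      N * (N ^ n * codes y t n 0 true) ∎)

-- Permutations

module Letters where

  private module Σ = SumProperties ℕ.+-*-semiring
  open Σ public using () renaming (sum to sumℕ)

  private variable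
    m k : ℕ

  -- Sets of letters are Boolean functions, so that membership, deletion and the test for distinct
  -- letters combine by `_∧_` alone.
  delete : (Fin m → Bool) → Fin m → Fin m → Bool
  delete V a b = V b ∧ not (does (a Fin.≟ b))

  total : (Fin m → Bool) → (Fin m → ℕ) → ℕ
  total V φ = sumℕ λ b → if V b then φ b else 0

  card : (Fin m → Bool) → ℕ
  card V = total V λ _ → 1

  -- When V consists of the letters still to be placed, this is the entry of the Lehmer code at a.
  rank : (Fin m → Bool) → Fin m → ℕ
  rank V a = total V (_≺ a)

  within : (Fin m → Bool) → Vec (Fin m) k → Bool
  within V []      = true
  within V (a ∷ w) = V a ∧ within V w

  distinct : Vec (Fin m) k → Bool
  distinct w = does (allPairs? (λ a b → ¬? (a Fin.≟ b)) w)

  delete-self : ∀ (V : Fin m → Bool) a → delete V a a ≡ false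
  delete-self V a = ≡.trans (≡.cong (λ b → V a ∧ not b) (dec-true (a Fin.≟ a) ≡.refl)) (Bool.∧-zeroʳ (V a))

  total-delete : ∀ (V : Fin m → Bool) φ a → V a ≡ true → total V φ ≡ φ a ℕ.+ total (delete V a) φ
  total-delete V φ zero    Va rewrite Va =
    ≡.cong (φ zero ℕ.+_) (Σ.sum-cong-≗ λ b → ≡.cong (if_then φ (suc b) else 0) (≡.sym (Bool.∧-identityʳ _)))
  total-delete V φ (suc a) Va = begin
    V₀ ℕ.+ total (V ∘ suc) (φ ∘ suc)
      ≡⟨ ≡.cong (V₀ ℕ.+_) (total-delete (V ∘ suc) (φ ∘ suc) a Va) ⟩
    V₀ ℕ.+ (φ (suc a) ℕ.+ total (delete (V ∘ suc) a) (φ ∘ suc))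
      ≡⟨ x∙yz≈y∙xz V₀ (φ (suc a)) _ ⟩
    φ (suc a) ℕ.+ (V₀ ℕ.+ total (delete (V ∘ suc) a) (φ ∘ suc))
      ≡⟨ ≡.cong (λ b → φ (suc a) ℕ.+ ((if b then φ zero else 0) ℕ.+ total (delete (V ∘ suc) a) (φ ∘ suc)))
                (Bool.∧-identityʳ (V zero)) ⟨
    φ (suc a) ℕ.+ total (delete V (suc a)) φ ∎
    where
    open ≡.≡-Reasoning
    open CommutativeSemigroupProperties ℕ.+-commutativeSemigroup using (x∙yz≈y∙xz)
    V₀ = if V zero then φ zero else 0

  card≡0⇒total≡0 : ∀ (V : Fin m → Bool) φ → card V ≡ 0 → total V φ ≡ 0
  card≡0⇒total≡0 {zero}  V φ _ = ≡.refl
  card≡0⇒total≡0 {suc m} V φ eq with V zero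
  ... | false = card≡0⇒total≡0 (V ∘ suc) (φ ∘ suc) eq

  total-zero : ∀ (V : Fin m → Bool) → total V (λ _ → 0) ≡ 0
  total-zero {zero}  V = ≡.refl
  total-zero {suc m} V with V zero
  ... | true  = total-zero (V ∘ suc)
  ... | false = total-zero (V ∘ suc)

  card-full : ∀ m → card {m} (λ _ → true) ≡ m
  card-full zero    = ≡.refl
  card-full (suc m) = ≡.cong suc (card-full m)

  total-mono : ∀ (V : Fin m → Bool) {φ ψ} → (∀ b → φ b ℕ.≤ ψ b) → total V φ ℕ.≤ total V ψ
  total-mono {zero}  V φ≤ψ = z≤n
  total-mono {suc m} V φ≤ψ with V zero
  ... | true  = ℕ.+-mono-≤ (φ≤ψ zero) (total-mono (V ∘ suc) (φ≤ψ ∘ suc))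
  ... | false = total-mono (V ∘ suc) (φ≤ψ ∘ suc)

  ≺-true : ∀ {a b : Fin m} → toℕ a ℕ.< toℕ b → (a ≺ b) ≡ 1
  ≺-true {a = a} {b} a<b = ≡.cong (if_then 1 else 0) (dec-true (a Fin.<? b) a<b)

  ≺-false : ∀ {a b : Fin m} → ¬ (toℕ a ℕ.< toℕ b) → (a ≺ b) ≡ 0
  ≺-false {a = a} {b} a≮b = ≡.cong (if_then 1 else 0) (dec-false (a Fin.<? b) a≮b)

  ≺-mono : ∀ {a c : Fin m} → toℕ a ℕ.≤ toℕ c → ∀ b → (b ≺ a) ℕ.≤ (b ≺ c)
  ≺-mono {a = a} {c} a≤c b with b Fin.<? a
  ... | yes b<a = ℕ.≤-reflexive (≡.trans (≺-true b<a) (≡.sym (≺-true (ℕ.<-≤-trans b<a a≤c))))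
  ... | no  b≮a = ℕ.≤-trans (ℕ.≤-reflexive (≺-false b≮a)) z≤n

  rank-mono : ∀ (V : Fin m → Bool) {a c} → toℕ a ℕ.≤ toℕ c → rank V a ℕ.≤ rank V c
  rank-mono V a≤c = total-mono V (≺-mono a≤c)

  rank-delete : ∀ (V : Fin m → Bool) {a} → V a ≡ true → rank (delete V a) a ≡ rank V a
  rank-delete V {a} Va =
    ≡.sym (≡.trans (total-delete V (_≺ a) a Va)
      (≡.cong (ℕ._+ rank (delete V a) a) (≺-false {a = a} {a} (ℕ.<-irrefl ≡.refl))))

  rank-strict : ∀ (V : Fin m → Bool) {a c} → V a ≡ true → toℕ a ℕ.< toℕ c → rank V a ℕ.< rank V c
  rank-strict V {a} {c} Va a<c = begin-strict
    rank V a                          ≡⟨ rank-delete V Va ⟨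
    rank (delete V a) a               <⟨ ℕ.≤-refl ⟩
    1 ℕ.+ rank (delete V a) a         ≤⟨ ℕ.+-monoʳ-≤ 1 (rank-mono (delete V a) (ℕ.<⇒≤ a<c)) ⟩
    1 ℕ.+ rank (delete V a) c         ≡⟨ ≡.cong (ℕ._+ rank (delete V a) c) (≺-true a<c) ⟨
    (a ≺ c) ℕ.+ rank (delete V a) c   ≡⟨ total-delete V (_≺ c) a Va ⟨
    rank V c                          ∎
    where open ℕ.≤-Reasoning

  arranges : (Fin m → Bool) → Vec (Fin m) k → Bool
  arranges V w = within V w ∧ distinct w

  ∧-interchange : ∀ a b c d → (a ∧ b) ∧ (c ∧ d) ≡ (a ∧ c) ∧ (b ∧ d)
  ∧-interchange true  b     true  d = ≡.refl
  ∧-interchange true  true  false d = ≡.refl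
  ∧-interchange true  false false d = ≡.refl
  ∧-interchange false b     c     d = ≡.refl

  within-delete : ∀ V (a : Fin m) (w : Vec (Fin m) k) →
    within V w ∧ does (all? (λ b → ¬? (a Fin.≟ b)) w) ≡ within (delete V a) w
  within-delete V a []      = ≡.refl
  within-delete V a (b ∷ w) = ≡.trans
    (∧-interchange (V b) (within V w) (not (does (a Fin.≟ b))) _)
    (≡.cong (delete V a b ∧_) (within-delete V a w))

  -- The part of the distinctness test that involves a merges with membership in V into membership
  -- in `delete V a`.
  arranges-∷ : ∀ V (a : Fin m) (w : Vec (Fin m) k) →
    arranges V (a ∷ w) ≡ V a ∧ arranges (delete V a) w
  arranges-∷ V a w with V a
  ... | false = ≡.refl
  ... | true  = ≡.trans (≡.sym (Bool.∧-assoc (within V w) _ (distinct w)))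
                        (≡.cong (_∧ distinct w) (within-delete V a w))

  within-full : ∀ (w : Vec (Fin m) k) → within (λ _ → true) w ≡ true
  within-full []      = ≡.refl
  within-full (a ∷ w) = within-full w

  -- How many later letters are smaller than a given one depends on the set of later letters and not
  -- on their order; this is why inversions become a sum of ranks.
  arranges-total : ∀ V (w : Vec (Fin m) k) φ → card V ≡ k → arranges V w ≡ true →
    Vec.sum (Vec.map φ w) ≡ total V φ
  arranges-total V []      φ |V| _  = ≡.sym (card≡0⇒total≡0 V φ |V|)
  arranges-total V (a ∷ w) φ |V| ok with V a in Va | ≡.trans (≡.sym (arranges-∷ V a w)) ok
  ... | true | ok′ = ≡.trans
    (≡.cong (φ a ℕ.+_) (arranges-total (delete V a) w φ
      (ℕ.suc-injective (≡.trans (≡.sym (total-delete V (λ _ → 1) a Va)) |V|)) ok′))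
    (≡.sym (total-delete V φ a Va))

module PermutationSums (R : RingWithInverse) (q : RingWithInverse.Carrier R) where

  open RingWithInverse R
  open Letters
  open QSeries R q using (P)
  open LehmerCodes commutativeRing q using (codes)
  open SumProperties semiring using (sum; sum-cong-≋)
  open ExpProperties semiring using (^-homo-*)
  open IntegerSolver commutativeRing
  open SetoidReasoning setoid

  private variable
    m k : ℕ
    A B : Set

  ∑ˡ : (A → Carrier) → List A → Carrier
  ∑ˡ f xs = List.foldr _+_ 0# (List.map f xs)

  ∑ˡ-cong : ∀ {f g : A → Carrier} → (∀ x → f x ≈ g x) → ∀ xs → ∑ˡ f xs ≈ ∑ˡ g xs
  ∑ˡ-cong f≈g []       = refl
  ∑ˡ-cong f≈g (x ∷ xs) = +-cong (f≈g x) (∑ˡ-cong f≈g xs)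

  ∑ˡ-++ : ∀ (f : A → Carrier) xs ys → ∑ˡ f (xs List.++ ys) ≈ ∑ˡ f xs + ∑ˡ f ys
  ∑ˡ-++ f []       ys = sym (+-identityˡ _)
  ∑ˡ-++ f (x ∷ xs) ys = trans (+-congˡ (∑ˡ-++ f xs ys)) (sym (+-assoc _ _ _))

  ∑ˡ-map : ∀ (f : B → Carrier) (g : A → B) xs → ∑ˡ f (List.map g xs) ≈ ∑ˡ (f ∘ g) xs
  ∑ˡ-map f g []       = refl
  ∑ˡ-map f g (x ∷ xs) = +-congˡ (∑ˡ-map f g xs)

  ∑ˡ-concatMap : ∀ (f : B → Carrier) (g : A → List B) xs →
    ∑ˡ f (List.concatMap g xs) ≈ ∑ˡ (λ x → ∑ˡ f (g x)) xs
  ∑ˡ-concatMap f g []       = refl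
  ∑ˡ-concatMap f g (x ∷ xs) = trans (∑ˡ-++ f (g x) _) (+-congˡ (∑ˡ-concatMap f g xs))

  ∑ˡ-tabulate : ∀ (f : A → Carrier) (g : Fin m → A) → ∑ˡ f (List.tabulate g) ≈ sum (f ∘ g)
  ∑ˡ-tabulate {m = zero}  f g = refl
  ∑ˡ-tabulate {m = suc m} f g = +-congˡ (∑ˡ-tabulate f (g ∘ suc))

  ∑ˡ-filter : ∀ {p} {Q : Pred A p} (Q? : Decidable Q) f xs →
    ∑ˡ f (List.filter Q? xs) ≈ ∑ˡ (λ x → if does (Q? x) then f x else 0#) xs
  ∑ˡ-filter Q? f []       = refl
  ∑ˡ-filter Q? f (x ∷ xs) with does (Q? x)
  ... | true  = +-congˡ (∑ˡ-filter Q? f xs)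
  ... | false = trans (∑ˡ-filter Q? f xs) (sym (+-identityˡ _))

  ∑ˡ-zero : ∀ (xs : List A) → ∑ˡ (λ _ → 0#) xs ≈ 0#
  ∑ˡ-zero []       = refl
  ∑ˡ-zero (x ∷ xs) = trans (+-identityˡ _) (∑ˡ-zero xs)

  ∑ˡ-*ˡ : ∀ c (f : A → Carrier) xs → ∑ˡ (λ x → c * f x) xs ≈ c * ∑ˡ f xs
  ∑ˡ-*ˡ c f []       = sym (zeroʳ c)
  ∑ˡ-*ˡ c f (x ∷ xs) = trans (+-congˡ (∑ˡ-*ˡ c f xs)) (sym (distribˡ c _ _))

  ∑-words : ∀ (f : Vec (Fin m) (suc k) → Carrier) →
    ∑ˡ f (words m (suc k)) ≈ sum λ a → ∑ˡ (f ∘ (a ∷_)) (words m k)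
  ∑-words {m} {k} f = begin
    ∑ˡ f (words m (suc k))
      ≈⟨ ∑ˡ-concatMap f (λ a → List.map (a ∷_) (words m k)) (List.allFin m) ⟩
    ∑ˡ (λ a → ∑ˡ f (List.map (a ∷_) (words m k))) (List.allFin m)
      ≈⟨ ∑ˡ-tabulate {m = m} _ (λ a → a) ⟩
    sum (λ a → ∑ˡ f (List.map (a ∷_) (words m k)))
      ≈⟨ sum-cong-≋ {m} (λ a → ∑ˡ-map f (a ∷_) (words m k)) ⟩
    sum (λ a → ∑ˡ (f ∘ (a ∷_)) (words m k)) ∎

  ∑-arrangements : (Fin m → Bool) → ∀ k → (Vec (Fin m) k → Carrier) → Carrier
  ∑-arrangements {m} V k f = ∑ˡ (λ w → if arranges V w then f w else 0#) (words m k)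

  ∑-arrangements-cong : ∀ (V : Fin m → Bool) {f g} c →
    (∀ w → arranges V w ≡ true → f w ≈ c * g w) → ∑-arrangements V k f ≈ c * ∑-arrangements V k g
  ∑-arrangements-cong {m} {k} V {f} {g} c f≈cg = trans (∑ˡ-cong term (words m k)) (∑ˡ-*ˡ c _ (words m k))
    where
    term : ∀ w → (if arranges V w then f w else 0#) ≈ c * (if arranges V w then g w else 0#)
    term w with arranges V w in ok
    ... | true  = f≈cg w ok
    ... | false = sym (zeroʳ c)

  -- In increasing order the letters of V have the ranks 0, 1, 2 and so on. If the least letter of
  -- the alphabet is in V, it raises all other ranks by one, whence `h ∘ suc`.
  sum-rank : ∀ (V : Fin m → Bool) (h : ℕ → Carrier) →
    sum (λ a → if V a then h (rank V a) else 0#) ≈ sum {card V} (h ∘ toℕ)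
  sum-rank {zero}  V h = refl
  sum-rank {suc m} V h with V zero
  ... | true  = +-cong (reflexive (≡.cong h rank-zero)) (sum-rank (V ∘ suc) (h ∘ suc))
    where
    rank-zero : total (V ∘ suc) (λ _ → 0) ≡ 0
    rank-zero = total-zero (V ∘ suc)
  ... | false = trans (+-identityˡ _) (sum-rank (V ∘ suc) h)

  ∑-first-letter : ∀ (V : Fin m → Bool) (f : Vec (Fin m) (suc k) → Carrier) (h : ℕ → Carrier) →
    card V ≡ suc k →
    (∀ a → V a ≡ true → ∑-arrangements (delete V a) k (f ∘ (a ∷_)) ≈ h (rank V a)) →
    ∑-arrangements V (suc k) f ≈ sum {suc k} (h ∘ toℕ)
  ∑-first-letter {m} {k} V f h |V| first = begin
    ∑-arrangements V (suc k) f
      ≈⟨ ∑-words (λ w → if arranges V w then f w else 0#) ⟩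
    sum (λ a → ∑ˡ (λ w → if arranges V (a ∷ w) then f (a ∷ w) else 0#) (words m k))
      ≈⟨ sum-cong-≋ {m} (λ a → term a (V a) ≡.refl) ⟩
    sum (λ a → if V a then h (rank V a) else 0#)
      ≈⟨ sum-rank V h ⟩
    sum {card V} (h ∘ toℕ)
      ≡⟨ ≡.cong (λ n → sum {n} (h ∘ toℕ)) |V| ⟩
    sum {suc k} (h ∘ toℕ) ∎
    where
    guard : ∀ {b} a (w : Vec (Fin m) k) → V a ≡ b →
      (if arranges V (a ∷ w) then f (a ∷ w) else 0#)
      ≡ (if b ∧ arranges (delete V a) w then f (a ∷ w) else 0#)
    guard a w Va = ≡.cong (if_then f (a ∷ w) else 0#)
      (≡.trans (arranges-∷ V a w) (≡.cong (_∧ arranges (delete V a) w) Va))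
    term : ∀ a b → V a ≡ b → ∑ˡ (λ w → if arranges V (a ∷ w) then f (a ∷ w) else 0#) (words m k)
                           ≈ (if b then h (rank V a) else 0#)
    term a true  Va = trans (∑ˡ-cong (λ w → reflexive (guard a w Va)) (words m k)) (first a Va)
    term a false Va = trans (∑ˡ-cong (λ w → reflexive (guard a w Va)) (words m k)) (∑ˡ-zero (words m k))

  -- Applied to a word that starts with the letter placed last. Before a descent this letter is a
  -- peak if it was reached by an ascent, and `lpk` treats a first letter in the same way.
  peaks : Bool → Vec (Fin m) k → ℕ
  peaks up w = if up then lpk w else interiorPeaks w

  peaks-ascent : ∀ up (p a : Fin m) (w : Vec (Fin m) k) → toℕ p ℕ.< toℕ a →
    peaks up (p ∷ a ∷ w) ≡ lpk (a ∷ w)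
  peaks-ascent up p a w p<a = ≡.trans (lemma up) (interior w)
    where
    lemma : ∀ up → peaks up (p ∷ a ∷ w) ≡ interiorPeaks (p ∷ a ∷ w)
    lemma true  = ≡.cong (ℕ._+ interiorPeaks (p ∷ a ∷ w)) (≺-false {a = a} {p} (ℕ.<-asym p<a))
    lemma false = ≡.refl
    interior : ∀ {k} (w : Vec (Fin _) k) → interiorPeaks (p ∷ a ∷ w) ≡ lpk (a ∷ w)
    interior []      = ≡.refl
    interior (c ∷ w) = ≡.cong (ℕ._+ interiorPeaks (a ∷ c ∷ w))
      (≡.trans (≡.cong (ℕ._* (c ≺ a)) (≺-true {a = p} {a} p<a)) (ℕ.*-identityˡ (c ≺ a)))

  interiorPeaks-descent : ∀ (p a : Fin m) (w : Vec (Fin m) k) → toℕ a ℕ.< toℕ p →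
    interiorPeaks (p ∷ a ∷ w) ≡ interiorPeaks (a ∷ w)
  interiorPeaks-descent p a []      a<p = ≡.refl
  interiorPeaks-descent p a (c ∷ w) a<p =
    ≡.cong (λ n → n ℕ.* (c ≺ a) ℕ.+ interiorPeaks (a ∷ c ∷ w)) (≺-false {a = p} {a} (ℕ.<-asym a<p))

  module _ (y t : Carrier) where

    -- Inversions with p are left out, since they are paid for when p is placed; peaks and descents
    -- include the step from p to w.
    weight : Bool → Fin m → Vec (Fin m) k → Carrier
    weight up p w = q ^ inv w * y ^ peaks up (p ∷ w) * t ^ des (p ∷ w)

    weight-∷ : ∀ up (p a : Fin m) (w : Vec (Fin m) k) {r c up′ l d} →
      Vec.sum (Vec.map (_≺ a) w) ≡ r → peaks up (p ∷ a ∷ w) ≡ l → (a ≺ p) ≡ d →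
      y ^ l * t ^ d ≈ c * y ^ peaks up′ (a ∷ w) →
      weight up p (a ∷ w) ≈ q ^ r * c * weight up′ a w
    weight-∷ up p a w {r} {c} {up′} {l} {d} ≡.refl ≡.refl ≡.refl yt≈ = begin
      q ^ (r ℕ.+ inv w) * y ^ l * t ^ (d ℕ.+ des (a ∷ w))
        ≈⟨ *-cong (*-congʳ (^-homo-* q r (inv w))) (^-homo-* t d (des (a ∷ w))) ⟩
      q ^ r * q ^ inv w * y ^ l * (t ^ d * t ^ des (a ∷ w))
        ≈⟨ solve 5 (λ a b c d e →
             a :* b :* c :* (d :* e) := a :* b :* (c :* d) :* e)
             refl _ _ _ _ _ ⟩
      q ^ r * q ^ inv w * (y ^ l * t ^ d) * t ^ des (a ∷ w)
        ≈⟨ *-congʳ (*-congˡ yt≈) ⟩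
      q ^ r * q ^ inv w * (c * y ^ peaks up′ (a ∷ w)) * t ^ des (a ∷ w)
        ≈⟨ solve 5 (λ a b c d e →
             a :* b :* (c :* d) :* e := a :* c :* (b :* d :* e))
             refl _ _ _ _ _ ⟩
      q ^ r * c * weight up′ a w ∎

    weight-ascent : ∀ up (p a : Fin m) (w : Vec (Fin m) k) → toℕ p ℕ.< toℕ a →
      weight up p (a ∷ w) ≈ q ^ Vec.sum (Vec.map (_≺ a) w) * 1# * weight true a w
    weight-ascent up p a w p<a =
      weight-∷ up p a w {up′ = true} ≡.refl (peaks-ascent up p a w p<a) (≺-false {a = a} {p} (ℕ.<-asym p<a))
        (*-comm _ _)

    weight-descent : ∀ up (p a : Fin m) (w : Vec (Fin m) k) → toℕ a ℕ.< toℕ p →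
      weight up p (a ∷ w) ≈ q ^ Vec.sum (Vec.map (_≺ a) w) * (if up then y * t else t) * weight false a w
    weight-descent true p a w a<p =
      weight-∷ true p a w {up′ = false} ≡.refl
        (≡.cong₂ ℕ._+_ (≺-true {a = a} {p} a<p) (interiorPeaks-descent p a w a<p))
        (≺-true {a = a} {p} a<p)
        (solve 3 (λ y t z → y :* z :* (t :* con (+ 1)) := y :* t :* z) refl y t _)
    weight-descent false p a w a<p =
      weight-∷ false p a w {up′ = false} ≡.refl (interiorPeaks-descent p a w a<p) (≺-true {a = a} {p} a<p)
        (solve 2 (λ t z → z :* (t :* con (+ 1)) := t :* z) refl t _)

    -- Induction on the number of letters left. As p is used up, the next letter a differs from it;
    -- as a is in V, comparing a with p amounts to comparing their ranks in V, which is all that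
    -- `codes` sees.
    ∑-weight : ∀ k (V : Fin m → Bool) p up → card V ≡ k → V p ≡ false →
      ∑-arrangements V k (weight up p) ≈ codes y t k (rank V p) up
    ∑-weight zero V p true  _ _ = solve 0 (con (+ 1) :* con (+ 1) :* con (+ 1) :+ con (+ 0) := con (+ 1)) refl
    ∑-weight zero V p false _ _ = solve 0 (con (+ 1) :* con (+ 1) :* con (+ 1) :+ con (+ 0) := con (+ 1)) refl
    ∑-weight {m} (suc k) V p up |V| Vp = ∑-first-letter V (weight up p) h |V| first
      where
      branch : ℕ → Bool → Carrier
      branch i below = if below then (if up then y * t else t) * codes y t k i false else codes y t k i true
      h : ℕ → Carrier
      h i = q ^ i * branch i (i ℕ.<ᵇ rank V p)
      first : ∀ a → V a ≡ true → ∑-arrangements (delete V a) k (weight up p ∘ (a ∷_)) ≈ h (rank V a)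
      first a Va = case (ℕ.<-cmp (toℕ p) (toℕ a))
        where
        |V∖a| : card (delete V a) ≡ k
        |V∖a| = ℕ.suc-injective (≡.trans (≡.sym (total-delete V (λ _ → 1) a Va)) |V|)
        inversions : ∀ w → arranges (delete V a) w ≡ true → Vec.sum (Vec.map (_≺ a) w) ≡ rank V a
        inversions w ok = ≡.trans (arranges-total (delete V a) w (_≺ a) |V∖a| ok) (rank-delete V Va)
        continue : ∀ c up′ →
          (∀ w → weight up p (a ∷ w) ≈ q ^ Vec.sum (Vec.map (_≺ a) w) * c * weight up′ a w) →
          ∑-arrangements (delete V a) k (weight up p ∘ (a ∷_))
          ≈ q ^ rank V a * (c * codes y t k (rank V a) up′)
        continue c up′ weight≈ = begin
          ∑-arrangements (delete V a) k (weight up p ∘ (a ∷_))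
            ≈⟨ ∑-arrangements-cong (delete V a) _ (λ w ok →
                 trans (weight≈ w) (*-congʳ (*-congʳ (reflexive (≡.cong (q ^_) (inversions w ok)))))) ⟩
          q ^ rank V a * c * ∑-arrangements (delete V a) k (weight up′ a)
            ≈⟨ *-assoc _ _ _ ⟩
          q ^ rank V a * (c * ∑-arrangements (delete V a) k (weight up′ a))
            ≈⟨ *-congˡ (*-congˡ (∑-weight k (delete V a) a up′ |V∖a| (delete-self V a))) ⟩
          q ^ rank V a * (c * codes y t k (rank (delete V a) a) up′)
            ≡⟨ ≡.cong (λ j → q ^ rank V a * (c * codes y t k j up′)) (rank-delete V Va) ⟩
          q ^ rank V a * (c * codes y t k (rank V a) up′) ∎
        case : Tri (toℕ p ℕ.< toℕ a) (toℕ p ≡ toℕ a) (toℕ a ℕ.< toℕ p) →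
               ∑-arrangements (delete V a) k (weight up p ∘ (a ∷_)) ≈ h (rank V a)
        case (tri< p<a _ _) = begin
          ∑-arrangements (delete V a) k (weight up p ∘ (a ∷_))
            ≈⟨ continue 1# true (λ w → weight-ascent up p a w p<a) ⟩
          q ^ rank V a * (1# * codes y t k (rank V a) true)
            ≈⟨ *-congˡ (*-identityˡ _) ⟩
          q ^ rank V a * codes y t k (rank V a) true
            ≡⟨ ≡.cong (λ b → q ^ rank V a * branch (rank V a) b)
                 (dec-false (rank V a ℕ.<? rank V p) (ℕ.≤⇒≯ (rank-mono V (ℕ.<⇒≤ p<a)))) ⟨
          h (rank V a) ∎
        case (tri≈ _ p≡a _) = contradiction
          (≡.trans (≡.sym Vp) (≡.trans (≡.cong V (Fin.toℕ-injective p≡a)) Va)) λ ()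
        case (tri> _ _ a<p) = begin
          ∑-arrangements (delete V a) k (weight up p ∘ (a ∷_))
            ≈⟨ continue (if up then y * t else t) false (λ w → weight-descent up p a w a<p) ⟩
          q ^ rank V a * ((if up then y * t else t) * codes y t k (rank V a) false)
            ≡⟨ ≡.cong (λ b → q ^ rank V a * branch (rank V a) b)
                 (dec-true (rank V a ℕ.<? rank V p) (rank-strict V Va a<p)) ⟨
          h (rank V a) ∎

    -- A permutation has no preceding letter. The imaginary entry 0 in its place makes the first
    -- letter the top of an ascent, as the convention for a left peak at position 1 demands, and
    -- contributes no weight.
    P≈codes : ∀ n → P n y t ≈ codes y t n 0 true
    P≈codes zero    = solve 0 (con (+ 1) :* con (+ 1) :* con (+ 1) :+ con (+ 0) := con (+ 1)) refl
    P≈codes (suc k) = begin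
      P n y t
        ≈⟨ ∑ˡ-filter (allPairs? λ a b → ¬? (a Fin.≟ b)) f (words n n) ⟩
      ∑ˡ (λ w → if distinct w then f w else 0#) (words n n)
        ≈⟨ ∑ˡ-cong (λ w → reflexive (≡.cong (λ b → if b ∧ distinct w then f w else 0#)
             (≡.sym (within-full w)))) (words n n) ⟩
      ∑-arrangements full n f
        ≈⟨ ∑-first-letter full f (λ i → q ^ i * codes y t k i true) (card-full n) first ⟩
      codes y t n 0 true ∎
      where
      n = suc k
      full : Fin n → Bool
      full _ = true
      f : Vec (Fin n) n → Carrier
      f π = q ^ inv π * y ^ lpk π * t ^ des π
      |full∖a| : ∀ a → card (delete full a) ≡ k
      |full∖a| a = ℕ.suc-injective (≡.trans (≡.sym (total-delete full (λ _ → 1) a ≡.refl)) (card-full n))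
      first : ∀ a → full a ≡ true →
        ∑-arrangements (delete full a) k (f ∘ (a ∷_)) ≈ q ^ rank full a * codes y t k (rank full a) true
      first a _ = begin
        ∑-arrangements (delete full a) k (f ∘ (a ∷_))
          ≈⟨ ∑-arrangements-cong (delete full a) (q ^ rank full a) term ⟩
        q ^ rank full a * ∑-arrangements (delete full a) k (weight true a)
          ≈⟨ *-congˡ (∑-weight k (delete full a) a true (|full∖a| a) (delete-self full a)) ⟩
        q ^ rank full a * codes y t k (rank (delete full a) a) true
          ≡⟨ ≡.cong (λ j → q ^ rank full a * codes y t k j true) (rank-delete full {a} ≡.refl) ⟩
        q ^ rank full a * codes y t k (rank full a) true ∎
        where
        term : ∀ w → arranges (delete full a) w ≡ true → f (a ∷ w) ≈ q ^ rank full a * weight true a w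
        term w ok = begin
          q ^ (Vec.sum (Vec.map (_≺ a) w) ℕ.+ inv w) * y ^ lpk (a ∷ w) * t ^ des (a ∷ w)
            ≈⟨ *-congʳ (*-congʳ (^-homo-* q (Vec.sum (Vec.map (_≺ a) w)) (inv w))) ⟩
          q ^ Vec.sum (Vec.map (_≺ a) w) * q ^ inv w * y ^ lpk (a ∷ w) * t ^ des (a ∷ w)
            ≈⟨ solve 4 (λ a b c d → a :* b :* c :* d := a :* (b :* c :* d)) refl _ _ _ _ ⟩
          q ^ Vec.sum (Vec.map (_≺ a) w) * weight true a w
            ≡⟨ ≡.cong (λ r → q ^ r * weight true a w)
                 (≡.trans (arranges-total (delete full a) w (_≺ a) (|full∖a| a) ok) (rank-delete full {a} ≡.refl)) ⟩
          q ^ rank full a * weight true a w ∎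

-- The generating function of permutations, and its rescaling

module Division (R : RingWithInverse) where

  open RingWithInverse R
  open Cancellation commutativeRing
  open SetoidReasoning setoid

  /-* : ∀ {b} a → b * b ⁻¹ ≈ 1# → a / b * b ≈ a
  /-* {b} a unit = begin
    a * b ⁻¹ * b    ≈⟨ *-assoc a (b ⁻¹) b ⟩
    a * (b ⁻¹ * b)  ≈⟨ *-congˡ (trans (*-comm (b ⁻¹) b) unit) ⟩
    a * 1#          ≈⟨ *-identityʳ a ⟩
    a               ∎

  *≈⇒≈/ : ∀ {a b c} → b * b ⁻¹ ≈ 1# → a * b ≈ c → a ≈ c / b
  *≈⇒≈/ {a} {b} {c} unit ab≈c = begin
    a             ≈⟨ *-identityʳ a ⟨
    a * 1#        ≈⟨ *-congˡ unit ⟨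
    a * (b * b ⁻¹) ≈⟨ *-assoc a b (b ⁻¹) ⟨
    a * b * b ⁻¹  ≈⟨ *-congʳ ab≈c ⟩
    c * b ⁻¹      ∎

module GeneratingFunctions (R : RingWithInverse) (q : RingWithInverse.Carrier R)
  ([1+_]q-unit : InvertibleQNumbers R q) (σ : Substitution R) where

  open RingWithInverse R
  open QSeries R q
  open Substitution σ
  open PowerSeriesInverse R
  open QExponentials R q [1+_]q-unit
  open ExpProperties semiring using (^-congˡ)
  open CommutativeExpProperties commutativeSemiring using (^-distrib-*)
  open RingProperties ring using (x[y-z]≈xy-xz)
  open IntegerSolver commutativeRing

  private
    module x = RingWithInverse seriesRingWithInverse

    M N c : Carrier
    M = 1# - T
    N = 1# + Y * T
    c = M / N

    denominator : Series → Series → Series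
    denominator f g = x.1# x.- constant T x.* f x.* g

    denominator-unit : ∀ f g → f 0 ≈ 1# → g 0 ≈ 1# → denominator f g x.* denominator f g x.⁻¹ x.≈ x.1#
    denominator-unit f g f₀≈1 g₀≈1 = ⊠-inverseʳ (denominator f g) (inverseʳ (trans (*-congʳ head) 1-T-unit))
      where
      open SetoidReasoning setoid
      head : denominator f g 0 ≈ M
      head = begin
        1# - ((T * f 0 + 0#) * g 0 + 0#)
          ≈⟨ +-congˡ (-‿cong (+-congʳ (*-cong (+-congʳ (*-congˡ f₀≈1)) g₀≈1))) ⟩
        1# - ((T * 1# + 0#) * 1# + 0#)
          ≈⟨ solve 1 (λ t →
               con (+ 1) :- ((t :* con (+ 1) :+ con (+ 0)) :* con (+ 1) :+ con (+ 0)) := con (+ 1) :- t)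
               refl T ⟩
        M ∎

    scale₀ : ∀ a f → f 0 ≈ 1# → scale a f 0 ≈ 1#
    scale₀ a f f₀≈1 = trans (*-identityˡ _) f₀≈1

    D S : Series
    D = denominator (scale Y Exp) exp
    S = constant M x.* exp x./ D

    S-eq : S x.* D x.≈ constant M x.* exp
    S-eq = Division./-* seriesRingWithInverse {D} (constant M x.* exp)
      (denominator-unit (scale Y Exp) exp (scale₀ Y Exp Exp₀≈1) exp₀≈1)

    S-coefficients : ∀ n → M ^ n * ([ n ]q! * S n) ≈ N ^ n * P n y t
    S-coefficients n = trans (series-counts-codes n) (*-congˡ (sym (P≈codes y t n)))
      where
      open CodeGeneratingFunction.Solution R q [1+_]q-unit σ S S-eq
      open PermutationSums R q

    ^-unit : ∀ {a} n → a * a ⁻¹ ≈ 1# → a ^ n * (a ⁻¹) ^ n ≈ 1#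
    ^-unit {a} n unit = trans (sym (^-distrib-* a (a ⁻¹) n)) (trans (^-congˡ n unit) (1^ n))
      where
      1^ : ∀ n → 1# ^ n ≈ 1#
      1^ zero    = refl
      1^ (suc n) = trans (*-identityˡ _) (1^ n)

  open SetoidReasoning setoid

  expansion : constant (1# - T) x.* exp x./ (x.1# x.- constant T x.* scale Y Exp x.* exp)
    x.≈ λ n → ((1# + Y * T) / (1# - T)) ^ n * P n y t / [ n ]q!
  expansion n = begin
    S n
      ≈⟨ trans (*-congʳ (^-unit n 1-T-unit)) (trans (*-identityˡ _) (trans (*-congʳ (!-unit n)) (*-identityˡ _))) ⟨
    M ^ n * (M ⁻¹) ^ n * ([ n ]q! * [ n ]q! ⁻¹ * S n)
      ≈⟨ solve 5 (λ m m′ f f′ s →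
           m :* m′ :* (f :* f′ :* s) := (m :* (f :* s)) :* m′ :* f′)
           refl (M ^ n) ((M ⁻¹) ^ n) [ n ]q! ([ n ]q! ⁻¹) (S n) ⟩
    M ^ n * ([ n ]q! * S n) * (M ⁻¹) ^ n * [ n ]q! ⁻¹
      ≈⟨ *-congʳ (*-congʳ (S-coefficients n)) ⟩
    N ^ n * P n y t * (M ⁻¹) ^ n * [ n ]q! ⁻¹
      ≈⟨ *-congʳ (solve 3 (λ a b c →
           a :* b :* c := a :* c :* b)
           refl (N ^ n) (P n y t) ((M ⁻¹) ^ n)) ⟩
    N ^ n * (M ⁻¹) ^ n * P n y t * [ n ]q! ⁻¹
      ≈⟨ *-congʳ (*-congʳ (^-distrib-* N (M ⁻¹) n)) ⟨
    (N / M) ^ n * P n y t / [ n ]q! ∎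

  private
    P≈scale-S : ∀ n → P n y t / [ n ]q! ≈ scale c S n
    P≈scale-S n = begin
      P n y t * [ n ]q! ⁻¹
        ≈⟨ trans (*-congʳ (^-unit n 1+YT-unit)) (*-identityˡ _) ⟨
      N ^ n * (N ⁻¹) ^ n * (P n y t * [ n ]q! ⁻¹)
        ≈⟨ solve 4 (λ a b c d →
             a :* b :* (c :* d) := (a :* c) :* b :* d)
             refl (N ^ n) ((N ⁻¹) ^ n) (P n y t) ([ n ]q! ⁻¹) ⟩
      N ^ n * P n y t * (N ⁻¹) ^ n * [ n ]q! ⁻¹
        ≈⟨ *-congʳ (*-congʳ (S-coefficients n)) ⟨
      M ^ n * ([ n ]q! * S n) * (N ⁻¹) ^ n * [ n ]q! ⁻¹
        ≈⟨ solve 5 (λ m m′ f f′ s →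
             (m :* (f :* s)) :* m′ :* f′ := m :* m′ :* (f :* f′ :* s))
             refl (M ^ n) ((N ⁻¹) ^ n) [ n ]q! ([ n ]q! ⁻¹) (S n) ⟩
      M ^ n * (N ⁻¹) ^ n * ([ n ]q! * [ n ]q! ⁻¹ * S n)
        ≈⟨ *-cong (sym (^-distrib-* M (N ⁻¹) n)) (trans (*-congʳ (!-unit n)) (*-identityˡ _)) ⟩
      c ^ n * S n ∎

    scale-constant : ∀ a → scale c (constant a) x.≈ constant a
    scale-constant a zero    = *-identityˡ a
    scale-constant a (suc n) = zeroʳ _

    scale-scale : scale c (scale Y Exp) x.≈ scale (Y * M / N) Exp
    scale-scale n = begin
      c ^ n * (Y ^ n * Exp n)    ≈⟨ *-assoc _ _ _ ⟨
      c ^ n * Y ^ n * Exp n      ≈⟨ *-congʳ (^-distrib-* c Y n) ⟨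
      (c * Y) ^ n * Exp n
        ≈⟨ *-congʳ (^-congˡ n (solve 3 (λ m n y → m :* n :* y := y :* m :* n) refl M (N ⁻¹) Y)) ⟩
      (Y * M / N) ^ n * Exp n    ∎

    D′ : Series
    D′ = denominator (scale (Y * M / N) Exp) (scale c exp)

    scale-D : scale c D x.≈ D′
    scale-D n = begin
      c ^ n * (constant 1# n - (constant T x.* scale Y Exp x.* exp) n)
        ≈⟨ x[y-z]≈xy-xz _ _ _ ⟩
      scale c (constant 1#) n - scale c (constant T x.* scale Y Exp x.* exp) n
        ≈⟨ +-cong (scale-constant 1# n) (-‿cong (scale-⊠ c (constant T x.* scale Y Exp) exp n)) ⟩
      constant 1# n - (scale c (constant T x.* scale Y Exp) x.* scale c exp) n
        ≈⟨ +-congˡ (-‿cong (⊠-cong {h = scale c exp} (λ k → trans (scale-⊠ c (constant T) (scale Y Exp) k)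
             (⊠-cong (scale-constant T) scale-scale k)) (λ _ → refl) n)) ⟩
      D′ n ∎

  -- Replacing x by cx with c = (1 - T) / (1 + YT) absorbs the powers attached to the polynomials.
  -- The replacement is multiplicative, so it is made in the product of S with its denominator, and
  -- the new denominator is divided out afterwards.
  rescaled : (λ n → P n y t / [ n ]q!) x.≈
    constant (1# - T) x.* scale ((1# - T) / (1# + Y * T)) exp
      x./ (x.1# x.- constant T x.* scale (Y * (1# - T) / (1# + Y * T)) Exp
                              x.* scale ((1# - T) / (1# + Y * T)) exp)
  rescaled n = trans (P≈scale-S n) (Division.*≈⇒≈/
     seriesRingWithInverse {scale c S} {D′} {constant M x.* scale c exp}
    (denominator-unit (scale (Y * M / N) Exp) (scale c exp)
      (scale₀ (Y * M / N) Exp Exp₀≈1) (scale₀ c exp exp₀≈1)) quotient n)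
    where
    quotient : scale c S x.* D′ x.≈ constant M x.* scale c exp
    quotient n = begin
      (scale c S x.* D′) n                             ≈⟨ ⊠-cong {scale c S} (λ _ → refl) scale-D n ⟨
      (scale c S x.* scale c D) n                      ≈⟨ scale-⊠ c S D n ⟨
      c ^ n * (S x.* D) n                              ≈⟨ *-congˡ (S-eq n) ⟩
      c ^ n * (constant M x.* exp) n                   ≈⟨ scale-⊠ c (constant M) exp n ⟩
      (scale c (constant M) x.* scale c exp) n
        ≈⟨ ⊠-cong {h = scale c exp} (scale-constant M) (λ _ → refl) n ⟩
      (constant M x.* scale c exp) n                   ∎

-- The series s, u and v

module Regularity (A : CommutativeRing 0ℓ 0ℓ) where

  open CommutativeRing A hiding (zero)
  open RingProperties ring using (x[y-z]≈xy-xz)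
  open GroupProperties +-group using (x∙y⁻¹≈ε⇒x≈y)

  -- The denominators 2yt and 2(1 - y)t of v and u are not units of ℚ[y][[t]], but they can be
  -- cancelled, which suffices for uniqueness.
  Regular : Carrier → Set
  Regular c = ∀ x → c * x ≈ 0# → x ≈ 0#

  regular-resp-≈ : ∀ {c d} → c ≈ d → Regular c → Regular d
  regular-resp-≈ c≈d reg x dx≈0 = reg x (trans (*-congʳ c≈d) dx≈0)

  regular-* : ∀ {c d} → Regular c → Regular d → Regular (c * d)
  regular-* reg₁ reg₂ x cdx≈0 = reg₂ x (reg₁ _ (trans (sym (*-assoc _ _ x)) cdx≈0))

  regular-cancelˡ : ∀ {c a b} → Regular c → c * a ≈ c * b → a ≈ b
  regular-cancelˡ {c} {a} {b} reg ca≈cb = x∙y⁻¹≈ε⇒x≈y a b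
    (reg (a - b) (trans (x[y-z]≈xy-xz c a b) (trans (+-congʳ ca≈cb) (-‿inverseʳ (c * b)))))

fixpoint-unit : (A : CommutativeRing 0ℓ 0ℓ) → let open CommutativeRing A in
  ∀ {x f g} → g ≈ 1# + x * (f * g) → (1# - x * f) * g ≈ 1#
fixpoint-unit A {x} {f} {g} g-eq = begin
  (1# - x * f) * g
    ≈⟨ solve 3 (λ x f g →
         (con (+ 1) :- x :* f) :* g := con (+ 1) :+ con (+ 1) :* (g :- (con (+ 1) :+ x :* (f :* g))))
         refl x f g ⟩
  _ ≈⟨ +-multiple _ _ g-eq ⟩
  1# ∎
  where
  open CommutativeRing A
  open IntegerSolver A
  open Cancellation A
  open SetoidReasoning setoid

module SeriesRegularity (K : CommutativeRing 0ℓ 0ℓ) where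

  open CommutativeRing K hiding (zero)
  open PowerSeries K
  open Regularity
  private module S = CommutativeRing seriesRing

  X-⊠-suc : ∀ f n → (X ⊠ f) (suc n) ≈ f n
  X-⊠-suc f n = trans (+-cong (zeroˡ _) (trans (⊠-cong {h = f} X-tail (λ _ → refl) n) (⊠-identityˡ f n)))
    (+-identityˡ _)
    where
    X-tail : X ∘ suc ≋ constant 1#
    X-tail zero    = refl
    X-tail (suc n) = refl

  X-⊠-zero : ∀ f → (X ⊠ f) 0 ≈ 0#
  X-⊠-zero f = trans (+-identityʳ _) (zeroˡ _)

  X-regular : Regular seriesRing X
  X-regular f Xf≈0 n = trans (sym (X-⊠-suc f n)) (Xf≈0 (suc n))

  -- If fg = 0, then the constant term of g vanishes, and f also annihilates the tail of g.
  head-regular : ∀ {f} → Regular K (f 0) → Regular seriesRing f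
  head-regular {f} reg g fg≈0 zero    = reg (g 0) (trans (sym (+-identityʳ _)) (fg≈0 0))
  head-regular {f} reg g fg≈0 (suc n) = head-regular {f} reg (g ∘ suc) tail≈0 n
    where
    g₀≈0 : g 0 ≈ 0#
    g₀≈0 = head-regular {f} reg g fg≈0 zero
    tail≈0 : f ⊠ (g ∘ suc) ≋ λ _ → 0#
    tail≈0 m = trans (sym (+-identityʳ _)) (trans (+-congˡ (sym (trans (*-congˡ g₀≈0) (zeroʳ _))))
      (trans (sym (⊠-tailʳ f g m)) (fg≈0 (suc m))))

module Contraction (K : CommutativeRing 0ℓ 0ℓ) where

  open CommutativeRing K hiding (zero)
  open PowerSeries K
  open SeriesRegularity K using (X-⊠-suc; X-⊠-zero)
  open SumProperties semiring using (sum-cong-≋)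
  private module S = CommutativeRing seriesRing

  infix 4 _≈[_]_
  _≈[_]_ : Series → ℕ → Series → Set
  f ≈[ n ] g = ∀ k → k ℕ.< n → f k ≈ g k

  -- Nonexpansive for the X-adic metric; the factor X in `F` then gains one coefficient at each
  -- application.
  Nonexpansive : (Series → Series) → Set
  Nonexpansive G = ∀ n f g → f ≈[ n ] g → G f ≈[ n ] G g

  module _ {G : Series → Series} (nonexpansive : Nonexpansive G) (c : Series) where

    private
      F : Series → Series
      F f = c ⊞ X ⊠ G f

      F-contracts : ∀ n f g → f ≈[ n ] g → F f ≈[ suc n ] F g
      F-contracts n f g f≈g zero    _           = +-congˡ (trans (X-⊠-zero (G f)) (sym (X-⊠-zero (G g))))
      F-contracts n f g f≈g (suc k) (s≤s k<n) =
        +-congˡ (trans (X-⊠-suc (G f) k) (trans (nonexpansive n f g f≈g k k<n) (sym (X-⊠-suc (G g) k))))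

      iterate : ℕ → Series
      iterate zero    = S.0#
      iterate (suc n) = F (iterate n)

      iterate-step : ∀ n → iterate n ≈[ n ] iterate (suc n)
      iterate-step zero    k ()
      iterate-step (suc n) = F-contracts n (iterate n) (iterate (suc n)) (iterate-step n)

      iterate-stable : ∀ k d → iterate (suc k) k ≈ iterate (d ℕ.+ suc k) k
      iterate-stable k zero    = refl
      iterate-stable k (suc d) =
        trans (iterate-stable k d) (iterate-step (d ℕ.+ suc k) k (ℕ.m≤n+m (suc k) d))

    -- By `iterate-stable` the coefficient of X^n no longer changes after n + 1 iterations.
    fix : Series
    fix n = iterate (suc n) n

    fix-eq : fix ≋ c ⊞ X ⊠ G fix
    fix-eq n = F-contracts n (iterate n) fix agrees n (ℕ.n<1+n n)
      where
      agrees : iterate n ≈[ n ] fix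
      agrees k k<n = sym (trans (iterate-stable k (n ∸ suc k))
        (reflexive (≡.cong (λ m → iterate m k) (ℕ.m∸n+n≡m k<n))))

  ⊞-agree : ∀ {n f g h k} → f ≈[ n ] g → h ≈[ n ] k → f ⊞ h ≈[ n ] g ⊞ k
  ⊞-agree f≈g h≈k m m<n = +-cong (f≈g m m<n) (h≈k m m<n)

  ⊟-agree : ∀ {n f g} → f ≈[ n ] g → ⊟ f ≈[ n ] ⊟ g
  ⊟-agree f≈g m m<n = -‿cong (f≈g m m<n)

  ⊠-agree : ∀ {n f g h k} → f ≈[ n ] g → h ≈[ n ] k → f ⊠ h ≈[ n ] g ⊠ k
  ⊠-agree {n} f≈g h≈k m m<n = sum-cong-≋ {suc m} λ i →
    *-cong (f≈g (toℕ i) (ℕ.≤-<-trans (Fin.toℕ≤pred[n] i) m<n))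
           (h≈k (m ∸ toℕ i) (ℕ.≤-<-trans (ℕ.m∸n≤m m (toℕ i)) m<n))

  -- The inverse is the fixed point of g = 1 + X f g, so nothing has to be inverted in K.
  1-Xf-unit : ∀ f → ∃[ g ] (S.1# S.- X S.* f) S.* g S.≈ S.1#
  1-Xf-unit f = fix nonexpansive S.1# , fixpoint-unit seriesRing {X} {f} (fix-eq nonexpansive S.1#)
    where
    nonexpansive : Nonexpansive (f ⊠_)
    nonexpansive n g h g≈h = ⊠-agree {f = f} {f} (λ _ _ → refl) g≈h

-- Over ℚ[y][[t]]: the square root and u are rational functions of v, and v
-- is the fixed point of a contraction.
module QuadraticRoots (A : CommutativeRing 0ℓ 0ℓ) where

  open CommutativeRing A
  open RawSemiringDefinitions (Semiring.rawSemiring semiring) using (_^_)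
  open Regularity A
  open IntegerSolver A
  open Cancellation A
  open SetoidReasoning setoid

  module Solutions {y t : Carrier}
    (regular-t : Regular t) (regular-2y : Regular ((1# + 1#) * y))
    (regular-2[1-y] : Regular ((1# + 1#) * (1# - y)))
    (1-tf-unit : ∀ f → ∃[ g ] (1# - t * f) * g ≈ 1#)
    (v-exists : ∃[ v ] v ≈ t * (y * (1# + v) ^ 2 - (1# + 1# + t) * v))
    (Normalised : Carrier → Set) (1+tf-normalised : ∀ f → Normalised (1# + t * f))
    (normalised-regular : ∀ {r s} → Normalised r → Normalised s → Regular (r + s))
    where

    private
      one two : ∀ {n} → Polynomial n
      one = con (+ 1)
      two = one :+ one

    U V : Carrier → Carrier → Set
    Root : Carrier → Set
    Root s = s ^ 2 ≈ (1# + t) ^ 2 - ((1# + 1#) + (1# + 1#)) * y * t × Normalised s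
    U s u = (1# + 1#) * (1# - y) * t * u ≈ 1# + t ^ 2 - (1# + 1#) * y * t - (1# - t) * s
    V s v = (1# + 1#) * y * t * v ≈ (1# + t) ^ 2 - (1# + 1#) * y * t - (1# + t) * s

    private
      v₀ ζ w z s₀ u₀ : Carrier
      v₀ = proj₁ v-exists
      ζ  = y * (1# + v₀) ^ 2 - (1# + 1# + t) * v₀
      w  = proj₁ (1-tf-unit (- 1#))
      z  = proj₁ (1-tf-unit v₀)
      -- The formula for v, solved for s with w = 1 / (1 + t): s = (1 + t) - 2yt (1 + v) w. The form
      -- 1 + t f exhibits the normalisation.
      s₀ = 1# + t * (1# - w * ((1# + 1#) * y * (1# + v₀)))
      u₀ = z * (t - v₀)

      v₀-eq : v₀ ≈ t * ζ
      v₀-eq = proj₂ v-exists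

      w-unit : (1# + t) * w ≈ 1#
      w-unit = trans (*-congʳ (solve 1 (λ t → one :+ t := one :- t :* (:- one)) refl t)) (proj₂ (1-tf-unit (- 1#)))

      z-unit : (1# - t * v₀) * z ≈ 1#
      z-unit = proj₂ (1-tf-unit v₀)

      s₀-eq : (1# + t) * s₀ ≈ (1# + t) ^ 2 - (1# + 1#) * y * t - (1# + 1#) * y * t * v₀
      s₀-eq = begin
        (1# + t) * s₀
          ≈⟨ solve 4 (λ y t v w → (one :+ t) :* (one :+ t :* (one :- w :* (two :* y :* (one :+ v))))
               := ((one :+ t) :^ 2 :- two :* y :* t :- two :* y :* t :* v)
                  :+ (:- (two :* y :* t :* (one :+ v))) :* ((one :+ t) :* w :- one)) refl y t v₀ w ⟩
        _ ≈⟨ +-multiple _ _ w-unit ⟩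
        (1# + t) ^ 2 - (1# + 1#) * y * t - (1# + 1#) * y * t * v₀ ∎

      u₀-eq : (1# - t * v₀) * u₀ ≈ t - v₀
      u₀-eq = trans (sym (*-assoc _ _ _)) (trans (*-congʳ z-unit) (*-identityˡ _))

      open QuadraticIdentities.FixedPoint A {y} {t} {v₀} v₀-eq

      s₀-root : Root s₀
      s₀-root = root-square w-unit s₀-eq , 1+tf-normalised _

      square-cong : ∀ {a b} → a ≈ b → a ^ 2 ≈ b ^ 2
      square-cong a≈b = *-cong a≈b (*-congʳ a≈b)

      -- From r² = s² follows (r + s) r = (r + s) s. Two normalised series have a regular sum, so
      -- the normalisation fixes the sign of the root.
      root-unique : ∀ {r s} → Root r → Root s → r ≈ s
      root-unique {r} {s} (r²≈ , r-norm) (s²≈ , s-norm) = regular-cancelˡ (normalised-regular r-norm s-norm) (begin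
        (r + s) * r    ≈⟨ solve 2 (λ r s → (r :+ s) :* r := r :^ 2 :+ s :* r) refl r s ⟩
        r ^ 2 + s * r  ≈⟨ +-congʳ (trans r²≈ (sym s²≈)) ⟩
        s ^ 2 + s * r  ≈⟨ solve 2 (λ r s → s :^ 2 :+ s :* r := (r :+ s) :* s) refl r s ⟩
        (r + s) * s    ∎)

    ∃!-root : ∃! _≈_ (Root)
    ∃!-root = s₀ , s₀-root , root-unique s₀-root

    module _ {s} (root : Root s) where

      private
        s≈s₀ : s ≈ s₀
        s≈s₀ = root-unique root s₀-root

        U-s-u₀ : U s u₀
        U-s-u₀ = trans (u-formula w-unit z-unit s₀-eq u₀-eq) (+-congˡ (-‿cong (*-congˡ (sym s≈s₀))))

        V-s-v₀ : V s v₀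
        V-s-v₀ = trans (v-formula s₀-eq) (+-congˡ (-‿cong (*-congˡ (sym s≈s₀))))

        U-unique : ∀ {u u′} → U s u → U s u′ → u ≈ u′
        U-unique U-u U-u′ = regular-cancelˡ (regular-* regular-2[1-y] regular-t) (trans U-u (sym U-u′))

        V-unique : ∀ {v v′} → V s v → V s v′ → v ≈ v′
        V-unique V-v V-v′ = regular-cancelˡ (regular-* regular-2y regular-t) (trans V-v (sym V-v′))

      ∃!-u : ∃! _≈_ (U s)
      ∃!-u = u₀ , U-s-u₀ , U-unique U-s-u₀

      ∃!-v : ∃! _≈_ (V s)
      ∃!-v = v₀ , V-s-v₀ , V-unique V-s-v₀

      module _ {u v} (U-u : U s u) (V-v : V s v) where

        private
          u≈u₀ : u ≈ u₀
          u≈u₀ = U-unique U-u U-s-u₀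

          v≈v₀ : v ≈ v₀
          v≈v₀ = V-unique V-v V-s-v₀

          1+uv≈ : 1# + u * v ≈ 1# + u₀ * v₀
          1+uv≈ = +-congˡ (*-cong u≈u₀ v≈v₀)

        t-relation : t * (1# + u * v) ≈ u + v
        t-relation = trans (*-congˡ 1+uv≈) (trans (t-equation u₀-eq) (sym (+-cong u≈u₀ v≈v₀)))

        yt-relation : y * t * (1# + u * v) ^ 2 ≈ (1# + u) ^ 2 * v
        yt-relation = trans (*-congˡ (square-cong 1+uv≈))
          (trans (yt-equation z-unit u₀-eq) (sym (*-cong (square-cong (+-congˡ u≈u₀)) v≈v₀)))

        -- Since v is t times ζ, both 1 - v and 1 + uv have the form 1 - t f.
        1-v-unit : ∃[ f ] (1# - v) * f ≈ 1#
        1-v-unit = _ , trans (*-congʳ (+-congˡ (-‿cong (trans v≈v₀ v₀-eq)))) (proj₂ (1-tf-unit ζ))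

        1+uv-unit : ∃[ f ] (1# + u * v) * f ≈ 1#
        1+uv-unit = _ , trans (*-congʳ (begin
          1# + u * v             ≈⟨ +-congˡ (*-congˡ (trans v≈v₀ v₀-eq)) ⟩
          1# + u * (t * ζ)
            ≈⟨ solve 3 (λ u t ζ → one :+ u :* (t :* ζ) := one :- t :* (:- (u :* ζ))) refl u t ζ ⟩
          1# - t * (- (u * ζ))   ∎)) (proj₂ (1-tf-unit (- (u * ζ))))

-- Homomorphisms and units of the coefficient rings

module Homomorphism {K L : CommutativeRing 0ℓ 0ℓ} {h : CommutativeRing.Carrier K →
  CommutativeRing.Carrier L}
  (isHom : IsRingHomomorphism (CommutativeRing.rawRing K) (CommutativeRing.rawRing L) h) where

  private
    module K = CommutativeRing K
    module L = CommutativeRing L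
    module Kˢ = PowerSeries K
    module Lˢ = PowerSeries L
    module Kᴾ = Polynomials K
    module Lᴾ = Polynomials L
  open IsRingHomomorphism isHom
  open RawSemiringDefinitions (Semiring.rawSemiring K.semiring) using () renaming (sum to sumᴷ; _^_ to _^ᴷ_)
  open RawSemiringDefinitions (Semiring.rawSemiring L.semiring) using () renaming (sum to sumᴸ; _^_ to _^ᴸ_)

  ⊠-homo : ∀ f g n → h ((f Kˢ.⊠ g) n) L.≈ ((h ∘ f) Lˢ.⊠ (h ∘ g)) n
  ⊠-homo f g zero    = L.trans (+-homo _ _) (L.+-cong (*-homo _ _) 0#-homo)
  ⊠-homo f g (suc n) = L.trans (+-homo _ _) (L.+-cong (*-homo _ _) (⊠-homo (f ∘ suc) g n))

  constant-homo : ∀ {a b} → h a L.≈ b → (h ∘ Kˢ.constant a) Lˢ.≋ Lˢ.constant b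
  constant-homo ha≈b zero    = ha≈b
  constant-homo ha≈b (suc n) = 0#-homo

  X-homo : (h ∘ Kˢ.X) Lˢ.≋ Lˢ.X
  X-homo zero          = 0#-homo
  X-homo (suc zero)    = 1#-homo
  X-homo (suc (suc n)) = 0#-homo

  seriesMap-isRingHomomorphism : IsRingHomomorphism
    (CommutativeRing.rawRing Kˢ.seriesRing) (CommutativeRing.rawRing Lˢ.seriesRing) (h ∘_)
  seriesMap-isRingHomomorphism = record
    { isSemiringHomomorphism = record
      { isNearSemiringHomomorphism = record
        { +-isMonoidHomomorphism = record
          { isMagmaHomomorphism = record
            { isRelHomomorphism = record { cong = λ f≋g n → ⟦⟧-cong (f≋g n) }
            ; homo = λ f g n → +-homo (f n) (g n) }
          ; ε-homo = λ n → 0#-homo }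
        ; *-homo = ⊠-homo }
      ; 1#-homo = constant-homo 1#-homo }
    ; -‿homo = λ f n → -‿homo (f n) }

  mapPolynomial-isRingHomomorphism : IsRingHomomorphism
    (CommutativeRing.rawRing Kᴾ.polynomialRing) (CommutativeRing.rawRing Lᴾ.polynomialRing)
    (mapPolynomial {K} {L} {h} isHom)
  mapPolynomial-isRingHomomorphism = record
    { isSemiringHomomorphism = record
      { isNearSemiringHomomorphism = record
        { +-isMonoidHomomorphism = record
          { isMagmaHomomorphism = record
            { isRelHomomorphism = record { cong = λ p≈r n → ⟦⟧-cong (p≈r n) }
            ; homo = λ p r n → +-homo (Kᴾ.coeff p n) (Kᴾ.coeff r n) }
          ; ε-homo = λ n → 0#-homo }
        ; *-homo = λ p r → ⊠-homo (Kᴾ.coeff p) (Kᴾ.coeff r) }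
      ; 1#-homo = constant-homo 1#-homo }
    ; -‿homo = λ p n → -‿homo (Kᴾ.coeff p n) }

  ^-homo : ∀ a n → h (a ^ᴷ n) L.≈ h a ^ᴸ n
  ^-homo a zero    = 1#-homo
  ^-homo a (suc n) = L.trans (*-homo _ _) (L.*-congˡ (^-homo a n))

  sum-homo : ∀ {n} (f : Fin n → K.Carrier) → h (sumᴷ f) L.≈ sumᴸ (h ∘ f)
  sum-homo {zero}  f = 0#-homo
  sum-homo {suc n} f = L.trans (+-homo _ _) (L.+-congˡ (sum-homo (f ∘ suc)))

  q-number-homo : ∀ q n → h (sumᴷ {n} λ i → q ^ᴷ toℕ i) L.≈ sumᴸ {n} λ i → h q ^ᴸ toℕ i
  q-number-homo q n = L.trans (sum-homo {n} _) (SumProperties.sum-cong-≋ L.semiring {n} λ i → ^-homo q (toℕ i))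

module QNumbers (D : Domain) where

  open Domain D
  open PolynomialDomain D
  private module P = CommutativeRing polynomialRing
  open SumProperties P.semiring using (sum; *-distribˡ-sum)
  open RawSemiringDefinitions (Semiring.rawSemiring P.semiring) using (_^_)

  [1+_] : ℕ → P.Carrier
  [1+ n ] = sum {suc n} λ i → Xᴾ ^ toℕ i

  -- Its value at q = 0 is 1.
  [1+_]≉0 : ∀ n → ¬ ([1+ n ] P.≈ P.0#)
  [1+ n ]≉0 eq = 1≉0 (trans (sym head) (eq 0))
    where
    open SetoidReasoning setoid
    head : coeff [1+ n ] 0 ≈ 1#
    head = begin
      1# + coeff (sum {n} (λ i → Xᴾ P.* Xᴾ ^ toℕ i)) 0
        ≈⟨ +-congˡ (*-distribˡ-sum {n} Xᴾ (λ i → Xᴾ ^ toℕ i) 0) ⟨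
      1# + (0# * coeff (sum {n} (λ i → Xᴾ ^ toℕ i)) 0 + 0#)
        ≈⟨ trans (+-congˡ (trans (+-identityʳ _) (zeroˡ _))) (+-identityʳ _) ⟩
      1# ∎

module ℚ[q]Numbers = QNumbers ℚ-domain

module FractionUnits (D : Domain) where

  private module D = Domain D

  open Fractions D
  private module E = IsRingHomomorphism embed-isRingHomomorphism
  open Field fractionField

  reciprocal : ∀ {p x} → ¬ (p D.≈ D.0#) → embed p ≈ x → ∃[ w ] x * w ≈ 1#
  reciprocal {p} {x} p≉0 p≈x = w ,
    trans {x * w} {embed p * w} {1#} (*-congʳ {w} {x} {embed p} (sym {embed p} {x} p≈x))
      (D.trans (D.*-congʳ (D.*-identityʳ p)) (D.trans (D.*-comm p D.1#) (D.*-congˡ (D.sym (D.*-identityˡ p)))))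
    where
    w : Fraction
    w = fraction D.1# p p≉0

  embed-1-t : ∀ t → embed (D.1# D.- t) ≈ 1# - embed t
  embed-1-t t = E.+-homo D.1# (D.- t)

  embed-1+yt : ∀ y t → embed (D.1# D.+ y D.* t) ≈ 1# + embed y * embed t
  embed-1+yt y t = trans {embed (D.1# D.+ y D.* t)} {1# + embed (y D.* t)} {1# + embed y * embed t}
    (E.+-homo D.1# (y D.* t)) (+-congˡ {1#} {embed (y D.* t)} {embed y * embed t} (E.*-homo y t))

  embed-y+t : ∀ y t → embed (y D.+ t) ≈ embed y + embed t
  embed-y+t y t = E.+-homo y t

module _ (R : RingWithInverse) (K : CommutativeRing 0ℓ 0ℓ)
  (h : CommutativeRing.Carrier K → RingWithInverse.Carrier R)
  (isHom : IsRingHomomorphism (CommutativeRing.rawRing K)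
                              (CommutativeRing.rawRing (RingWithInverse.commutativeRing R)) h)
  (q₀ : CommutativeRing.Carrier K) where

  open RingWithInverse R
  open RawSemiringDefinitions (Semiring.rawSemiring (CommutativeRing.semiring K))
    using () renaming (sum to sumᴷ; _^_ to _^ᴷ_)

  -- The q-numbers of R are images of polynomials in one variable, so it is enough to invert those
  -- images. The equation `q ≡ h q₀` lets the opaque q be used here.
  q-number-units : ∀ {q} → q ≡ h q₀ →
    (∀ n → ∃[ w ] h (sumᴷ {suc n} λ i → q₀ ^ᴷ toℕ i) * w ≈ 1#) → InvertibleQNumbers R q
  q-number-units ≡.refl unit n with unit n
  ... | w , hw≈1 = inverseʳ {y = w}
    (trans (*-congʳ (sym (Homomorphism.q-number-homo {K} {commutativeRing} {h} isHom q₀ (suc n)))) hw≈1)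

module RationalFunctionUnits where

  open RationalFunctions
  private
    module FR = CommutativeRing Frac[q,y,t].fractionRing
    module Q  = CommutativeRing ℚ[q].polynomialRing
    module QT = CommutativeRing ℚ[q,y,t].polynomialRing
    module U  = FractionUnits ℚ[q,y,t].polynomialDomain

    yᴾ tᴾ : QT.Carrier
    yᴾ = ℚ[q,y,t].constantᴾ ℚ[q,y].Xᴾ
    tᴾ = ℚ[q,y,t].Xᴾ

    1-tᴾ≉0 : ¬ (QT.1# QT.- tᴾ QT.≈ QT.0#)
    -- The arguments of `eq` are the exponents of t, y and q, in this order, of a monomial with
    -- non-zero coefficient.
    1-tᴾ≉0 eq with () ← eq 0 0 0

    1+ytᴾ≉0 : ¬ (QT.1# QT.+ yᴾ QT.* tᴾ QT.≈ QT.0#)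
    1+ytᴾ≉0 eq with () ← eq 0 0 0

    y+tᴾ≉0 : ¬ (yᴾ QT.+ tᴾ QT.≈ QT.0#)
    y+tᴾ≉0 eq with () ← eq 0 1 0

  opaque
    unfolding coefficients q

    inject : Q.Carrier → Carrier
    inject = Frac[q,y,t].embed ∘ ℚ[q,y,t].constantᴾ ∘ ℚ[q,y].constantᴾ

    inject-isRingHomomorphism : IsRingHomomorphism Q.rawRing (CommutativeRing.rawRing commutativeRing) inject
    inject-isRingHomomorphism = Composition.isRingHomomorphism
      (λ {a} {b} {c} → trans {a} {b} {c})
      (Composition.isRingHomomorphism (λ {a} {b} {c} → QT.trans {a} {b} {c})
        ℚ[q,y].constantᴾ-isRingHomomorphism ℚ[q,y,t].constantᴾ-isRingHomomorphism)
      Frac[q,y,t].embed-isRingHomomorphism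

    q≡inject-X : q ≡ inject ℚ[q].Xᴾ
    q≡inject-X = ≡.refl

    inject-unit : ∀ p → ¬ (p Q.≈ Q.0#) → ∃[ w ] inject p * w ≈ 1#
    inject-unit p p≉0 = U.reciprocal {ℚ[q,y,t].constantᴾ (ℚ[q,y].constantᴾ p)} {inject p} (λ eq → p≉0 (eq 0 0))
      (FR.refl {inject p})

    1-t-unit : ∃[ w ] (1# - t) * w ≈ 1#
    1-t-unit = U.reciprocal {QT.1# QT.- tᴾ} {1# - t} 1-tᴾ≉0 (U.embed-1-t tᴾ)

    1+yt-unit : ∃[ w ] (1# + y * t) * w ≈ 1#
    1+yt-unit = U.reciprocal {QT.1# QT.+ yᴾ QT.* tᴾ} {1# + y * t} 1+ytᴾ≉0 (U.embed-1+yt yᴾ tᴾ)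

    y+t-unit : ∃[ w ] (y + t) * w ≈ 1#
    y+t-unit = U.reciprocal {yᴾ QT.+ tᴾ} {y + t} y+tᴾ≉0 (U.embed-y+t yᴾ tᴾ)

  [1+_]q-unit : InvertibleQNumbers coefficients q
  [1+_]q-unit = q-number-units coefficients ℚ[q].polynomialRing
    inject inject-isRingHomomorphism ℚ[q].Xᴾ q≡inject-X
    (λ n → inject-unit (ℚ[q]Numbers.[1+ n ]) (ℚ[q]Numbers.[1+ n ]≉0))

constant-isRingHomomorphism : (K : CommutativeRing 0ℓ 0ℓ) → IsRingHomomorphism (CommutativeRing.rawRing K)
  (CommutativeRing.rawRing (PowerSeries.seriesRing K)) (PowerSeries.constant K)
constant-isRingHomomorphism K = record
  { isSemiringHomomorphism = record
    { isNearSemiringHomomorphism = record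
      { +-isMonoidHomomorphism = record
        { isMagmaHomomorphism = record
          { isRelHomomorphism = record { cong = ⟦⟧-cong }
          ; homo = +-homo }
        ; ε-homo = 0#-homo }
      ; *-homo = *-homo }
    ; 1#-homo = 1#-homo }
  ; -‿homo = -‿homo }
  where open IsRingHomomorphism (Polynomials.constantᴾ-isRingHomomorphism K)

-- The square root, u and v as power series

module SeriesRoots (K : CommutativeRing 0ℓ 0ℓ) where

  open CommutativeRing K hiding (zero)
  open PowerSeries K
  open Contraction K
  open SeriesRegularity K
  open Regularity
  private
    module S = CommutativeRing seriesRing
    open RawSemiringDefinitions (Semiring.rawSemiring S.semiring) using (_^_)

  module At (ŷ : Carrier)
    (noZeroDivisors : ∀ {x y} → x * y ≈ 0# → x ≈ 0# ⊎ y ≈ 0#)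
    (2≉0 : ¬ (1# + 1# ≈ 0#))
    (2y≉0 : ¬ ((1# + 1#) * ŷ ≈ 0#))
    (2[1-y]≉0 : ¬ ((1# + 1#) * (1# - ŷ) ≈ 0#)) where

    private
      nonzero-regular : ∀ {c} → ¬ (c ≈ 0#) → Regular K c
      nonzero-regular c≉0 x cx≈0 with noZeroDivisors cx≈0
      ... | inj₁ c≈0 = contradiction c≈0 c≉0
      ... | inj₂ x≈0 = x≈0

      head-≉0-regular : ∀ {f c} → f 0 ≈ c → ¬ (c ≈ 0#) → Regular seriesRing f
      head-≉0-regular {f} f₀≈c c≉0 =
        head-regular {f} (regular-resp-≈ K (sym f₀≈c) (nonzero-regular c≉0))

      y t : Series
      y = constant ŷ
      t = X

      G : Series → Series
      G v = y S.* (S.1# S.+ v) ^ 2 S.- (S.1# S.+ S.1# S.+ t) S.* v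

      G-nonexpansive : Nonexpansive G
      G-nonexpansive n f g f≈g = ⊞-agree {f = y S.* (S.1# S.+ f) ^ 2} {y S.* (S.1# S.+ g) ^ 2}
        (⊠-agree {f = y} {y} same (⊠-agree {f = S.1# S.+ f} {S.1# S.+ g} 1+f≈1+g
          (⊠-agree {f = S.1# S.+ f} {S.1# S.+ g} {S.1#} {S.1#} 1+f≈1+g same)))
        (⊟-agree {f = (S.1# S.+ S.1# S.+ t) S.* f} {(S.1# S.+ S.1# S.+ t) S.* g}
          (⊠-agree {f = S.1# S.+ S.1# S.+ t} {S.1# S.+ S.1# S.+ t} same f≈g))
        where
        same : ∀ {h} → h ≈[ n ] h
        same _ _ = refl
        1+f≈1+g : S.1# S.+ f ≈[ n ] S.1# S.+ g
        1+f≈1+g = ⊞-agree {f = S.1#} {S.1#} same f≈g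

    open QuadraticRoots.Solutions seriesRing {y} {t} X-regular
      (head-≉0-regular {(S.1# S.+ S.1#) S.* y} (+-identityʳ _) 2y≉0)
      (head-≉0-regular {(S.1# S.+ S.1#) S.* (S.1# S.- y)} (+-identityʳ _) 2[1-y]≉0)
      1-Xf-unit
      (fix G-nonexpansive S.0# , λ n → trans (fix-eq G-nonexpansive S.0# n) (+-identityˡ _))
      (λ s → s 0 ≈ 1#)
      (λ f → trans (+-congˡ (X-⊠-zero f)) (+-identityʳ 1#))
      (λ {r} {s} r₀≈1 s₀≈1 → head-≉0-regular {r S.+ s} (+-cong r₀≈1 s₀≈1) 2≉0)
      public

private
  2≉0 : ¬ (let open CommutativeRing ℚ[y]⟦t⟧.ℚ[y].polynomialRing in 1# + 1# ≈ 0#)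
  2≉0 eq with () ← eq 0

  2y≉0 : ¬ (let open CommutativeRing ℚ[y]⟦t⟧.ℚ[y].polynomialRing in (1# + 1#) * ℚ[y]⟦t⟧.ℚ[y].Xᴾ ≈ 0#)
  2y≉0 eq with () ← eq 1

  2[1-y]≉0 : ¬ (let open CommutativeRing ℚ[y]⟦t⟧.ℚ[y].polynomialRing in (1# + 1#) * (1# - ℚ[y]⟦t⟧.ℚ[y].Xᴾ) ≈ 0#)
  2[1-y]≉0 eq with () ← eq 0

module ℚ[y]Roots = SeriesRoots.At ℚ[y]⟦t⟧.ℚ[y].polynomialRing ℚ[y]⟦t⟧.ℚ[y].Xᴾ
  -- ℚ[q] and ℚ[y] are the same ring of polynomials in one variable over ℚ, so the domain property
  -- of the former applies.
  (λ {x} {y} → Domain.noZeroDivisors ℚ[q].polynomialDomain {x} {y}) 2≉0 2y≉0 2[1-y]≉0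

-- The inclusion of ℚ[y][[t]] in ℚ(q)[y][[t]]

homomorphism-resp-≈ : (A B : CommutativeRing 0ℓ 0ℓ) →
  let module A = CommutativeRing A
      module B = CommutativeRing B
  in
  ∀ {f g : A.Carrier → B.Carrier} → (∀ a → g a B.≈ f a) → IsRingHomomorphism A.rawRing B.rawRing f →
  IsRingHomomorphism A.rawRing B.rawRing g
homomorphism-resp-≈ A B {f} {g} g≈f isHom = record
  { isSemiringHomomorphism = record
    { isNearSemiringHomomorphism = record
      { +-isMonoidHomomorphism = record
        { isMagmaHomomorphism = record
          { isRelHomomorphism = record { cong = λ {a} {b} a≈b → trans (g≈f a) (trans (⟦⟧-cong a≈b) (sym (g≈f b))) }
          ; homo = λ a b → trans (g≈f _) (trans (+-homo a b) (sym (+-cong (g≈f a) (g≈f b)))) }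
        ; ε-homo = trans (g≈f _) 0#-homo }
      ; *-homo = λ a b → trans (g≈f _) (trans (*-homo a b) (sym (*-cong (g≈f a) (g≈f b)))) }
    ; 1#-homo = trans (g≈f _) 1#-homo }
  ; -‿homo = λ a → trans (g≈f _) (trans (-‿homo a) (sym (-‿cong (g≈f a)))) }
  where
  open CommutativeRing B
  open IsRingHomomorphism isHom

module SeriesInclusion (K : CommutativeRing 0ℓ 0ℓ) (F : Field) {h : CommutativeRing.Carrier K → Field.Carrier F}
  (isHom : IsRingHomomorphism (CommutativeRing.rawRing K)
                              (CommutativeRing.rawRing (Field.commutativeRing F)) h) where

  private
    module Ky    = Polynomials K
    module Ky⟦t⟧ = PowerSeries Ky.polynomialRing
    module Fy    = PolynomialInverse F
    module Fy⟦t⟧ = PowerSeriesInverse Fy.polynomialRingWithInverse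
    module H     = Homomorphism {K} {Field.commutativeRing F} {h} isHom
    module Hʸ    = Homomorphism {Ky.polynomialRing} {RingWithInverse.commutativeRing Fy.polynomialRingWithInverse}
      {mapPolynomial {K} {Field.commutativeRing F} {h} isHom} H.mapPolynomial-isRingHomomorphism

  module R = RingWithInverse Fy⟦t⟧.seriesRingWithInverse

  ι : (ℕ → Ky.Polynomial) → R.Carrier
  ι f n = mapPolynomial {K} {Field.commutativeRing F} {h} isHom (f n)

  ι-isRingHomomorphism : IsRingHomomorphism (CommutativeRing.rawRing Ky⟦t⟧.seriesRing)
    (CommutativeRing.rawRing R.commutativeRing) ι
  ι-isRingHomomorphism = Hʸ.seriesMap-isRingHomomorphism

  ι-t : ι Ky⟦t⟧.X R.≈ Fy⟦t⟧.X
  ι-t = Hʸ.X-homo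

  ι-y : ι (Ky⟦t⟧.constant Ky.Xᴾ) R.≈ Fy⟦t⟧.constant Fy.Xᴾ
  ι-y = Hʸ.constant-homo {Ky.Xᴾ} {Fy.Xᴾ} H.X-homo

  scalar : Field.Carrier F → R.Carrier
  scalar = Fy⟦t⟧.constant ∘ Fy.constantᴾ

  scalar-isRingHomomorphism : IsRingHomomorphism (CommutativeRing.rawRing (Field.commutativeRing F))
    (CommutativeRing.rawRing R.commutativeRing) scalar
  scalar-isRingHomomorphism = Composition.isRingHomomorphism (λ {a} {b} {c} → R.trans {a} {b} {c})
    Fy.constantᴾ-isRingHomomorphism
    (constant-isRingHomomorphism (RingWithInverse.commutativeRing Fy.polynomialRingWithInverse))

module Inclusion where

  open ℚ⟨q⟩[y]⟦t⟧
  private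
    module Q  = CommutativeRing ℚ[q].polynomialRing
    module F  = CommutativeRing Frac[q].fractionRing
    module U  = FractionUnits ℚ[q].polynomialDomain
    module I  = SeriesInclusion ℚ.+-*-commutativeRing Frac[q].fractionField
      {Frac[q].embed ∘ ℚ[q].constantᴾ} ℚ→ℚ⟨q⟩

  opaque
    unfolding coefficients q include

    ι : ℚ[y]⟦t⟧.Carrier → Carrier
    ι = I.ι

    -- `include` itself unfolds too slowly to be compared with I.ι as a function.
    include≈ι : ∀ f → include f ≈ ι f
    include≈ι f n k = F.refl {Frac[q].embed (ℚ[q].constantᴾ (ℚ[y]⟦t⟧.ℚ[y].coeff (f n) k))}

    ι-isRingHomomorphism : IsRingHomomorphism (CommutativeRing.rawRing ℚ[y]⟦t⟧.t[[]].seriesRing)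
      (CommutativeRing.rawRing commutativeRing) ι
    ι-isRingHomomorphism = I.ι-isRingHomomorphism

    ι-t : ι ℚ[y]⟦t⟧.t ≈ t
    ι-t = I.ι-t

    ι-y : ι ℚ[y]⟦t⟧.y ≈ y
    ι-y = I.ι-y

    scalar : F.Carrier → Carrier
    scalar = I.scalar

    scalar-isRingHomomorphism : IsRingHomomorphism F.rawRing (CommutativeRing.rawRing commutativeRing) scalar
    scalar-isRingHomomorphism = I.scalar-isRingHomomorphism

    q≡scalar-X : q ≡ scalar (Frac[q].embed ℚ[q].Xᴾ)
    q≡scalar-X = ≡.refl

  include-isRingHomomorphism : IsRingHomomorphism (CommutativeRing.rawRing ℚ[y]⟦t⟧.t[[]].seriesRing)
    (CommutativeRing.rawRing commutativeRing) include
  include-isRingHomomorphism =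
    homomorphism-resp-≈ ℚ[y]⟦t⟧.t[[]].seriesRing commutativeRing include≈ι ι-isRingHomomorphism

  include-t : include ℚ[y]⟦t⟧.t ≈ t
  include-t = trans (include≈ι _) ι-t

  include-y : include ℚ[y]⟦t⟧.y ≈ y
  include-y = trans (include≈ι _) ι-y

  private
    scalar-embed-isRingHomomorphism : IsRingHomomorphism Q.rawRing (CommutativeRing.rawRing commutativeRing)
      (scalar ∘ Frac[q].embed)
    scalar-embed-isRingHomomorphism = Composition.isRingHomomorphism
      (λ {a} {b} {c} → trans {a} {b} {c}) Frac[q].embed-isRingHomomorphism scalar-isRingHomomorphism

    -- The inverse is taken in the field ℚ(q) and then carried along, so no unit of the polynomial
    -- or series ring has to be recognised.
    scalar-embed-unit : ∀ p → ¬ (p Q.≈ Q.0#) → ∃[ w ] scalar (Frac[q].embed p) * w ≈ 1#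
    scalar-embed-unit p p≉0 =
      let w , unit = U.reciprocal {p} {Frac[q].embed p} p≉0 (F.refl {Frac[q].embed p})
      in scalar w , trans (sym (*-homo (Frac[q].embed p) w))
           (trans (⟦⟧-cong {Frac[q].embed p F.* w} {F.1#} unit) 1#-homo)
      where open IsRingHomomorphism scalar-isRingHomomorphism

  [1+_]q-unit : InvertibleQNumbers coefficients q
  [1+_]q-unit = q-number-units coefficients ℚ[q].polynomialRing
    (scalar ∘ Frac[q].embed) scalar-embed-isRingHomomorphism ℚ[q].Xᴾ q≡scalar-X
    λ n → scalar-embed-unit (ℚ[q]Numbers.[1+ n ]) (ℚ[q]Numbers.[1+ n ]≉0)

-- The two identities

module RationalFunctionIdentity where

  open RationalFunctions
  open RationalFunctionUnits
  open Cancellation commutativeRing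
  open Division coefficients
  open SetoidReasoning setoid

  private
    y′ t′ : Carrier
    y′ = (1# + y) ^ 2 * t / ((y + t) * (1# + y * t))
    t′ = (y + t) / (1# + y * t)

    1+yt-invertible : (1# + y * t) * (1# + y * t) ⁻¹ ≈ 1#
    1+yt-invertible = inverseʳ (proj₂ 1+yt-unit)

    t′-eq : t′ * (1# + y * t) ≈ y + t
    t′-eq = /-* (y + t) 1+yt-invertible

    y′t′-eq : y′ * t′ * (1# + y * t) ^ 2 ≈ (1# + y) ^ 2 * t
    y′t′-eq = begin
      y′ * t′ * (1# + y * t) ^ 2
        ≈⟨ *-congˡ (*-congˡ (*-identityʳ _)) ⟩
      y′ * t′ * ((1# + y * t) * (1# + y * t))
        ≈⟨ trans (*-assoc _ _ _) (*-congˡ (sym (*-assoc _ _ _))) ⟩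
      y′ * (t′ * (1# + y * t) * (1# + y * t))
        ≈⟨ *-congˡ (*-congʳ t′-eq) ⟩
      y′ * ((y + t) * (1# + y * t))
        ≈⟨ /-* ((1# + y) ^ 2 * t) (inverseʳ (unit-* (proj₂ y+t-unit) (proj₂ 1+yt-unit))) ⟩
      (1# + y) ^ 2 * t ∎

    substitution : Substitution coefficients
    substitution = record
      { t-eq      = t′-eq
      ; yt-eq     = y′t′-eq
      ; 1-T-unit  = inverseʳ (proj₂ 1-t-unit)
      ; 1+YT-unit = 1+yt-invertible
      }

  open GeneratingFunctions coefficients q [1+_]q-unit substitution public using (expansion)

-- The relations between u, v, y and t do not involve q. They are established in ℚ[y][[t]] and
-- carried, together with the inverses, to the ring that contains the q-exponentials.
module Transport (A B : CommutativeRing 0ℓ 0ℓ) {h : CommutativeRing.Carrier A → CommutativeRing.Carrier B}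
  (isHom : IsRingHomomorphism (CommutativeRing.rawRing A) (CommutativeRing.rawRing B) h) where

  private
    module A = CommutativeRing A
    module Aˢ = RawSemiringDefinitions (Semiring.rawSemiring A.semiring)
    open CommutativeRing B
    open RawSemiringDefinitions (Semiring.rawSemiring semiring) using (_^_)
    open IsRingHomomorphism isHom

    1-homo : ∀ v → h (A.1# A.- v) ≈ 1# - h v
    1-homo v = trans (+-homo A.1# (A.- v)) (+-cong 1#-homo (-‿homo v))

    1+*-homo : ∀ u v → h (A.1# A.+ u A.* v) ≈ 1# + h u * h v
    1+*-homo u v = trans (+-homo A.1# (u A.* v)) (+-cong 1#-homo (*-homo u v))

    square : ∀ {f b} → h f ≈ b → h (f Aˢ.^ 2) ≈ b ^ 2
    square {f} hf≈b = trans (*-homo f (f A.* A.1#))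
      (*-cong hf≈b (trans (*-homo f A.1#) (*-cong hf≈b 1#-homo)))

    unit : ∀ {f g a} → h f ≈ a → f A.* g A.≈ A.1# → ∃[ w ] a * w ≈ 1#
    unit {f} {g} hf≈a fg≈1 = h g ,
      trans (*-congʳ (sym hf≈a)) (trans (sym (*-homo f g)) (trans (⟦⟧-cong fg≈1) 1#-homo))

  module _ {y t : A.Carrier} {y′ t′ : Carrier} (hy≈y′ : h y ≈ y′) (ht≈t′ : h t ≈ t′) (u v : A.Carrier) where

    t-transport : t A.* (A.1# A.+ u A.* v) A.≈ u A.+ v → t′ * (1# + h u * h v) ≈ h u + h v
    t-transport eq = trans (*-cong (sym ht≈t′) (sym (1+*-homo u v)))
      (trans (sym (*-homo _ _)) (trans (⟦⟧-cong eq) (+-homo u v)))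

    yt-transport : y A.* t A.* (A.1# A.+ u A.* v) Aˢ.^ 2 A.≈ (A.1# A.+ u) Aˢ.^ 2 A.* v →
      y′ * t′ * (1# + h u * h v) ^ 2 ≈ (1# + h u) ^ 2 * h v
    yt-transport eq = trans
      (sym (trans (*-homo _ _) (*-cong (trans (*-homo y t) (*-cong hy≈y′ ht≈t′)) (square (1+*-homo u v)))))
      (trans (⟦⟧-cong eq) (trans (*-homo _ v) (*-congʳ (square (trans (+-homo A.1# u) (+-congʳ 1#-homo))))))

    1-v-transport : ∃[ f ] (A.1# A.- v) A.* f A.≈ A.1# → ∃[ w ] (1# - h v) * w ≈ 1#
    1-v-transport (f , eq) = unit (1-homo v) eq

    1+uv-transport : ∃[ f ] (A.1# A.+ u A.* v) A.* f A.≈ A.1# → ∃[ w ] (1# + h u * h v) * w ≈ 1#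
    1+uv-transport (f , eq) = unit (1+*-homo u v) eq

module SeriesIdentity {s u₀ v₀} (root : ℚ[y]⟦t⟧.IsRoot s)
  (isU : ℚ[y]⟦t⟧.IsU s u₀) (isV : ℚ[y]⟦t⟧.IsV s v₀) where

  open ℚ⟨q⟩[y]⟦t⟧
  open Inclusion
  private
    module A = ℚ[y]⟦t⟧
    open Transport A.t[[]].seriesRing commutativeRing {include} include-isRingHomomorphism

    u v : Carrier
    u = include u₀
    v = include v₀

    t-eq : t * (1# + u * v) ≈ u + v
    t-eq = t-transport {A.y} {A.t} include-y include-t u₀ v₀ (ℚ[y]Roots.t-relation {s} root {u₀} {v₀} isU isV)

    yt-eq : y * t * (1# + u * v) ^ 2 ≈ (1# + u) ^ 2 * v
    yt-eq = yt-transport {A.y} {A.t} include-y include-t u₀ v₀ (ℚ[y]Roots.yt-relation {s} root {u₀} {v₀} isU isV)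

    1-v-unit : ∃[ w ] (1# - v) * w ≈ 1#
    1-v-unit = 1-v-transport {A.y} {A.t} include-y include-t u₀ v₀ (ℚ[y]Roots.1-v-unit {s} root {u₀} {v₀} isU isV)

    1+uv-unit : ∃[ w ] (1# + u * v) * w ≈ 1#
    1+uv-unit = 1+uv-transport {A.y} {A.t} include-y include-t u₀ v₀ (ℚ[y]Roots.1+uv-unit {s} root {u₀} {v₀} isU isV)

    substitution : Substitution coefficients
    substitution = record
      { t-eq      = t-eq
      ; yt-eq     = yt-eq
      ; 1-T-unit  = inverseʳ (proj₂ 1-v-unit)
      ; 1+YT-unit = inverseʳ (proj₂ 1+uv-unit)
      }

  open GeneratingFunctions coefficients q [1+_]q-unit substitution public using (rescaled)

theorem4p8 :
    (let open RationalFunctions in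
      constant (1# - t) x.* exp x./ (x.1# x.- constant t x.* scale y Exp x.* exp)
        x.≈
      λ n → ((1# + y * t) / (1# - t)) ^ n
              * P n ((1# + y) ^ 2 * t / ((y + t) * (1# + y * t))) ((y + t) / (1# + y * t))
              / [ n ]q!)
    ×
    ∃! ℚ[y]⟦t⟧._≈_ ℚ[y]⟦t⟧.IsRoot
    ×
    (∀ s → ℚ[y]⟦t⟧.IsRoot s →
      ∃! ℚ[y]⟦t⟧._≈_ (ℚ[y]⟦t⟧.IsU s)
      ×
      ∃! ℚ[y]⟦t⟧._≈_ (ℚ[y]⟦t⟧.IsV s)
      ×
      (∀ u₀ v₀ → ℚ[y]⟦t⟧.IsU s u₀ → ℚ[y]⟦t⟧.IsV s v₀ →
        let open ℚ⟨q⟩[y]⟦t⟧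
            u = include u₀
            v = include v₀
        in
        (λ n → P n y t / [ n ]q!)
          x.≈
        constant (1# - v) x.* scale ((1# - v) / (1# + u * v)) exp
          x./ (x.1# x.- constant v x.* scale (u * (1# - v) / (1# + u * v)) Exp
                                  x.* scale ((1# - v) / (1# + u * v)) exp)))
theorem4p8 =
    RationalFunctionIdentity.expansion
  , ℚ[y]Roots.∃!-root
  , λ s root → ℚ[y]Roots.∃!-u {s} root , ℚ[y]Roots.∃!-v {s} root
  , λ u₀ v₀ isU isV → SeriesIdentity.rescaled {s} {u₀} {v₀} root isU isV
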